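{- Let $G$ be a finite simple $2$-connected cubic graph and let $x,y$ be two distinct vertices of $G$. If $P$ is a longest $(x,y)$-path in $G$ (i.e., a path with endpoints $x$ and $y$ of maximum length among all such paths), then $P$ contains at least one internal $P$-bound vertex.
   Context: For a subgraph $H$ of a graph $G$, a vertex $v$ of $H$ is called $H$-bound if all neighbors of $v$ in $G$ lie in $H$, i.e., $N_G(v)\subseteq V(H)$. An internal vertex of a path is a vertex of the path that is not one of its endpoints. -}

module Defs where

open import Data.Nat using (ℕ; _≤_; _∸_)
open import Data.Fin using (Fin)
open import Data.Bool using (Bool; true; false)
open import Data.List using (List; []; _∷_; length)
open import Data.List.Membership.Propositional using (_∈_; _∉_)
open import Data.List.Relation.Unary.Unique.Propositional using (Unique)
open import Data.Vec using (tabulate)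
open import Data.Fin.Subset using (Subset; ∣_∣)
open import Data.Product using (Σ; _×_)
open import Relation.Binary.PropositionalEquality using (_≡_; _≢_)

record Graph (n : ℕ) : Set where
  field
    adj    : Fin n → Fin n → Bool
    sym    : ∀ u v → adj u v ≡ adj v u
    irrefl : ∀ v → adj v v ≡ false
open Graph public

module _ {n : ℕ} (G : Graph n) where

  nbhd : Fin n → Subset n
  nbhd v = tabulate (adj G v)

  degree : Fin n → ℕ
  degree v = ∣ nbhd v ∣

  Cubic : Set
  Cubic = ∀ v → degree v ≡ 3

  data Walk : Fin n → Fin n → List (Fin n) → Set where
    single : ∀ x → Walk x x (x ∷ [])
    step   : ∀ {x z y vs} → adj G x z ≡ true → Walk z y vs → Walk x y (x ∷ vs)

  IsPath : Fin n → Fin n → List (Fin n) → Set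
  IsPath x y vs = Walk x y vs × Unique vs

  pathLength : List (Fin n) → ℕ
  pathLength vs = length vs ∸ 1

  Connected : Set
  Connected = ∀ u w → Σ (List (Fin n)) λ vs → IsPath u w vs

  ConnectedWithout : Fin n → Set
  ConnectedWithout z = ∀ u w → u ≢ z → w ≢ z →
    Σ (List (Fin n)) λ vs → IsPath u w vs × z ∉ vs

  TwoConnected : Set
  TwoConnected = (3 ≤ n) × Connected × (∀ z → ConnectedWithout z)

  LongestPath : Fin n → Fin n → List (Fin n) → Set
  LongestPath x y vs = IsPath x y vs ×
    (∀ ws → IsPath x y ws → pathLength ws ≤ pathLength vs)

  Bound : List (Fin n) → Fin n → Set
  Bound vs v = v ∈ vs × (∀ w → adj G v w ≡ true → w ∈ vs)

  Internal : Fin n → Fin n → List (Fin n) → Fin n → Set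
  Internal x y vs v = v ∈ vs × v ≢ x × v ≢ y

{-# OPTIONS --safe #-}
module Submission where

-- Suppose that every internal vertex of P has a neighbour off P. It is then unique, and the internal
-- vertices fall into classes according to the component of G − P to which they are attached. Two
-- members of a class are joined by a detour through the component, so they are not consecutive on P.
-- Give each class a hub: x or y if it is attached to the component; in a class of two, each member is
-- the hub of the other (and the detour has at least two inner vertices, as G has no cut vertex);
-- in a larger class a member, chosen so that no two of these hubs, x and y are consecutive on P. Such a
-- choice exists because a class has three members and only two vertices are excluded: a set of more
-- than 3s vertices of a path has no independence homology in s-sets, so a Sperner argument applies.
--
-- Add to P an edge from every other internal vertex to its hub. All vertices except the chosen hubs
-- then have odd degree 3, and a lollipop argument gives a second x-y-path Q ≠ P through all vertices of
-- odd degree. Counting dropped edges, Q misses at most as many hubs as it has edges between members of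
-- classes of two. Replacing the new edges by detours gives a path of G longer than P, unless Q visits
-- every vertex of P and passes a hub, whenever it uses a new edge there, by two new edges b-a-c (which
-- become a detour from b to c that skips a). In that case let h be the first vertex at which P, read from x,
-- leaves Q. Keeping only the new edges on Q, and making h the hub of all other vertices, the same
-- argument on the part of P from h to y gives another such path that agrees with P up to h, and
-- the common part grows for ever.

open import Defs renaming (sym to adj-sym; irrefl to adj-irrefl)
open import Data.Nat using (ℕ; zero; suc; _+_; _*_; _∸_; _≤_; _<_; _≤?_; z≤n; s≤s)
open import Data.Nat.Properties
  using (≤-refl; ≤-trans; ≤-reflexive; n≤1+n; m≤m+n; 1+n≰n; <-irrefl; suc-injective; +-comm; +-assoc; +-suc; +-identityʳ;
         +-mono-≤; +-monoˡ-≤; +-monoʳ-≤; +-cancelʳ-≤; *-suc; *-comm; module ≤-Reasoning)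
open import Data.Fin using (Fin; zero; suc)
import Data.Fin.Properties as Fin
open import Data.Fin.Subset using (∣_∣)
open import Data.Bool using (Bool; true; false; _∧_; _∨_; not; _xor_; if_then_else_)
import Data.Bool.Properties as Bool
open import Data.List
  using (List; []; _∷_; _++_; length; map; concatMap; reverse; allFin; deduplicate; cartesianProduct; foldr; filter; drop;
         initLast; _∷ʳ′_)
import Data.List as List
import Data.List.Properties as List
open import Data.List.Membership.Propositional using (_∈_; _∉_)
open import Data.List.Membership.Propositional.Properties
import Data.List.Membership.DecPropositional as DecMembership
open import Data.List.Relation.Unary.Any using (here; there)
import Data.List.Relation.Unary.Any as Any
open import Data.List.Relation.Unary.All using ([]; _∷_)
import Data.List.Relation.Unary.All as All
open import Data.List.Relation.Unary.AllPairs using ([]; _∷_)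
open import Data.List.Relation.Unary.Unique.Propositional using (Unique)
import Data.List.Relation.Unary.Unique.Propositional.Properties as Unique
import Data.List.Relation.Unary.Unique.DecPropositional as DecUnique
import Data.List.Relation.Unary.Unique.DecPropositional.Properties as DecUniqueProperties
open import Data.List.Relation.Binary.Permutation.Propositional using (_↭_; ↭-sym; ↭⇒↭ₛ)
import Data.List.Relation.Binary.Permutation.Propositional.Properties as ↭
import Data.List.Relation.Binary.Permutation.Setoid.Properties as ↭ₛ
open import Data.Vec using (Vec; []; _∷_; lookup)
import Data.Vec as Vec
import Data.Vec.Properties as Vec
open import Data.Product using (Σ; _×_; _,_; proj₁; proj₂)
import Data.Product as Product
open import Data.Product.Properties using (≡-dec)
open import Data.Sum using (_⊎_; inj₁; inj₂)
import Data.Sum as Sum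
open import Data.Unit using (⊤; tt)
open import Data.Empty using (⊥; ⊥-elim)
open import Function using (_∘_)
open import Relation.Nullary
open import Relation.Nullary.Decidable using (decidable-stable)
open import Relation.Binary using (DecidableEquality)
open import Relation.Binary.PropositionalEquality

-- Lists and parity sums

-- The new edges of one component all meet in its hub, or form the single edge of a pair, so a path
-- uses at most two of them, and two only in succession. This is why a class gets a star and not
-- some other set of edges: detours through one component cannot collide.
--
-- Keeping the hubs nonconsecutive makes them independent in the enlarged graph, because a new edge
-- starts at a vertex that is no chosen hub. On a path from x to y every hub but the last is then
-- followed by another vertex, which ties the number of hubs visited to the numbers of other
-- vertices and of steps avoiding hubs. A hub can be missed only against an additional step between
-- two non-hubs, and off P such a step is a pair edge. The first inner vertex of its detour pays for
-- the hub, the second makes the path longer.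
--
-- The obstacle is the passage through a hub by two new edges: its detour may gain exactly the one
-- vertex that it skips. Such a Q yields no longer path by itself, but it drops no edge of P between
-- two non-hubs, and this rigidity is what the repeated argument on the end of P exploits.

private variable
  A : Set

unique-↭ : {xs ys : List A} → xs ↭ ys → Unique xs → Unique ys
unique-↭ p = ↭ₛ.AllPairs-resp-↭ (setoid _) (λ ne e → ne (sym e)) ((λ { refl h → h }) , λ { refl h → h }) (↭⇒↭ₛ p)

∷-unique : {a : A} {xs : List A} → a ∉ xs → Unique xs → Unique (a ∷ xs)
∷-unique a∉ u = All.tabulate (λ h e → a∉ (subst (_∈ _) (sym e) h)) ∷ u

head∉ : {a : A} {xs : List A} → Unique (a ∷ xs) → a ∉ xs
head∉ = Unique.Unique[x∷xs]⇒x∉xs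

tail-unique : {a : A} {xs : List A} → Unique (a ∷ xs) → Unique xs
tail-unique (_ ∷ u) = u

drop-unique : (xs : List A) {ys : List A} → Unique (xs ++ ys) → Unique ys
drop-unique []       u       = u
drop-unique (_ ∷ xs) (_ ∷ u) = drop-unique xs u

unique-disjoint : (xs : List A) {ys : List A} {a : A} → Unique (xs ++ ys) → a ∈ xs → a ∉ ys
unique-disjoint (x ∷ xs) u (here refl) h = head∉ u (∈-++⁺ʳ xs h)
unique-disjoint (x ∷ xs) (_ ∷ u) (there i) h = unique-disjoint xs u i h

unique-⊆-length : {xs : List A} (ys : List A) → Unique xs → (∀ {a} → a ∈ xs → a ∈ ys) → length xs ≤ length ys
unique-⊆-length {xs = []}     ys u sub = z≤n
unique-⊆-length {xs = x ∷ xs} ys u sub with ∈-∃++ (sub (here refl))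
... | as , bs , refl = ≤-trans (s≤s (unique-⊆-length (as ++ bs) (tail-unique u) sub′))
        (≤-reflexive (sym (↭.↭-length (↭.shift x as bs))))
  where
  sub′ : ∀ {a} → a ∈ xs → a ∈ as ++ bs
  sub′ h with ↭.∈-resp-↭ (↭.shift x as bs) (sub (there h))
  ... | here refl = ⊥-elim (head∉ u h)
  ... | there q   = q

⨁ : List A → (A → Bool) → Bool
⨁ xs f = foldr (λ a b → f a xor b) false xs

⨁-cong : (xs : List A) {f g : A → Bool} → (∀ a → a ∈ xs → f a ≡ g a) → ⨁ xs f ≡ ⨁ xs g
⨁-cong []       h = refl
⨁-cong (x ∷ xs) h = cong₂ _xor_ (h x (here refl)) (⨁-cong xs (λ a i → h a (there i)))

⨁-false : (xs : List A) {f : A → Bool} → (∀ a → a ∈ xs → f a ≡ false) → ⨁ xs f ≡ false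
⨁-false []       h = refl
⨁-false (x ∷ xs) h rewrite h x (here refl) = ⨁-false xs (λ a i → h a (there i))

xor-interchange : ∀ a b c d → (a xor b) xor (c xor d) ≡ (a xor c) xor (b xor d)
xor-interchange false false c d = refl
xor-interchange false true  false d = refl
xor-interchange false true  true  d = refl
xor-interchange true  false false d = refl
xor-interchange true  false true  false = refl
xor-interchange true  false true  true = refl
xor-interchange true  true  false false = refl
xor-interchange true  true  false true = refl
xor-interchange true  true  true  false = refl
xor-interchange true  true  true  true = refl

⨁-xor : (xs : List A) (f g : A → Bool) → ⨁ xs (λ a → f a xor g a) ≡ ⨁ xs f xor ⨁ xs g
⨁-xor []       f g = refl
⨁-xor (x ∷ xs) f g = trans (cong ((f x xor g x) xor_) (⨁-xor xs f g)) (xor-interchange (f x) (g x) _ _)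

⨁-single : (xs : List A) {f : A → Bool} {a : A} → Unique xs → a ∈ xs → (∀ b → b ∈ xs → b ≢ a → f b ≡ false) → ⨁ xs f ≡ f a
⨁-single (x ∷ xs) {f} u (here refl) h =
  trans (cong (f x xor_) (⨁-false xs (λ b i → h b (there i) λ { refl → head∉ u i }))) (Bool.xor-identityʳ (f x))
⨁-single (x ∷ xs) u (there i) h rewrite h x (here refl) (λ { refl → head∉ u i }) = ⨁-single xs (tail-unique u) i (λ b j → h b (there j))

-- Off the diagonal every entry cancels against its mirror image.
⨁-symmetric : (xs : List A) (r : A → A → Bool) → (∀ a b → a ∈ xs → b ∈ xs → r a b ≡ r b a) →
              (∀ a → a ∈ xs → r a a ≡ false) → ⨁ xs (λ a → ⨁ xs (r a)) ≡ false
⨁-symmetric []       r s i = refl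
⨁-symmetric (x ∷ xs) r s i
  rewrite i x (here refl)
        | ⨁-xor xs (λ a → r a x) (λ a → ⨁ xs (r a))
        | ⨁-cong xs (λ b h → s x b (here refl) (there h))
        | ⨁-symmetric xs r (λ a b h h′ → s a b (there h) (there h′)) (λ a h → i a (there h))
        | Bool.xor-identityʳ (⨁ xs (λ a → r a x)) = Bool.xor-same (⨁ xs (λ a → r a x))

-- The matrix `r` of the graph of `ι` has the values of `f` as row sums. It is symmetric because `ι`
-- is an involution on the support of `f`, and its diagonal vanishes because `ι` has no fixed point
-- there. No representatives of the orbits have to be chosen.
⨁-involution : DecidableEquality A → (xs : List A) → Unique xs → (f : A → Bool) (ι : A → A) →
  (∀ a → a ∈ xs → f a ≡ true → ι a ∈ xs × f (ι a) ≡ true × ι (ι a) ≡ a × ι a ≢ a) → ⨁ xs f ≡ false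
⨁-involution _≟_ xs u f ι h = trans (⨁-cong xs row) (⨁-symmetric xs r symm diag)
  where
  r : _ → _ → Bool
  r a b = f a ∧ ⌊ b ≟ ι a ⌋
  row : ∀ a → a ∈ xs → f a ≡ ⨁ xs (r a)
  row a i with f a in eq
  ... | false = sym (⨁-false xs (λ _ _ → refl))
  ... | true  = sym (trans (⨁-single xs u (proj₁ (h a i eq)) off) on)
    where
    off : ∀ b → b ∈ xs → b ≢ ι a → ⌊ b ≟ ι a ⌋ ≡ false
    off b _ ne with b ≟ ι a
    ... | yes e = ⊥-elim (ne e)
    ... | no _  = refl
    on : ⌊ ι a ≟ ι a ⌋ ≡ true
    on with ι a ≟ ι a
    ... | yes _ = refl
    ... | no ne = ⊥-elim (ne refl)
  to : ∀ a b → a ∈ xs → r a b ≡ true → r b a ≡ true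
  to a b i e with f a in eq
  to a b i e | true with b ≟ ι a
  to a .(ι a) i e | true | yes refl rewrite proj₁ (proj₂ (h a i eq)) with a ≟ ι (ι a)
  ... | yes _ = refl
  ... | no ne = ⊥-elim (ne (sym (proj₁ (proj₂ (proj₂ (h a i eq))))))
  symm : ∀ a b → a ∈ xs → b ∈ xs → r a b ≡ r b a
  symm a b i j with r a b in e₁ | r b a in e₂
  ... | true  | true  = refl
  ... | false | false = refl
  ... | true  | false = trans (sym (to a b i e₁)) e₂
  ... | false | true  = trans (sym e₁) (to b a j e₂)
  diag : ∀ a → a ∈ xs → r a a ≡ false
  diag a i with f a in eq
  ... | false = refl
  ... | true with a ≟ ι a
  ...   | yes e = ⊥-elim (proj₂ (proj₂ (proj₂ (h a i eq))) (sym e))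
  ...   | no _  = refl

another : DecidableEquality A → (xs : List A) → Unique xs → (f : A → Bool) → ⨁ xs f ≡ false → ∀ {a} → a ∈ xs → f a ≡ true →
          Σ A λ b → b ∈ xs × f b ≡ true × b ≢ a
another _≟_ xs u f e {a} i t = search xs contra
  where
  -- The search carries a refutation of the claim that all remaining entries other than `a` are
  -- false, so the end of the list is absurd.
  search : ∀ ys → ((∀ b → b ∈ ys → b ≢ a → f b ≡ false) → ⊥) → Σ _ λ b → b ∈ ys × f b ≡ true × b ≢ a
  search []       k = ⊥-elim (k λ _ ())
  search (y ∷ ys) k with f y in eq | y ≟ a
  ... | true | no ne = y , here refl , eq , ne
  ... | true | yes refl with search ys (λ g → k λ { b (here refl) ne → ⊥-elim (ne refl) ; b (there j) ne → g b j ne })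
  ...   | b , j , q = b , there j , q
  search (y ∷ ys) k | false | _ with search ys (λ g → k λ { b (here refl) ne → eq ; b (there j) ne → g b j ne })
  ...   | b , j , q = b , there j , q
  contra : (∀ b → b ∈ xs → b ≢ a → f b ≡ false) → ⊥
  contra g with () ← trans (sym t) (trans (sym (⨁-single xs u i g)) e)

⨁-product : {B : Set} (xs : List A) (ys : List B) (f : A × B → Bool) →
            ⨁ (cartesianProduct xs ys) f ≡ ⨁ xs (λ a → ⨁ ys (λ b → f (a , b)))
⨁-product [] ys f = refl
⨁-product (x ∷ xs) ys f = trans (split (map (x ,_) ys) _ ) (cong₂ _xor_ (mapped ys) (⨁-product xs ys f))
  where
  split : ∀ as bs → ⨁ (as ++ bs) f ≡ ⨁ as f xor ⨁ bs f
  split []       bs = refl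
  split (a ∷ as) bs = trans (cong (f a xor_) (split as bs)) (sym (Bool.xor-assoc (f a) _ _))
  mapped : ∀ bs → ⨁ (map (x ,_) bs) f ≡ ⨁ bs (λ b → f (x , b))
  mapped []       = refl
  mapped (b ∷ bs) = cong (f (x , b) xor_) (mapped bs)

-- Paths through all vertices of odd degree

module _ {n : ℕ} where
  open DecMembership (Fin._≟_ {n}) using (_∈?_) public
  open DecUnique (Fin._≟_ {n}) using (unique?) public

lists : {A : Set} → List A → ℕ → List (List A)
lists as zero    = [] ∷ []
lists as (suc k) = [] ∷ concatMap (λ a → map (a ∷_) (lists as k)) as

∈-lists : {A : Set} (as : List A) (k : ℕ) (xs : List A) → (∀ {a} → a ∈ xs → a ∈ as) → length xs ≤ k → xs ∈ lists as k
∈-lists as zero    []       h l = here refl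
∈-lists as (suc k) []       h l = here refl
∈-lists as (suc k) (x ∷ xs) h (s≤s l) = there (∈-concatMap⁺ (λ a → map (a ∷_) (lists as k))
  (Any.map (λ { refl → ∈-map⁺ (x ∷_) (∈-lists as k xs (h ∘ there) l) }) (h (here refl))))

module _ {n : ℕ} {Γ : Graph n} where

  walk-head : ∀ {u y v vs} → Walk Γ u y (v ∷ vs) → u ≡ v
  walk-head (single _) = refl
  walk-head (step _ _) = refl

  walk-first : ∀ {u y vs} → Walk Γ u y vs → u ∈ vs
  walk-first (single _) = here refl
  walk-first (step _ _) = here refl

  walk-last : ∀ {u y vs} → Walk Γ u y vs → y ∈ vs
  walk-last (single _) = here refl
  walk-last (step _ w) = there (walk-last w)

  walk? : ∀ u y vs → Dec (Walk Γ u y vs)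
  walk? u y [] = no λ ()
  walk? u y (v ∷ []) with u Fin.≟ v | y Fin.≟ v
  ... | yes refl | yes refl = yes (single _)
  ... | no ne    | _        = no (ne ∘ walk-head)
  ... | _        | no ne    = no λ { (single _) → ne refl }
  walk? u y (v ∷ v′ ∷ vs) with u Fin.≟ v | adj Γ u v′ Bool.≟ true | walk? v′ y (v′ ∷ vs)
  ... | no ne    | _     | _     = no (ne ∘ walk-head)
  ... | _        | no na | _     = no λ { (step a w) → na (subst (λ t → adj Γ u t ≡ true) (walk-head w) a) }
  ... | _        | _     | no nw = no λ { (step a w) → nw (subst (λ t → Walk Γ t y (v′ ∷ vs)) (walk-head w) w) }
  ... | yes refl | yes a | yes w = yes (step a w)

  walk-tail : ∀ {u y v v′ vs} → Walk Γ u y (v ∷ v′ ∷ vs) → adj Γ v v′ ≡ true × Walk Γ v′ y (v′ ∷ vs)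
  walk-tail (step a w) with walk-head w
  ... | refl = a , w

  rotate : ∀ {a acc y} mid {s rest y′} → Walk Γ a y′ (a ∷ mid ++ s ∷ rest) → Walk Γ a y (a ∷ acc) →
           Walk Γ s y (s ∷ reverse mid ++ a ∷ acc)
  rotate {a} [] {s} w w′ = step (trans (adj-sym Γ s a) (proj₁ (walk-tail w))) w′
  rotate {a} {acc} {y} (m ∷ mid) {s} w w′ =
    subst (λ t → Walk Γ s y (s ∷ t)) eq
      (rotate mid (proj₂ (walk-tail w)) (step (trans (adj-sym Γ m a) (proj₁ (walk-tail w))) w′))
    where
    eq : reverse mid ++ m ∷ a ∷ acc ≡ reverse (m ∷ mid) ++ a ∷ acc
    eq = trans (sym (List.++-assoc (reverse mid) (m ∷ []) (a ∷ acc))) (cong (_++ a ∷ acc) (sym (List.unfold-reverse m mid)))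

  walk-from : ∀ {u y v} vs {ws} → Walk Γ u y (vs ++ v ∷ ws) → Walk Γ v y (v ∷ ws)
  walk-from []           w with walk-head w
  ... | refl = w
  walk-from (_ ∷ [])     w = proj₂ (walk-tail w)
  walk-from (_ ∷ v ∷ vs) w = walk-from (v ∷ vs) (proj₂ (walk-tail w))

-- Moves at the front of a path

cut : ∀ {n} → Fin n → List (Fin n) → List (Fin n) × List (Fin n)
cut w []       = [] , []
cut w (a ∷ as) with w Fin.≟ a
... | yes _ = [] , a ∷ as
... | no _  = a ∷ proj₁ (cut w as) , proj₂ (cut w as)

cut-at : ∀ {n} {w : Fin n} pre {post} → w ∉ pre → cut w (pre ++ w ∷ post) ≡ (pre , w ∷ post)
cut-at {w = w} [] h with w Fin.≟ w
... | yes _ = refl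
... | no ne = ⊥-elim (ne refl)
cut-at {w = w} (a ∷ pre) {post} h with w Fin.≟ a
... | yes refl = ⊥-elim (h (here refl))
... | no _ rewrite cut-at pre {post} (h ∘ there) = refl

cut-∉ : ∀ {n} {w : Fin n} as → w ∉ as → cut w as ≡ (as , [])
cut-∉ [] h = refl
cut-∉ {w = w} (a ∷ as) h with w Fin.≟ a
... | yes refl = ⊥-elim (h (here refl))
... | no _ rewrite cut-∉ as (h ∘ there) = refl

Flag : ℕ → Set
Flag n = List (Fin n) × Fin n

-- The move at the first vertex z of a path along the edge zw: prepend w if it is new, drop z if w
-- comes directly after it, and otherwise rotate.
moveCut : ∀ {n} → Fin n → List (Fin n) → List (Fin n) × List (Fin n) → Flag n
moveCut w []      _            = [] , w
moveCut w (z ∷ Q) (_ , [])     = w ∷ z ∷ Q , z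
moveCut w (z ∷ Q) (_ ∷ [] , w′ ∷ R) = w′ ∷ R , z
moveCut w (z ∷ Q) (pre , R)    = reverse pre ++ R , w

move : ∀ {n} → Flag n → Flag n
move (Q , w) = moveCut w Q (cut w Q)

-- The cases in which `move` computes: `extend` and `shorten` are inverse to each other, `rot` to
-- itself.
data Shape {n} : List (Fin n) → Fin n → Set where
  extend : ∀ {z Q w} → w ∉ z ∷ Q → Shape (z ∷ Q) w
  shorten : ∀ {z w R} → w ≢ z → Shape (z ∷ w ∷ R) w
  rot    : ∀ {z mid s w R} → w ∉ z ∷ mid ++ s ∷ [] → Shape (z ∷ mid ++ s ∷ w ∷ R) w

shape : ∀ {n} (z : Fin n) Q w → Unique (z ∷ Q) → w ≢ z → Shape (z ∷ Q) w
shape z Q w u ne with w ∈? Q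
... | no w∉ = extend λ { (here e) → ne e ; (there i) → w∉ i }
... | yes i with ∈-∃++ i
...   | as , R , refl with initLast as
...     | [] = shorten ne
...     | mid ∷ʳ′ s = subst (λ t → Shape (z ∷ t) w) (sym (List.++-assoc mid (s ∷ []) (w ∷ R)))
            (rot λ j → unique-disjoint (z ∷ mid ++ s ∷ []) u j (here refl))

move-extend : ∀ {n} {z : Fin n} {Q w} → w ∉ z ∷ Q → move (z ∷ Q , w) ≡ (w ∷ z ∷ Q , z)
move-extend h rewrite cut-∉ _ h = refl

move-drop : ∀ {n} {z w : Fin n} {R} → w ≢ z → move (z ∷ w ∷ R , w) ≡ (w ∷ R , z)
move-drop {z = z} {w} {R} ne = cong (moveCut w _) (cut-at (z ∷ []) λ { (here e) → ne e })

reverse-mid : ∀ {A : Set} (z : A) mid s T → reverse (z ∷ mid ++ s ∷ []) ++ T ≡ s ∷ reverse mid ++ z ∷ T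
reverse-mid z mid s T = trans
  (cong (_++ T) (trans (List.unfold-reverse z (mid ++ s ∷ [])) (cong (_++ z ∷ []) (List.reverse-++ mid (s ∷ [])))))
  (cong (s ∷_) (List.++-assoc (reverse mid) (z ∷ []) T))

move-rot : ∀ {n} {z : Fin n} mid {s w R} → w ∉ z ∷ mid ++ s ∷ [] →
           move (z ∷ mid ++ s ∷ w ∷ R , w) ≡ (s ∷ reverse mid ++ z ∷ w ∷ R , w)
move-rot {z = z} mid {s} {w} {R} h = trans (cong (moveCut w _) cut-eq) (trans (rev mid) (cong (_, w) (reverse-mid z mid s (w ∷ R))))
  where
  cut-eq : cut w (z ∷ mid ++ s ∷ w ∷ R) ≡ (z ∷ mid ++ s ∷ [] , w ∷ R)
  cut-eq = trans (cong (λ t → cut w (z ∷ t)) (sym (List.++-assoc mid (s ∷ []) (w ∷ R)))) (cut-at (z ∷ mid ++ s ∷ []) h)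
  rev : ∀ m → moveCut w (z ∷ mid ++ s ∷ w ∷ R) (z ∷ m ++ s ∷ [] , w ∷ R) ≡ (reverse (z ∷ m ++ s ∷ []) ++ w ∷ R , w)
  rev []      = refl
  rev (_ ∷ _) = refl


∧-true : ∀ {a b} → a ∧ b ≡ true → a ≡ true × b ≡ true
∧-true {true} {true} _ = refl , refl

⌊⌋-true : {P : Set} (d : Dec P) → P → ⌊ d ⌋ ≡ true
⌊⌋-true (yes _) p = refl
⌊⌋-true (no np) p = ⊥-elim (np p)

⌊⌋-false : {P : Set} (d : Dec P) → ¬ P → ⌊ d ⌋ ≡ false
⌊⌋-false (yes p) np = ⊥-elim (np p)
⌊⌋-false (no _)  np = refl

true-⌊⌋ : {P : Set} (d : Dec P) → ⌊ d ⌋ ≡ true → P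
true-⌊⌋ (yes p) e = p

odd : ∀ {n} → Graph n → Fin n → Bool
odd {n} Γ v = ⨁ (allFin n) (adj Γ v)

CoversOdd : ∀ {n} → Graph n → Fin n → Fin n → List (Fin n) → Set
CoversOdd Γ x y Q = ∀ v → odd Γ v ≡ true → v ≢ x → v ≢ y → v ∈ Q

module _ {n : ℕ} (Γ : Graph n) (x y : Fin n) where

  -- What remains of a path from `x` to `y` when its first vertex is removed, except that the front
  -- need not be adjacent to `x`.
  State : List (Fin n) → Set
  State Q = Σ (Fin n) λ z → Walk Γ z y Q × Unique Q × x ∉ Q × CoversOdd Γ x y Q

  state? : ∀ Q → Dec (State Q)
  state? [] = no λ { (_ , () , _) }
  state? (z ∷ Q) with walk? {Γ = Γ} z y (z ∷ Q) ×-dec unique? (z ∷ Q) ×-dec ¬? (x ∈? (z ∷ Q)) ×-dec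
                      Fin.all? (λ v → (odd Γ v Bool.≟ true) →-dec ¬? (v Fin.≟ x) →-dec ¬? (v Fin.≟ y) →-dec (v ∈? (z ∷ Q)))
  ... | yes s = yes (z , s)
  ... | no ns = no λ { (z′ , w , s) → ns (subst (λ t → Walk Γ t y (z ∷ Q)) (walk-head w) w , s) }

  -- A move must not run into `x`, and the edge to the second vertex `p`, along which `z` would be
  -- dropped, is open only if `z` has even degree.
  allowed : Fin n → Fin n → Fin n → Bool
  allowed z p w = adj Γ z w ∧ (not ⌊ w Fin.≟ x ⌋ ∧ not (⌊ w Fin.≟ p ⌋ ∧ odd Γ z))

  valid : Flag n → Bool
  valid (z ∷ p ∷ Q , w) = ⌊ state? (z ∷ p ∷ Q) ⌋ ∧ allowed z p w
  valid _               = false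

  closing : List (Fin n) → Bool
  closing (z ∷ p ∷ Q) = ⌊ state? (z ∷ p ∷ Q) ⌋ ∧ adj Γ z x
  closing _           = false

  allowed-true : ∀ {z p w} → allowed z p w ≡ true → adj Γ z w ≡ true × w ≢ x × (w ≡ p → odd Γ z ≡ false)
  allowed-true {z} {p} {w} e with ∧-true {adj Γ z w} e
  ... | a , e′ with w Fin.≟ x | w Fin.≟ p | odd Γ z
  ...   | no ne | yes _ | false = a , ne , λ _ → refl
  ...   | no ne | no np | b     = a , ne , λ q → ⊥-elim (np q)

  true-allowed : ∀ {z p w} → adj Γ z w ≡ true → w ≢ x → (w ≡ p → odd Γ z ≡ false) → allowed z p w ≡ true
  true-allowed {z} {p} {w} a ne h rewrite a | ⌊⌋-false (w Fin.≟ x) ne with w Fin.≟ p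
  ... | no _  = refl
  ... | yes e rewrite h e = refl

  -- Modulo two, `z` has `odd Γ z` neighbours; `x` is excluded if it is one of them, and `p`, which
  -- always is one, is excluded exactly if `z` is odd. The two occurrences of `odd Γ z` cancel.
  row : ∀ z p Q → ⨁ (allFin n) (λ w → valid (z ∷ p ∷ Q , w)) ≡ closing (z ∷ p ∷ Q)
  row z p Q with state? (z ∷ p ∷ Q)
  ... | no _ = ⨁-false (allFin n) (λ _ _ → refl)
  ... | yes (z′ , wk , u , x∉ , cov) = begin
    ⨁ (allFin n) (allowed z p)
      ≡⟨ ⨁-cong (allFin n) (λ w _ → pointwise w) ⟩
    ⨁ (allFin n) (λ w → adj Γ z w xor (⌊ w Fin.≟ x ⌋ ∧ adj Γ z x xor ⌊ w Fin.≟ p ⌋ ∧ odd Γ z))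
      ≡⟨ ⨁-xor (allFin n) (adj Γ z) _ ⟩
    odd Γ z xor ⨁ (allFin n) (λ w → ⌊ w Fin.≟ x ⌋ ∧ adj Γ z x xor ⌊ w Fin.≟ p ⌋ ∧ odd Γ z)
      ≡⟨ cong (odd Γ z xor_) (⨁-xor (allFin n) (λ w → ⌊ w Fin.≟ x ⌋ ∧ adj Γ z x) (λ w → ⌊ w Fin.≟ p ⌋ ∧ odd Γ z)) ⟩
    odd Γ z xor (⨁ (allFin n) (λ w → ⌊ w Fin.≟ x ⌋ ∧ adj Γ z x) xor ⨁ (allFin n) (λ w → ⌊ w Fin.≟ p ⌋ ∧ odd Γ z))
      ≡⟨ cong (odd Γ z xor_) (cong₂ _xor_ (indicator x _) (indicator p _)) ⟩
    odd Γ z xor (adj Γ z x xor odd Γ z)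
      ≡⟨ cancel (odd Γ z) (adj Γ z x) ⟩
    adj Γ z x ∎
    where
    open ≡-Reasoning
    cancel : ∀ a b → a xor (b xor a) ≡ b
    cancel false false = refl
    cancel false true  = refl
    cancel true  false = refl
    cancel true  true  = refl
    indicator : ∀ v b → ⨁ (allFin n) (λ w → ⌊ w Fin.≟ v ⌋ ∧ b) ≡ b
    indicator v b = trans (⨁-single (allFin n) (Unique.allFin⁺ n) (∈-allFin v)
        (λ w _ ne → cong (_∧ b) (⌊⌋-false (w Fin.≟ v) ne)))
      (cong (_∧ b) (⌊⌋-true (v Fin.≟ v) refl))
    pointwise : ∀ w → allowed z p w ≡ adj Γ z w xor (⌊ w Fin.≟ x ⌋ ∧ adj Γ z x xor ⌊ w Fin.≟ p ⌋ ∧ odd Γ z)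
    pointwise w with w Fin.≟ x | w Fin.≟ p
    ... | yes refl | yes refl = ⊥-elim (x∉ (there (here refl)))
    ... | no _     | yes refl rewrite proj₁ (walk-tail wk) = refl
    ... | yes refl | no _ = pt (adj Γ z w)
      where pt : ∀ b → b ∧ false ≡ b xor (b xor false)
            pt false = refl
            pt true = refl
    ... | no _     | no _ = pt (adj Γ z w)
      where pt : ∀ b → b ∧ true ≡ b xor false
            pt false = refl
            pt true = refl

  module _ (o : Fin n) (odd-o : odd Γ o ≡ true) (o≢x : o ≢ x) (o≢y : o ≢ y) where

    -- Covering `o` rules out the path consisting of `y` alone, on which `valid` is false and which
    -- therefore must not be the result of a move.
    state-length : ∀ {Q} → State Q → Σ (Fin n) λ z → Σ (Fin n) λ p → Σ (List (Fin n)) λ R → Q ≡ z ∷ p ∷ R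
    state-length {z ∷ p ∷ R} s = z , p , R , refl
    state-length {z ∷ []} (_ , single _ , _ , _ , cov) with cov o odd-o o≢x o≢y
    ... | here refl = ⊥-elim (o≢y refl)

    valid-intro : ∀ {z Q w} → State (z ∷ Q) → adj Γ z w ≡ true → w ≢ x → (∀ R → Q ≡ w ∷ R → odd Γ z ≡ false) →
                  valid (z ∷ Q , w) ≡ true
    valid-intro {z} {Q} {w} s a ne h with state-length s
    ... | _ , p , R , refl rewrite ⌊⌋-true (state? (z ∷ p ∷ R)) s = true-allowed a ne (λ { refl → h R refl })

    valid-elim : ∀ {Q w} → valid (Q , w) ≡ true →
                 Σ (Fin n) λ z → Σ (List (Fin n)) λ R → Q ≡ z ∷ R × State Q × adj Γ z w ≡ true × w ≢ x ×
                 (∀ R′ → R ≡ w ∷ R′ → odd Γ z ≡ false)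
    valid-elim {z ∷ p ∷ R} {w} e with ∧-true {⌊ state? (z ∷ p ∷ R) ⌋} e
    ... | e₁ , e₂ with allowed-true {z} {p} {w} e₂
    ...   | a , ne , h = z , p ∷ R , refl , true-⌊⌋ (state? (z ∷ p ∷ R)) e₁ , a , ne , λ { R′ refl → h refl }

    move-valid : ∀ Q w → valid (Q , w) ≡ true →
                 valid (move (Q , w)) ≡ true × move (move (Q , w)) ≡ (Q , w) × move (Q , w) ≢ (Q , w)
    move-valid Q w v with valid-elim {Q} v
    ... | z , R , refl , s@(z′ , wk , u , x∉ , cov) , a , w≢x , par with walk-head wk
    ... | refl = go (shape z R w u w≢z) s par
      where
      w≢z : w ≢ z
      w≢z refl with () ← trans (sym a) (adj-irrefl Γ z)
      go : ∀ {Q} → Shape Q w → ∀ {R} → {{Q ≡ z ∷ R}} → State Q → (∀ R′ → R ≡ w ∷ R′ → odd Γ z ≡ false) →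
           valid (move (Q , w)) ≡ true × move (move (Q , w)) ≡ (Q , w) × move (Q , w) ≢ (Q , w)
      go (extend {_} {Q} w∉) {{refl}} (z′ , wk , u , x∉ , cov) par with walk-head wk
      ... | refl rewrite move-extend w∉ =
        valid-intro (w , step (trans (adj-sym Γ w z) a) wk , ∷-unique w∉ u ,
                      (λ { (here e) → w≢x (sym e) ; (there i) → x∉ i }) , λ v o p q → there (cov v o p q))
          (trans (adj-sym Γ w z) a) (λ { refl → x∉ (here refl) }) (λ _ _ → even) ,
        move-drop (λ e → w≢z (sym e)) ,
        λ e → w≢z (sym (cong proj₂ e))
        where
        -- A vertex missed by a covering path and different from `x` and `y` has even degree, so the
        -- inverse move, which drops `w` again, is allowed.
        even : odd Γ w ≡ false
        even with odd Γ w in eq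
        ... | false = refl
        ... | true  = ⊥-elim (w∉ (cov w eq w≢x λ { refl → w∉ (walk-last wk) }))
      go (shorten {R = R} _) {{refl}} (z′ , wk , u , x∉ , cov) par with walk-head wk
      ... | refl rewrite move-drop {R = R} w≢z =
        valid-intro (w , proj₂ (walk-tail wk) , tail-unique u , (λ i → x∉ (there i)) , cov′)
          (trans (adj-sym Γ w z) a) (λ { refl → x∉ (here refl) })
          (λ { R′ refl → ⊥-elim (head∉ u (there (here refl))) }) ,
        move-extend (head∉ u) ,
        λ e → w≢z (sym (cong proj₂ e))
        where
        -- The flag points at the second vertex, so `z` is even and may be dropped.
        cov′ : CoversOdd Γ x y (w ∷ R)
        cov′ v o p q with cov v o p q
        ... | there i = i
        ... | here refl with () ← trans (sym o) (par R refl)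
      go (rot {mid = mid} {s} {_} {R} w∉) {{refl}} (z′ , wk , u , x∉ , cov) par with walk-head wk
      ... | refl rewrite move-rot mid {s} {w} {R} w∉ =
        valid-intro (s , rotate mid wk (step a (walk-from (z ∷ mid ++ s ∷ []) (subst (Walk Γ z y) assoc wk))) ,
                      unique-↭ (↭-sym perm) u , (λ i → x∉ (↭.∈-resp-↭ perm i)) ,
                      λ v o p q → ↭.∈-resp-↭ (↭-sym perm) (cov v o p q))
          (proj₁ (walk-tail (walk-from (z ∷ mid) wk))) w≢x
          (λ R′ e → ⊥-elim (w∉′ (there (first (reverse mid) e)))) ,
        trans (move-rot (reverse mid) {z} {w} {R} w∉′) (cong (λ t → z ∷ t ++ s ∷ w ∷ R , w) (List.reverse-involutive mid)) ,
        λ e → head∉ u (∈-++⁺ʳ mid (here (sym (List.∷-injectiveˡ (cong proj₁ e)))))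
        where
        first : ∀ as {R′} → as ++ z ∷ w ∷ R ≡ w ∷ R′ → w ∈ as ++ z ∷ []
        first []       refl = here refl
        first (_ ∷ as) refl = here refl
        assoc : z ∷ mid ++ s ∷ w ∷ R ≡ (z ∷ mid ++ s ∷ []) ++ w ∷ R
        assoc = cong (z ∷_) (sym (List.++-assoc mid (s ∷ []) (w ∷ R)))
        perm : s ∷ reverse mid ++ z ∷ w ∷ R ↭ z ∷ mid ++ s ∷ w ∷ R
        perm = subst₂ _↭_ (reverse-mid z mid s (w ∷ R)) (sym assoc) (↭.++⁺ʳ (w ∷ R) (↭.↭-reverse (z ∷ mid ++ s ∷ [])))
        w∉′ : w ∉ s ∷ reverse mid ++ z ∷ []
        w∉′ i = w∉ (↭.∈-resp-↭ (↭.↭-reverse (z ∷ mid ++ s ∷ []))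
                  (subst (w ∈_) (trans (sym (reverse-mid z mid s [])) (List.++-identityʳ _)) i))

    -- The vertices of odd degree must be covered, those of even degree may be skipped. Every edge at
    -- the end of a partial path is then a move, apart from the last edge at an odd end, and the moves
    -- are paired by their inverses.
    second-path : ∀ {P} → x ≢ y → IsPath Γ x y P → CoversOdd Γ x y P →
                  Σ (List (Fin n)) λ Q → Q ≢ P × IsPath Γ x y Q × CoversOdd Γ x y Q
    second-path ne (single _ , u) cov = ⊥-elim (ne refl)
    second-path ne (step {z = z} {vs = Q₀} a w , u) cov = finish (another (List.≡-dec Fin._≟_) states states-unique closing total
        (∈-states s₀) closing₀)
      where
      s₀ : State Q₀
      s₀ = z , w , tail-unique u , head∉ u , λ v o p q → tail (cov v o p q) p
        where tail : ∀ {v} → v ∈ x ∷ Q₀ → v ≢ x → v ∈ Q₀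
              tail (here e) p = ⊥-elim (p e)
              tail (there i) p = i
      candidates = lists (allFin n) (length (allFin n))
      states = deduplicate (List.≡-dec Fin._≟_) candidates
      states-unique : Unique states
      states-unique = DecUniqueProperties.deduplicate-! (List.≡-dec Fin._≟_) candidates
      ∈-states : ∀ {Q} → State Q → Q ∈ states
      ∈-states (_ , _ , u , _) = ∈-deduplicate⁺ (List.≡-dec Fin._≟_)
        (∈-lists (allFin n) _ _ (λ _ → ∈-allFin _) (unique-⊆-length (allFin n) u (λ _ → ∈-allFin _)))
      closing-intro : ∀ {z Q} → State (z ∷ Q) → adj Γ z x ≡ true → closing (z ∷ Q) ≡ true
      closing-intro s a with state-length s
      ... | _ , p , R , refl rewrite ⌊⌋-true (state? (_ ∷ p ∷ R)) s = a
      closing₀ : closing Q₀ ≡ true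
      closing₀ = go w s₀
        where
        go : ∀ {Q} → Walk Γ z y Q → State Q → closing Q ≡ true
        go (single _) s = closing-intro s (trans (adj-sym Γ z x) a)
        go (step _ _) s = closing-intro s (trans (adj-sym Γ z x) a)
      flags = cartesianProduct states (allFin n)
      -- The valid flags are counted twice: grouped by their paths they give the closing states,
      -- grouped by the pairing they cancel.
      total : ⨁ states closing ≡ false
      total = begin
        ⨁ states closing                                  ≡⟨ ⨁-cong states (λ Q _ → sym (rows Q)) ⟩
        ⨁ states (λ Q → ⨁ (allFin n) (λ w → valid (Q , w))) ≡⟨ sym (⨁-product states (allFin n) valid) ⟩
        ⨁ flags valid                                      ≡⟨ ⨁-involution (≡-dec (List.≡-dec Fin._≟_) Fin._≟_) flags
                                                                (Unique.cartesianProduct⁺ states-unique (Unique.allFin⁺ n)) valid move paired ⟩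
        false                                              ∎
        where
        open ≡-Reasoning
        rows : ∀ Q → ⨁ (allFin n) (λ w → valid (Q , w)) ≡ closing Q
        rows []          = ⨁-false (allFin n) (λ _ _ → refl)
        rows (_ ∷ [])    = ⨁-false (allFin n) (λ _ _ → refl)
        rows (z ∷ p ∷ Q) = row z p Q
        paired : ∀ f → f ∈ flags → valid f ≡ true → move f ∈ flags × valid (move f) ≡ true × move (move f) ≡ f × move f ≢ f
        paired (Q , w) _ v with move-valid Q w v
        ... | v′ , inv , ne = ∈-cartesianProduct⁺ (∈-states (proj₁ (proj₂ (proj₂ (proj₂ (valid-elim {proj₁ (move (Q , w))} {proj₂ (move (Q , w))} v′)))))) (∈-allFin _) , v′ , inv , ne
      finish : (Σ (List (Fin n)) λ Q → Q ∈ states × closing Q ≡ true × Q ≢ Q₀) →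
               Σ (List (Fin n)) λ Q → Q ≢ x ∷ Q₀ × IsPath Γ x y Q × CoversOdd Γ x y Q
      finish (z ∷ p ∷ R , _ , c , ne) with ∧-true {⌊ state? (z ∷ p ∷ R) ⌋} c
      ... | c₁ , a′ with true-⌊⌋ (state? (z ∷ p ∷ R)) c₁
      ...   | _ , w′ , u′ , x∉ , cov′ with walk-head w′
      ...     | refl = x ∷ z ∷ p ∷ R , (λ { refl → ne refl }) , (step (trans (adj-sym Γ x z) a′) w′ , ∷-unique x∉ u′) ,
                       λ v o p q → there (cov′ v o p q)

-- Hubs and spokes

module _ {A : Set} where

  steps : List A → List (A × A)
  steps (a ∷ b ∷ L) = (a , b) ∷ steps (b ∷ L)
  steps _           = []

  Adj : List A → A → A → Set
  Adj L a b = (a , b) ∈ steps L ⊎ (b , a) ∈ steps L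

  Adj-sym : ∀ {L a b} → Adj L a b → Adj L b a
  Adj-sym (inj₁ h) = inj₂ h
  Adj-sym (inj₂ h) = inj₁ h

  step-∈ˡ : ∀ {a b} L → (a , b) ∈ steps L → a ∈ L
  step-∈ˡ (_ ∷ _ ∷ L) (here refl) = here refl
  step-∈ˡ (_ ∷ _ ∷ L) (there i)   = there (step-∈ˡ (_ ∷ L) i)

  step-∈ʳ : ∀ {a b} L → (a , b) ∈ steps L → b ∈ L
  step-∈ʳ (_ ∷ _ ∷ L) (here refl) = there (here refl)
  step-∈ʳ (_ ∷ _ ∷ L) (there i)   = there (step-∈ʳ (_ ∷ L) i)

  step-tail : ∀ {a b c} L → (a , b) ∈ steps (c ∷ L) → b ∈ L
  step-tail (_ ∷ L) (here refl) = here refl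
  step-tail (_ ∷ L) (there i)   = there (step-tail L i)

  Adj-∈ : ∀ {a b} L → Adj L a b → a ∈ L
  Adj-∈ L (inj₁ h) = step-∈ˡ L h
  Adj-∈ L (inj₂ h) = step-∈ʳ L h

  step-++ʳ : ∀ {a b} as L → (a , b) ∈ steps L → (a , b) ∈ steps (as ++ L)
  step-++ʳ []           L i = i
  step-++ʳ (_ ∷ [])     (_ ∷ L) i = there i
  step-++ʳ (_ ∷ a ∷ as) L i = there (step-++ʳ (a ∷ as) L i)

  step-here : ∀ {a b} as L → (a , b) ∈ steps (as ++ a ∷ b ∷ L)
  step-here as L = step-++ʳ as _ (here refl)

  step-split : ∀ {a b} L → (a , b) ∈ steps L → Σ (List A) λ as → Σ (List A) λ bs → L ≡ as ++ a ∷ b ∷ bs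
  step-split (_ ∷ _ ∷ L) (here refl) = [] , L , refl
  step-split (c ∷ _ ∷ L) (there i) with step-split (_ ∷ L) i
  ... | as , bs , e = c ∷ as , bs , cong (c ∷_) e

  successor-unique : ∀ {a b c} L → Unique L → (a , b) ∈ steps L → (a , c) ∈ steps L → b ≡ c
  successor-unique (_ ∷ _ ∷ L) u (here refl) (here refl) = refl
  successor-unique (_ ∷ _ ∷ L) u (here refl) (there j)   = ⊥-elim (head∉ u (step-∈ˡ (_ ∷ L) j))
  successor-unique (_ ∷ _ ∷ L) u (there i)   (here refl) = ⊥-elim (head∉ u (step-∈ˡ (_ ∷ L) i))
  successor-unique (_ ∷ _ ∷ L) u (there i)   (there j)   = successor-unique (_ ∷ L) (tail-unique u) i j

  predecessor-unique : ∀ {a b c} L → Unique L → (b , a) ∈ steps L → (c , a) ∈ steps L → b ≡ c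
  predecessor-unique (_ ∷ _ ∷ L) u (here refl) (here refl) = refl
  predecessor-unique (_ ∷ _ ∷ L) u (here refl) (there j)   = ⊥-elim (head∉ (tail-unique u) (step-tail L j))
  predecessor-unique (_ ∷ _ ∷ L) u (there i)   (here refl) = ⊥-elim (head∉ (tail-unique u) (step-tail L i))
  predecessor-unique (_ ∷ _ ∷ L) u (there i)   (there j)   = predecessor-unique (_ ∷ L) (tail-unique u) i j

  step-antisym : ∀ {a b} L → Unique L → (a , b) ∈ steps L → (b , a) ∉ steps L
  step-antisym (_ ∷ _ ∷ L) u (here refl) (here refl) = head∉ u (here refl)
  step-antisym (_ ∷ _ ∷ L) u (here refl) (there j)   = head∉ u (step-∈ʳ (_ ∷ L) j)
  step-antisym (_ ∷ _ ∷ L) u (there i)   (here refl) = head∉ u (step-∈ʳ (_ ∷ L) i)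
  step-antisym (_ ∷ _ ∷ L) u (there i)   (there j)   = step-antisym (_ ∷ L) (tail-unique u) i j

module _ {n : ℕ} where

  private V = Fin n

  open DecMembership (≡-dec (Fin._≟_ {n}) (Fin._≟_ {n})) using () renaming (_∈?_ to _∈ₛ?_) public

  adj? : (L : List V) (a b : V) → Dec (Adj L a b)
  adj? L a b = ((a , b) ∈ₛ? steps L) ⊎-dec ((b , a) ∈ₛ? steps L)

  record Inner (L : List V) (v : V) : Set where
    field
      pre post : V
      pre-step : (pre , v) ∈ steps L
      post-step : (v , post) ∈ steps L
      pre≢post : pre ≢ post
      only : ∀ {w} → Adj L v w → w ≡ pre ⊎ w ≡ post

  inner : ∀ {Γ : Graph n} {x y L v} → IsPath Γ x y L → v ∈ L → v ≢ x → v ≢ y → Inner L v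
  inner {L = L} {v} (w , u) i v≢x v≢y with go w i v≢x v≢y
    where
    go : ∀ {Γ x y L} → Walk Γ x y L → v ∈ L → v ≢ x → v ≢ y → Σ _ λ as → Σ _ λ p → Σ _ λ s → Σ _ λ bs → L ≡ as ++ p ∷ v ∷ s ∷ bs
    go (single _) (here e) a b = ⊥-elim (a e)
    go (step _ w) (here e) a b = ⊥-elim (a e)
    go {y = y} (step {x = p} {z} a w) (there i) ne ne′ with v Fin.≟ z
    go (step _ (single _)) (there i) ne ne′ | yes refl = ⊥-elim (ne′ refl)
    go (step {x = p} _ (step {vs = _ ∷ bs} a w)) (there i) ne ne′ | yes refl = [] , p , _ , bs , refl
    ... | no nz with go w i nz ne′
    ...   | as , p′ , s , bs , refl = p ∷ as , p′ , s , bs , refl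
  ... | as , p , s , bs , refl = record
    { pre = p ; post = s ; pre-step = step-here as _ ; post-step = post-step
    ; pre≢post = λ { refl → step-antisym L u (step-here as _) post-step }
    ; only = λ { (inj₁ h) → inj₂ (successor-unique L u h post-step)
               ; (inj₂ h) → inj₁ (predecessor-unique L u h (step-here as _)) } }
    where
    post-step : (v , s) ∈ steps (as ++ p ∷ v ∷ s ∷ bs)
    post-step = step-++ʳ as _ (there (here refl))

  ⨁-three : (f : V → Bool) {a b c : V} → a ≢ b → a ≢ c → b ≢ c → f a ≡ true → f b ≡ true → f c ≡ true →
            (∀ w → f w ≡ true → w ≡ a ⊎ w ≡ b ⊎ w ≡ c) → ⨁ (allFin n) f ≡ true
  ⨁-three f {a} {b} {c} ab ac bc fa fb fc only = begin
    ⨁ (allFin n) f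
      ≡⟨ ⨁-cong (allFin n) (λ w _ → pointwise w) ⟩
    ⨁ (allFin n) (λ w → ind a w xor (ind b w xor ind c w))
      ≡⟨ ⨁-xor (allFin n) (ind a) _ ⟩
    ⨁ (allFin n) (ind a) xor ⨁ (allFin n) (λ w → ind b w xor ind c w)
      ≡⟨ cong₂ _xor_ (one a) (trans (⨁-xor (allFin n) (ind b) (ind c)) (cong₂ _xor_ (one b) (one c))) ⟩
    true ∎
    where
    open ≡-Reasoning
    ind : V → V → Bool
    ind v w = ⌊ w Fin.≟ v ⌋
    one : ∀ v → ⨁ (allFin n) (ind v) ≡ true
    one v = trans (⨁-single (allFin n) (Unique.allFin⁺ n) (∈-allFin v) (λ w _ ne → ⌊⌋-false (w Fin.≟ v) ne)) (⌊⌋-true (v Fin.≟ v) refl)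
    pointwise : ∀ w → f w ≡ ind a w xor (ind b w xor ind c w)
    pointwise w with w Fin.≟ a | w Fin.≟ b | w Fin.≟ c
    ... | yes refl | yes refl | _        = ⊥-elim (ab refl)
    ... | yes refl | no _     | yes refl = ⊥-elim (ac refl)
    ... | no _     | yes refl | yes refl = ⊥-elim (bc refl)
    ... | yes refl | no _     | no _     = fa
    ... | no _     | yes refl | no _     = fb
    ... | no _     | no _     | yes refl = fc
    ... | no na    | no nb    | no nc with f w in eq
    ...   | false = refl
    ...   | true with only w eq
    ...     | inj₁ e        = ⊥-elim (na e)
    ...     | inj₂ (inj₁ e) = ⊥-elim (nb e)
    ...     | inj₂ (inj₂ e) = ⊥-elim (nc e)

  -- Counting vertices and steps outside the hubs

  #steps : (V → V → Bool) → List V → ℕ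
  #steps f (a ∷ b ∷ L) = (if f a b then 1 else 0) + #steps f (b ∷ L)
  #steps f _           = 0

  module _ (B : V → Bool) where

    plain : V → V → Bool
    plain a b = not (B a) ∧ not (B b)

    #B #plain : List V → ℕ
    #B []      = 0
    #B (v ∷ L) = (if B v then 1 else 0) + #B L
    #plain []      = 0
    #plain (v ∷ L) = (if B v then 0 else 1) + #plain L

    length-split : ∀ L → length L ≡ #plain L + #B L
    length-split []      = refl
    length-split (v ∷ L) with B v
    ... | true  = trans (cong suc (length-split L)) (sym (+-suc (#plain L) (#B L)))
    ... | false = cong suc (length-split L)

    -- Each vertex outside B except the first is entered from B or by a plain step, and each vertex
    -- of B except the last leads to a vertex outside B.
    balance : ∀ {Γ : Graph n} {a y L} → Walk Γ a y L → B y ≡ true →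
              (∀ {u v} → (u , v) ∈ steps L → B u ≡ true → B v ≡ true → ⊥) →
              #plain L + (if B a then 1 else 0) ≡ #B L + #steps plain L
    balance (single y) e h rewrite e = refl
    balance {L = a ∷ c ∷ L} (step ac w) e h with walk-head w
    ... | refl with balance w e (λ i → h (there i))
    ... | ih with B a in ea | B c in ec
    ... | true  | true  = ⊥-elim (h (here refl) ea ec)
    ... | true  | false = trans (+-comm _ 1) (cong suc (trans (sym (+-identityʳ _)) ih))
    ... | false | true  = trans (cong suc (+-identityʳ _)) (trans (sym (+-comm (#plain L) 1)) ih)
    ... | false | false = trans (cong suc ih) (sym (+-suc (#B L) _))

    plain-mono : ∀ {P Q} → Unique P → (∀ v → v ∈ P → B v ≡ false → v ∈ Q) → #plain P ≤ #plain Q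
    plain-mono {[]} u h = z≤n
    plain-mono {v ∷ P} {Q} u h with B v in eq
    ... | true  = plain-mono (tail-unique u) (λ w i → h w (there i))
    ... | false with ∈-∃++ (h v (here refl) eq)
    ...   | as , bs , refl = ≤-trans (s≤s (plain-mono {P} {as ++ bs} (tail-unique u) sub)) (≤-reflexive (sym (count as)))
      where
      count : ∀ as → #plain (as ++ v ∷ bs) ≡ suc (#plain (as ++ bs))
      count [] rewrite eq = refl
      count (a ∷ as) rewrite count as = +-suc _ _
      sub : ∀ w → w ∈ P → B w ≡ false → w ∈ as ++ bs
      sub w i e with ∈-++⁻ as (h w (there i) e)
      ... | inj₁ j           = ∈-++⁺ˡ j
      ... | inj₂ (here refl) = ⊥-elim (head∉ u i)
      ... | inj₂ (there j)   = ∈-++⁺ʳ as j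

    #new : List V → List V → ℕ
    #new P = #steps (λ a b → plain a b ∧ not ⌊ adj? P a b ⌋)

    -- `shared` is compared with the steps of `P` by the pigeonhole principle, so a step that `Q`
    -- takes backwards has to be turned round.
    orient : List V → V → V → V × V
    orient P a b with (a , b) ∈ₛ? steps P
    ... | yes _ = a , b
    ... | no _  = b , a

    -- The plain steps of Q along edges of P, oriented as in P.
    shared : List V → List V → List (V × V)
    shared P (a ∷ b ∷ Q) = if plain a b ∧ ⌊ adj? P a b ⌋ then orient P a b ∷ shared P (b ∷ Q) else shared P (b ∷ Q)
    shared P _           = []

    new+shared : ∀ P Q → #steps plain Q ≡ #new P Q + length (shared P Q)
    new+shared P [] = refl
    new+shared P (a ∷ []) = refl
    new+shared P (a ∷ b ∷ Q) with new+shared P (b ∷ Q) | plain a b | adj? P a b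
    ... | ih | false | _     = ih
    ... | ih | true  | yes _ = trans (cong suc ih) (sym (+-suc _ _))
    ... | ih | true  | no _  = cong suc ih

    plainSteps : List V → List (V × V)
    plainSteps (a ∷ b ∷ L) = if plain a b then (a , b) ∷ plainSteps (b ∷ L) else plainSteps (b ∷ L)
    plainSteps _           = []

    length-plainSteps : ∀ L → length (plainSteps L) ≡ #steps plain L
    length-plainSteps [] = refl
    length-plainSteps (a ∷ []) = refl
    length-plainSteps (a ∷ b ∷ L) with length-plainSteps (b ∷ L) | plain a b
    ... | ih | true  = cong suc ih
    ... | ih | false = ih

    ∈-plainSteps : ∀ {a b} L → (a , b) ∈ steps L → plain a b ≡ true → (a , b) ∈ plainSteps L
    ∈-plainSteps (a ∷ b ∷ L) (here refl) e rewrite e = here refl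
    ∈-plainSteps (a ∷ b ∷ L) (there i) e with ∈-plainSteps (b ∷ L) i e | plain a b
    ... | ih | true  = there ih
    ... | ih | false = ih

    orient-cases : ∀ P {a b} → Adj P a b → (orient P a b ≡ (a , b) × (a , b) ∈ steps P) ⊎ (orient P a b ≡ (b , a) × (b , a) ∈ steps P)
    orient-cases P {a} {b} h with (a , b) ∈ₛ? steps P
    orient-cases P h        | yes i = inj₁ (refl , i)
    orient-cases P (inj₁ i) | no ni = ⊥-elim (ni i)
    orient-cases P (inj₂ i) | no ni = inj₂ (refl , i)

    shared-spec : ∀ P Q {a b} → (a , b) ∈ shared P Q → Adj Q a b × (a , b) ∈ plainSteps P
    shared-spec P (c ∷ d ∷ Q) = extend-spec (shared-spec P (d ∷ Q))
      where
      extend-spec : (∀ {a b} → (a , b) ∈ shared P (d ∷ Q) → Adj (d ∷ Q) a b × (a , b) ∈ plainSteps P) →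
                    ∀ {a b} → (a , b) ∈ shared P (c ∷ d ∷ Q) → Adj (c ∷ d ∷ Q) a b × (a , b) ∈ plainSteps P
      extend-spec ih i with plain c d in eq | adj? P c d
      ... | false | _    = Product.map₁ (Sum.map there there) (ih i)
      ... | true  | no _ = Product.map₁ (Sum.map there there) (ih i)
      extend-spec ih (there i) | true | yes _ = Product.map₁ (Sum.map there there) (ih i)
      extend-spec ih (here e)  | true | yes h with orient-cases P h
      ... | inj₁ (q , s) rewrite q with refl ← e = inj₁ (here refl) , ∈-plainSteps P s eq
      ... | inj₂ (q , s) rewrite q with refl ← e = inj₂ (here refl) ,
              ∈-plainSteps P s (trans (Bool.∧-comm (not (B d)) (not (B c))) eq)

    shared-unique : ∀ P Q → Unique Q → Unique (shared P Q)
    shared-unique P [] u = []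
    shared-unique P (_ ∷ []) u = []
    shared-unique P (a ∷ b ∷ Q) u with shared-unique P (b ∷ Q) (tail-unique u) | plain a b | adj? P a b
    ... | ih | false | _     = ih
    ... | ih | true  | no _  = ih
    ... | ih | true  | yes h = ∷-unique new ih
      where
      new : orient P a b ∉ shared P (b ∷ Q)
      new i with orient-cases P h
      ... | inj₁ (q , _) = head∉ u (Adj-∈ (b ∷ Q) (proj₁ (shared-spec P (b ∷ Q) (subst (_∈ _) q i))))
      ... | inj₂ (q , _) = head∉ u (Adj-∈ (b ∷ Q) (Adj-sym {L = b ∷ Q} (proj₁ (shared-spec P (b ∷ Q) (subst (_∈ _) q i)))))

    -- The visits to B that Q misses and the plain steps of P that Q loses are paid for by new plain
    -- steps of Q.
    exchange : ∀ {Γ Γ′ : Graph n} {x y P Q} → IsPath Γ x y P → IsPath Γ′ x y Q → B x ≡ true → B y ≡ true →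
               (∀ {u v} → (u , v) ∈ steps P → B u ≡ true → B v ≡ true → ⊥) →
               (∀ {u v} → (u , v) ∈ steps Q → B u ≡ true → B v ≡ true → ⊥) →
               (∀ v → v ∈ P → B v ≡ false → v ∈ Q) →
               (lost : List (V × V)) → Unique lost →
               (∀ {a b} → (a , b) ∈ lost → (a , b) ∈ steps P × plain a b ≡ true × ¬ Adj Q a b) →
               length P + length lost ≤ length Q + #new P Q
    exchange {x = x} {P = P} {Q} (wP , uP) (wQ , uQ) bx by hP hQ cov lost ul hl = begin
      length P + length lost                 ≡⟨ cong (_+ length lost) (length-split P) ⟩
      #plain P + #B P + length lost          ≡⟨ +-assoc (#plain P) _ _ ⟩
      #plain P + (#B P + length lost)        ≤⟨ +-mono-≤ fewer (+-cancelʳ-≤ (length (shared P Q)) _ _ rest) ⟩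
      #plain Q + (#B Q + #new P Q)           ≡⟨ sym (+-assoc (#plain Q) _ _) ⟩
      #plain Q + #B Q + #new P Q             ≡⟨ cong (_+ #new P Q) (sym (length-split Q)) ⟩
      length Q + #new P Q                    ∎
      where
      open ≤-Reasoning
      fewer : #plain P ≤ #plain Q
      fewer = plain-mono uP cov
      disjoint-sub : ∀ {e} → e ∈ lost ++ shared P Q → e ∈ plainSteps P
      disjoint-sub i with ∈-++⁻ lost i
      ... | inj₁ j = ∈-plainSteps P (proj₁ (hl j)) (proj₁ (proj₂ (hl j)))
      ... | inj₂ j = proj₂ (shared-spec P Q j)
      -- Lost and shared steps are disjoint, since the shared ones are steps of `Q`.
      few : length lost + length (shared P Q) ≤ #steps plain P
      few = begin
        length lost + length (shared P Q) ≡⟨ sym (List.length-++ lost) ⟩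
        length (lost ++ shared P Q)       ≤⟨ unique-⊆-length (plainSteps P)
                                               (Unique.++⁺ ul (shared-unique P Q uQ)
                                                  (λ (i , j) → proj₂ (proj₂ (hl i)) (proj₁ (shared-spec P Q j)))) disjoint-sub ⟩
        length (plainSteps P)             ≡⟨ length-plainSteps P ⟩
        #steps plain P                    ∎
      -- The 1 accounts for `y`, the only vertex of `B` on the path that is not followed by a vertex
      -- outside `B`.
      balanced : ∀ {Γ : Graph n} {y L} → Walk Γ x y L → B y ≡ true →
                 (∀ {u v} → (u , v) ∈ steps L → B u ≡ true → B v ≡ true → ⊥) → #B L + #steps plain L ≡ #plain L + 1
      balanced {L = L} w e h = trans (sym (balance w e h)) (cong (λ b → #plain L + (if b then 1 else 0)) bx)
      rest : #B P + length lost + length (shared P Q) ≤ #B Q + #new P Q + length (shared P Q)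
      rest = begin
        #B P + length lost + length (shared P Q)   ≡⟨ +-assoc (#B P) _ _ ⟩
        #B P + (length lost + length (shared P Q)) ≤⟨ +-monoʳ-≤ (#B P) few ⟩
        #B P + #steps plain P                      ≡⟨ balanced wP by hP ⟩
        #plain P + 1                               ≤⟨ +-monoˡ-≤ 1 fewer ⟩
        #plain Q + 1                               ≡⟨ sym (balanced wQ by hQ) ⟩
        #B Q + #steps plain Q                      ≡⟨ cong (#B Q +_) (new+shared P Q) ⟩
        #B Q + (#new P Q + length (shared P Q))    ≡⟨ sym (+-assoc (#B Q) _ _) ⟩
        #B Q + #new P Q + length (shared P Q)      ∎

  Inside : V → V → List V → V → Set
  Inside x y P v = v ∈ P × v ≢ x × v ≢ y

  -- P with an edge from every spoke to its hub. B contains the hubs that a second path may skip; a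
  -- spoke whose hub is not in B forms a pair with it, each being the hub of the other.
  record Hubs (G : Graph n) (x y : V) (P : List V) : Set where
    field
      path     : IsPath G x y P
      x≢y      : x ≢ y
      B        : V → Bool
      B-x      : B x ≡ true
      B-y      : B y ≡ true
      B-sparse : ∀ {u v} → (u , v) ∈ steps P → B u ≡ true → B v ≡ true → ⊥
      hub      : V → V
    Spoke : V → Set
    Spoke v = Inside x y P v × B v ≡ false
    Green : V → V → Set
    Green u v = Spoke u × hub u ≡ v
    field
      hub-∈    : ∀ {v} → Spoke v → hub v ∈ P
      hub-≢    : ∀ {v} → Spoke v → hub v ≢ v
      hub-far  : ∀ {v} → Spoke v → ¬ Adj P v (hub v)
      hub-kind : ∀ {v} → Spoke v → B (hub v) ≡ true ⊎ Green (hub v) v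

    spoke : ∀ {v} → v ∈ P → B v ≡ false → Spoke v
    spoke i e = (i , (λ { refl → absurd (trans (sym e) B-x) }) , λ { refl → absurd (trans (sym e) B-y) }) , e
      where absurd : ∀ {A : Set} → false ≡ true → A
            absurd ()

    green? : ∀ u v → Dec (Green u v)
    green? u v = (((u ∈? P) ×-dec ¬? (u Fin.≟ x) ×-dec ¬? (u Fin.≟ y)) ×-dec (B u Bool.≟ false)) ×-dec (hub u Fin.≟ v)

    Edge : V → V → Set
    Edge u v = Adj P u v ⊎ (Green u v ⊎ Green v u)

    edge? : ∀ u v → Dec (Edge u v)
    edge? u v = adj? P u v ⊎-dec (green? u v ⊎-dec green? v u)

    Edge-sym : ∀ {u v} → Edge u v → Edge v u
    Edge-sym (inj₁ a)        = inj₁ (Adj-sym {L = P} a)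
    Edge-sym (inj₂ (inj₁ g)) = inj₂ (inj₂ g)
    Edge-sym (inj₂ (inj₂ g)) = inj₂ (inj₁ g)

    Edge-∈ : ∀ {u v} → Edge u v → u ∈ P
    Edge-∈ (inj₁ a)                    = Adj-∈ P a
    Edge-∈ (inj₂ (inj₁ (s , _)))       = proj₁ (proj₁ s)
    Edge-∈ (inj₂ (inj₂ (s , refl)))    = hub-∈ s

    graph : Graph n
    graph = record
      { adj = λ u v → ⌊ edge? u v ⌋
      ; sym = λ u v → agree (edge? u v) (edge? v u) Edge-sym Edge-sym
      ; irrefl = λ v → ⌊⌋-false (edge? v v) λ
          { (inj₁ (inj₁ i)) → step-antisym P (proj₂ path) i i
          ; (inj₁ (inj₂ i)) → step-antisym P (proj₂ path) i i
          ; (inj₂ (inj₁ (s , e))) → hub-≢ s e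
          ; (inj₂ (inj₂ (s , e))) → hub-≢ s e } }
      where
      agree : {X Y : Set} (d : Dec X) (e : Dec Y) → (X → Y) → (Y → X) → ⌊ d ⌋ ≡ ⌊ e ⌋
      agree (yes _) (yes _) f g = refl
      agree (no _)  (no _)  f g = refl
      agree (yes p) (no np) f g = ⊥-elim (np (f p))
      agree (no np) (yes p) f g = ⊥-elim (np (g p))

    edge : ∀ {u v} → adj graph u v ≡ true → Edge u v
    edge {u} {v} = true-⌊⌋ (edge? u v)

    edge⁻¹ : ∀ {u v} → Edge u v → adj graph u v ≡ true
    edge⁻¹ {u} {v} = ⌊⌋-true (edge? u v)

    walk-edge : ∀ {a b Q u v} → Walk graph a b Q → (u , v) ∈ steps Q → Edge u v
    walk-edge (step e (single _)) (here refl) = edge e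
    walk-edge (step e (step _ _)) (here refl) = edge e
    walk-edge (step _ w@(step _ _)) (there i) = walk-edge w i

    walk-⊆ : ∀ {a b Q} → a ∈ P → Walk graph a b Q → ∀ {v} → v ∈ Q → v ∈ P
    walk-⊆ a∈ (single _) (here refl) = a∈
    walk-⊆ a∈ (step e w) (here refl) = a∈
    walk-⊆ a∈ (step e w) (there i)   = walk-⊆ (Edge-∈ (Edge-sym (edge e))) w i

    -- A green edge starts at a spoke, and spokes lie outside `B`.
    no-BB-edge : ∀ {u v} → Edge u v → B u ≡ true → B v ≡ true → ⊥
    no-BB-edge (inj₁ (inj₁ i)) bu bv = B-sparse i bu bv
    no-BB-edge (inj₁ (inj₂ i)) bu bv = B-sparse i bv bu
    no-BB-edge (inj₂ (inj₁ ((_ , e) , _))) bu bv with () ← trans (sym e) bu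
    no-BB-edge (inj₂ (inj₂ ((_ , e) , _))) bu bv with () ← trans (sym e) bv

    path-walk : IsPath graph x y P
    path-walk = go path inj₁ , proj₂ path
      where
      convert : ∀ {a b L} → Walk G a b L → (∀ {u v} → (u , v) ∈ steps L → Edge u v) → Walk graph a b L
      convert (single _) h = single _
      convert (step _ w@(single _)) h = step (edge⁻¹ (h (here refl))) (convert w λ ())
      convert (step _ w@(step _ _)) h = step (edge⁻¹ (h (here refl))) (convert w (λ i → h (there i)))
      go : IsPath G x y P → (∀ {u v} → Adj P u v → Edge u v) → Walk graph x y P
      go (w , _) h = convert w (λ i → h (inj₁ i))

    -- Besides its two neighbours on `P` a spoke is adjacent only to its hub: a spoke that has it as
    -- hub forms a pair with it and hence is that same hub.
    spoke-odd : ∀ {v} → Spoke v → odd graph v ≡ true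
    spoke-odd {v} s@((i , ≢x , ≢y) , bv) = ⨁-three (adj graph v) pre≢post
        (λ e → hub-far s (inj₂ (subst (λ t → (t , v) ∈ steps P) e pre-step)))
        (λ e → hub-far s (inj₁ (subst (λ t → (v , t) ∈ steps P) e post-step)))
        (edge⁻¹ (inj₁ (inj₂ pre-step))) (edge⁻¹ (inj₁ (inj₁ post-step))) (edge⁻¹ (inj₂ (inj₁ (s , refl))))
        (λ w e → neighbour (edge e))
      where
      open Inner (inner path i ≢x ≢y)
      neighbour : ∀ {w} → Edge v w → w ≡ pre ⊎ w ≡ post ⊎ w ≡ hub v
      neighbour (inj₁ a) with only a
      ... | inj₁ e = inj₁ e
      ... | inj₂ e = inj₂ (inj₁ e)
      neighbour (inj₂ (inj₁ (_ , e))) = inj₂ (inj₂ (sym e))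
      neighbour (inj₂ (inj₂ (s′ , refl))) with hub-kind s′
      ... | inj₁ b       with () ← trans (sym bv) b
      ... | inj₂ (_ , e) = inj₂ (inj₂ (sym e))

    second : (o : V) → Spoke o → Σ (List V) λ Q → Q ≢ P × IsPath graph x y Q × (∀ v → v ∈ P → B v ≡ false → v ∈ Q)
    second o s@((_ , o≢x , o≢y) , _) with second-path graph x y o (spoke-odd s) o≢x o≢y x≢y path-walk covers
      where
      -- A vertex off `P` has no edge, hence degree 0.
      covers : CoversOdd graph x y P
      covers v e _ _ = decidable-stable (v ∈? P) λ ni → contradiction
        (trans (sym e) (⨁-false (allFin n) (λ w _ → ⌊⌋-false (edge? v w) (λ h → ni (Edge-∈ h))))) λ ()
    ... | Q , ne , p , cov = Q , ne , p , λ v i bv → let s = spoke i bv in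
            cov v (spoke-odd s) (proj₁ (proj₂ (proj₁ s))) (proj₂ (proj₂ (proj₁ s)))

    count : ∀ {Q} → IsPath graph x y Q → (∀ v → v ∈ P → B v ≡ false → v ∈ Q) → (lost : List (V × V)) → Unique lost →
            (∀ {a b} → (a , b) ∈ lost → (a , b) ∈ steps P × plain B a b ≡ true × ¬ Adj Q a b) →
            length P + length lost ≤ length Q + #new B P Q
    count q@(w , _) cov = exchange B path q B-x B-y B-sparse (λ i → no-BB-edge (walk-edge w i)) cov

-- Independent transversals of a path

-- Chains modulo 2 on the subsets of an `n`-set: the first component holds the sets without the
-- first element, the second those with it, that element being removed. The empty set counts as a
-- simplex, so `∂` is the augmented boundary.
Chain : ℕ → Set
Chain zero    = Bool
Chain (suc n) = Chain n × Chain n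

private variable n c s k : ℕ

0c : ∀ n → Chain n
0c zero    = false
0c (suc n) = 0c n , 0c n

infixl 6 _⊕_
_⊕_ : Chain n → Chain n → Chain n
_⊕_ {zero}  a b = a xor b
_⊕_ {suc n} (a , b) (a′ , b′) = a ⊕ a′ , b ⊕ b′

∂ : Chain n → Chain n
∂ {zero}  _       = false
∂ {suc n} (a , b) = ∂ a ⊕ b , ∂ b

⊕-comm : (a b : Chain n) → a ⊕ b ≡ b ⊕ a
⊕-comm {zero}  a b = Bool.xor-comm a b
⊕-comm {suc n} (a , b) (a′ , b′) = cong₂ _,_ (⊕-comm a a′) (⊕-comm b b′)

⊕-assoc : (a b d : Chain n) → (a ⊕ b) ⊕ d ≡ a ⊕ (b ⊕ d)
⊕-assoc {zero}  a b d = Bool.xor-assoc a b d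
⊕-assoc {suc n} (a , b) (a′ , b′) (a″ , b″) = cong₂ _,_ (⊕-assoc a a′ a″) (⊕-assoc b b′ b″)

⊕-self : (a : Chain n) → a ⊕ a ≡ 0c n
⊕-self {zero}  a = Bool.xor-same a
⊕-self {suc n} (a , b) = cong₂ _,_ (⊕-self a) (⊕-self b)

⊕-idˡ : (a : Chain n) → 0c n ⊕ a ≡ a
⊕-idˡ {zero}  a = refl
⊕-idˡ {suc n} (a , b) = cong₂ _,_ (⊕-idˡ a) (⊕-idˡ b)

⊕-idʳ : (a : Chain n) → a ⊕ 0c n ≡ a
⊕-idʳ a = trans (⊕-comm a _) (⊕-idˡ a)

⊕-cancel : (a b : Chain n) → a ⊕ (a ⊕ b) ≡ b
⊕-cancel a b = trans (sym (⊕-assoc a a b)) (trans (cong (_⊕ b) (⊕-self a)) (⊕-idˡ b))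

⊕-zero⇒≡ : (a b : Chain n) → a ⊕ b ≡ 0c n → a ≡ b
⊕-zero⇒≡ a b e = trans (sym (⊕-idʳ a)) (trans (cong (a ⊕_) (sym e)) (⊕-cancel a b))

⊕-interchange : (a b d e : Chain n) → (a ⊕ b) ⊕ (d ⊕ e) ≡ (a ⊕ d) ⊕ (b ⊕ e)
⊕-interchange a b d e = begin
  (a ⊕ b) ⊕ (d ⊕ e) ≡⟨ ⊕-assoc a b _ ⟩
  a ⊕ (b ⊕ (d ⊕ e)) ≡⟨ cong (a ⊕_) (sym (⊕-assoc b d e)) ⟩
  a ⊕ ((b ⊕ d) ⊕ e) ≡⟨ cong (λ t → a ⊕ (t ⊕ e)) (⊕-comm b d) ⟩
  a ⊕ ((d ⊕ b) ⊕ e) ≡⟨ cong (a ⊕_) (⊕-assoc d b e) ⟩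
  a ⊕ (d ⊕ (b ⊕ e)) ≡⟨ sym (⊕-assoc a d _) ⟩
  (a ⊕ d) ⊕ (b ⊕ e) ∎
  where open ≡-Reasoning

∂-0 : ∀ n → ∂ (0c n) ≡ 0c n
∂-0 zero    = refl
∂-0 (suc n) = cong₂ _,_ (trans (⊕-idʳ _) (∂-0 n)) (∂-0 n)

∂-⊕ : (a b : Chain n) → ∂ (a ⊕ b) ≡ ∂ a ⊕ ∂ b
∂-⊕ {zero}  a b = refl
∂-⊕ {suc n} (a , b) (a′ , b′) =
  cong₂ _,_ (trans (cong (_⊕ (b ⊕ b′)) (∂-⊕ a a′)) (⊕-interchange (∂ a) (∂ a′) b b′)) (∂-⊕ b b′)

-- On W p s z: z is a combination of s-element subsets of W ⊆ {0,…,n-1} without two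
-- consecutive elements; p forbids the element 0.
On  : Vec Bool n → Bool → ℕ → Chain n → Set
On₁ : Bool → Vec Bool n → ℕ → Chain n → Set
On []      p zero    z = ⊤
On []      p (suc s) z = z ≡ false
On (w ∷ W) p s (a , b) = On W false s a × On₁ (w ∧ not p) W s b
On₁ {n} false W s       b = b ≡ 0c n
On₁ {n} true  W zero    b = b ≡ 0c n
On₁     true  W (suc s) b = On W true s b

on-0  : (W : Vec Bool n) (p : Bool) (s : ℕ) → On W p s (0c n)
on₁-0 : (t : Bool) (W : Vec Bool n) (s : ℕ) → On₁ t W s (0c n)
on-0 []      p zero    = tt
on-0 []      p (suc s) = refl
on-0 (w ∷ W) p s       = on-0 W false s , on₁-0 (w ∧ not p) W s
on₁-0 false W s       = refl
on₁-0 true  W zero    = refl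
on₁-0 true  W (suc s) = on-0 W true s

on-⊕  : (W : Vec Bool n) (p : Bool) (s : ℕ) {a b : Chain n} → On W p s a → On W p s b → On W p s (a ⊕ b)
on₁-⊕ : (t : Bool) (W : Vec Bool n) (s : ℕ) {a b : Chain n} → On₁ t W s a → On₁ t W s b → On₁ t W s (a ⊕ b)
on-⊕ []      p zero    _ _ = tt
on-⊕ []      p (suc s) refl refl = refl
on-⊕ (w ∷ W) p s (h , i) (h′ , i′) = on-⊕ W false s h h′ , on₁-⊕ (w ∧ not p) W s i i′
on₁-⊕ false W s       refl refl = ⊕-self _
on₁-⊕ true  W zero    refl refl = ⊕-self _
on₁-⊕ true  W (suc s) h i = on-⊕ W true s h i

_⊑_ : Bool → Bool → Set
b ⊑ b′ = b ≡ true → b′ ≡ true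

on₁-mono : (t t′ : Bool) → t ⊑ t′ → (W : Vec Bool n) (s : ℕ) {a : Chain n} → On₁ t W s a → On₁ t′ W s a
on₁-mono true  true  le W s h = h
on₁-mono true  false le W s h with () ← le refl
on₁-mono false t′    le W s refl = on₁-0 t′ W s

on-unblock : (W : Vec Bool n) (s : ℕ) {a : Chain n} → On W true s a → On W false s a
on-unblock []      zero    h = h
on-unblock []      (suc s) h = h
on-unblock (w ∷ W) s (h , i) = h , on₁-mono (w ∧ false) (w ∧ true) (le w) W s i
  where le : ∀ w → (w ∧ false) ⊑ (w ∧ true)
        le true ()
        le false ()

on-mono : (W W′ : Vec Bool n) → (∀ i → lookup W i ⊑ lookup W′ i) → (p : Bool) (s : ℕ) {a : Chain n} →
          On W p s a → On W′ p s a
on-mono []      []        le p zero    h = h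
on-mono []      []        le p (suc s) h = h
on-mono (w ∷ W) (w′ ∷ W′) le p s (h , i) =
  on-mono W W′ (λ j → le (suc j)) false s h , widen w w′ p (le zero) s i
  where
  widen : ∀ w w′ p → w ⊑ w′ → ∀ s {b} → On₁ (w ∧ not p) W s b → On₁ (w′ ∧ not p) W′ s b
  widen false w′   p     le₀ s       refl = on₁-0 (w′ ∧ not p) W′ s
  widen true  true false le₀ zero    h    = h
  widen true  true false le₀ (suc s) h    = on-mono W W′ (λ j → le (suc j)) true s h
  widen true  true true  le₀ s       h    = h
  widen true  false p    le₀ s       h with () ← le₀ refl

#_ : Vec Bool n → ℕ
# [] = 0
# (true ∷ W) = suc (# W)
# (false ∷ W) = # W

-- In the last clause write 0 and 1 for the first two vertices and D for the filling of the
-- coefficient of 1. Adding the boundary of 1·D to the cycle cancels its part with 1 and without 0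
-- and turns `a` into `a` + D. What is left avoids 1 and is filled by the cone 0·(`a` + D).
fill : Vec Bool n → Chain n → Chain n
fill []                  z = false
fill (false ∷ W)         (a , b) = fill W a , 0c _
fill (true ∷ [])         (a , b) = 0c _ , a
fill (true ∷ false ∷ W)  (a , b) = 0c _ , a
fill (true ∷ true ∷ [])  ((a , e) , b) = (0c _ , 0c _) , (a , 0c _)
fill (true ∷ true ∷ w ∷ W) ((a , (e , _)) , b) =
  (0c _ , (fill W e , 0c _)) , (a ⊕ (fill W e , 0c _) , 0c _)

fill-0 : (W : Vec Bool n) → fill W (0c n) ≡ 0c n
fill-0 []                    = refl
fill-0 (false ∷ W)           = cong (_, 0c _) (fill-0 W)
fill-0 (true ∷ [])           = refl
fill-0 (true ∷ false ∷ W)    = refl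
fill-0 (true ∷ true ∷ [])    = refl
fill-0 (true ∷ true ∷ w ∷ W) rewrite fill-0 W =
  cong (λ t → (0c _ , 0c _) , (t , 0c _)) (⊕-self (0c _))

cone : (a b : Chain n) → ∂ a ⊕ b ≡ 0c n → ∂ {suc n} (0c n , a) ≡ (a , b)
cone a b e = cong₂ _,_ (trans (cong (_⊕ a) (∂-0 _)) (⊕-idˡ a)) (⊕-zero⇒≡ (∂ a) b e)

on-blocked : (w : Bool) (W : Vec Bool n) (s : ℕ) {a b : Chain n} → On (w ∷ W) true s (a , b) →
             On W false s a × b ≡ 0c n
on-blocked true  W s h = h
on-blocked false W s h = h

blocked-on : (w : Bool) (W : Vec Bool n) (s : ℕ) {a : Chain n} → On W false s a → On (w ∷ W) true s (a , 0c n)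
blocked-on true  W s h = h , refl
blocked-on false W s h = h , refl

-- Every cycle of s-sets in a subset W of a path with more than 3s elements is a boundary: the
-- coefficient of the second vertex lives off the first three vertices and is filled by recursion,
-- the remainder is a cone over the first vertex.
fill-∂ : (W : Vec Bool n) (s : ℕ) (z : Chain n) → 3 * s < # W → On W false s z → ∂ z ≡ 0c n →
         ∂ (fill W z) ≡ z × On W false (suc s) (fill W z)
fill-∂ [] zero    z () h e
fill-∂ [] (suc s) z () h e
fill-∂ (false ∷ W) s (a , b) lt (h , refl) e
  with fill-∂ W s a lt h (trans (sym (⊕-idʳ _)) (cong proj₁ e))
... | e′ , h′ = cong₂ _,_ (trans (⊕-idʳ _) e′) (∂-0 _) , h′ , refl
fill-∂ (true ∷ []) s (a , b) lt (h , i) e = cone a b (cong proj₁ e) , on-0 [] false (suc s) , top s h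
  where top : ∀ s → On [] false s a → On [] true s a
        top zero    h = h
        top (suc s) h = h
fill-∂ (true ∷ false ∷ W) s (a , b) lt (h , i) e = cone a b (cong proj₁ e) , on-0 (false ∷ W) false (suc s) , h
fill-∂ (true ∷ true ∷ []) (suc zero) z (s≤s (s≤s ())) h e
fill-∂ (true ∷ true ∷ []) (suc (suc s)) z (s≤s (s≤s ())) h e
fill-∂ (true ∷ true ∷ []) zero ((a , e₁) , b , b₁) lt ((h , refl) , refl) e =
  refl , (refl , tt) , (tt , refl)
fill-∂ {suc (suc (suc n))} (true ∷ true ∷ w ∷ W) s ((a , (e₁ , e₂)) , (b , b₁)) lt ((h , i) , j) e =
  boundary , (on-0 (w ∷ W) false (suc s) , on-D) , on-⊕ (w ∷ W) false s h (on-unblock (w ∷ W) s on-D) , refl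
  where
  open ≡-Reasoning
  d = fill W e₁
  D : Chain (suc n)
  D = d , 0c n

  -- A set containing the first vertex cannot contain the second.
  b₁≡0 : ∀ s → On₁ true (true ∷ w ∷ W) s (b , b₁) → b₁ ≡ 0c _
  b₁≡0 zero    eq = cong proj₂ eq
  b₁≡0 (suc s) h  = proj₂ h

  eqₑ : ∂ (e₁ , e₂) ≡ 0c _
  eqₑ = trans (sym (⊕-idʳ _)) (trans (cong (∂ (e₁ , e₂) ⊕_) (sym (b₁≡0 s j))) (cong proj₂ (cong proj₁ e)))

  top : ∀ s → 3 * s < # (true ∷ true ∷ w ∷ W) → On₁ true (w ∷ W) s (e₁ , e₂) →
        ∂ D ≡ (e₁ , e₂) × On (w ∷ W) true s D
  -- For `s` = 0 only the empty set occurs, and it contributes nothing to the coefficient of the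
  -- second vertex.
  top zero lt refl = trans (cong ∂ D≡0) (∂-0 (suc n)) , subst (On (w ∷ W) true 0) (sym D≡0) (on-0 (w ∷ W) true 0)
    where
    D≡0 : D ≡ 0c (suc n)
    D≡0 = cong (_, 0c n) (fill-0 W)
  top (suc s) lt i with on-blocked w W s i
  ... | h₁ , refl with fill-∂ W s e₁ (count w (≤-trans (≤-reflexive (cong suc (sym (*-suc 3 s)))) lt)) h₁
                        (trans (sym (⊕-idʳ _)) (cong proj₁ eqₑ))
    where
    -- Lowering `s` by one costs at most the three vertices in front; the factor 3 comes from here.
    count : ∀ w → 4 + 3 * s ≤ # (true ∷ true ∷ w ∷ W) → 3 * s < # W
    count true  (s≤s (s≤s (s≤s lt))) = lt
    count false (s≤s (s≤s lt)) = ≤-trans (n≤1+n _) lt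
  ... | ∂d , on-d = cong₂ _,_ (trans (⊕-idʳ _) ∂d) (∂-0 n) , blocked-on w W (suc s) on-d

  ∂D   = proj₁ (top s lt i)
  on-D = proj₂ (top s lt i)

  boundary : ∂ {suc (suc (suc n))} ((0c _ , D) , (a ⊕ D , 0c _)) ≡ ((a , (e₁ , e₂)) , (b , b₁))
  boundary = cong₂ _,_
    (cong₂ _,_
      (begin
        (∂ (0c (suc n)) ⊕ D) ⊕ (a ⊕ D) ≡⟨ cong (λ t → (t ⊕ D) ⊕ (a ⊕ D)) (∂-0 (suc n)) ⟩
        (0c (suc n) ⊕ D) ⊕ (a ⊕ D)     ≡⟨ cong₂ _⊕_ (⊕-idˡ D) (⊕-comm a D) ⟩
        D ⊕ (D ⊕ a)                    ≡⟨ ⊕-cancel D a ⟩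
        a                              ∎)
      (trans (⊕-idʳ _) ∂D))
    (cong₂ _,_
      (begin
        ∂ (a ⊕ D) ⊕ 0c (suc n) ≡⟨ ⊕-idʳ _ ⟩
        ∂ (a ⊕ D)              ≡⟨ ∂-⊕ a D ⟩
        ∂ a ⊕ ∂ D              ≡⟨ cong (∂ a ⊕_) ∂D ⟩
        ∂ a ⊕ (e₁ , e₂)        ≡⟨ ⊕-zero⇒≡ _ b (cong proj₁ (cong proj₁ e)) ⟩
        b                      ∎)
      (trans (∂-0 (suc n)) (sym (b₁≡0 s j))))

-- The simplex of colours and the Sperner argument

data _⋖_ : Vec Bool c → Vec Bool c → Set where
  remove  : {J : Vec Bool c} → (false ∷ J) ⋖ (true ∷ J)
  keep : ∀ {b} {J J′ : Vec Bool c} → J′ ⋖ J → (b ∷ J′) ⋖ (b ∷ J)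

⋖-# : {J J′ : Vec Bool c} → J′ ⋖ J → # J ≡ suc (# J′)
⋖-# remove = refl
⋖-# (keep {b = true} r) = cong suc (⋖-# r)
⋖-# (keep {b = false} r) = ⋖-# r

⋖-⊑ : {J J′ : Vec Bool c} → J′ ⋖ J → ∀ i → lookup J′ i ⊑ lookup J i
⋖-⊑ remove      zero    ()
⋖-⊑ remove      (suc i) e = e
⋖-⊑ (keep r) zero    e = e
⋖-⊑ (keep r) (suc i) e = ⋖-⊑ r i e

-- The simplicial boundary of `J` evaluated by `φ`, that is, the sum of `φ` over all `J′ ⋖ J`.
δ : (Vec Bool c → Chain n) → Vec Bool c → Chain n
δ φ []          = 0c _
δ φ (false ∷ J) = δ (λ K → φ (false ∷ K)) J
δ φ (true ∷ J)  = φ (false ∷ J) ⊕ δ (λ K → φ (true ∷ K)) J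

δ-all : (Q : Chain n → Set) → Q (0c n) → (∀ {a b} → Q a → Q b → Q (a ⊕ b)) →
        (φ : Vec Bool c → Chain n) (J : Vec Bool c) → (∀ {J′} → J′ ⋖ J → Q (φ J′)) → Q (δ φ J)
δ-all Q q0 q⊕ φ []          h = q0
δ-all Q q0 q⊕ φ (false ∷ J) h = δ-all Q q0 q⊕ _ J (λ r → h (keep r))
δ-all Q q0 q⊕ φ (true ∷ J)  h = q⊕ (h remove) (δ-all Q q0 q⊕ _ J (λ r → h (keep r)))

δ-cong : (φ ψ : Vec Bool c → Chain n) (J : Vec Bool c) → (∀ {J′} → J′ ⋖ J → φ J′ ≡ ψ J′) → δ φ J ≡ δ ψ J
δ-cong φ ψ []          h = refl
δ-cong φ ψ (false ∷ J) h = δ-cong _ _ J (λ r → h (keep r))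
δ-cong φ ψ (true ∷ J)  h = cong₂ _⊕_ (h remove) (δ-cong _ _ J (λ r → h (keep r)))

δ-hom : ∀ {m} (f : Chain n → Chain m) → f (0c n) ≡ 0c m → (∀ a b → f (a ⊕ b) ≡ f a ⊕ f b) →
        (φ : Vec Bool c → Chain n) (J : Vec Bool c) → f (δ φ J) ≡ δ (λ K → f (φ K)) J
δ-hom f f0 f⊕ φ []          = f0
δ-hom f f0 f⊕ φ (false ∷ J) = δ-hom f f0 f⊕ _ J
δ-hom f f0 f⊕ φ (true ∷ J)  = trans (f⊕ _ _) (cong (_ ⊕_) (δ-hom f f0 f⊕ _ J))

δ-⊕ : (φ ψ : Vec Bool c → Chain n) (J : Vec Bool c) → δ (λ K → φ K ⊕ ψ K) J ≡ δ φ J ⊕ δ ψ J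
δ-⊕ φ ψ []          = sym (⊕-self _)
δ-⊕ φ ψ (false ∷ J) = δ-⊕ _ _ J
δ-⊕ φ ψ (true ∷ J)  = trans (cong ((φ (false ∷ J) ⊕ ψ (false ∷ J)) ⊕_) (δ-⊕ _ _ J)) (⊕-interchange _ _ _ _)

-- Two elements can be removed in two orders.
δδ≡0 : (φ : Vec Bool c → Chain n) (J : Vec Bool c) → δ (δ φ) J ≡ 0c n
δδ≡0 φ []          = refl
δδ≡0 φ (false ∷ J) = δδ≡0 _ J
δδ≡0 φ (true ∷ J)  = trans (cong (δ (λ K → φ (false ∷ K)) J ⊕_)
  (trans (δ-⊕ _ _ J) (trans (cong (δ (λ K → φ (false ∷ K)) J ⊕_) (δδ≡0 (λ K → φ (true ∷ K)) J)) (⊕-idʳ _)))) (⊕-self _)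

basis : Vec Bool c → Chain c
basis []          = true
basis (false ∷ J) = basis J , 0c _
basis (true ∷ J)  = 0c _ , basis J

∂-basis : (J : Vec Bool c) → ∂ (basis J) ≡ δ basis J
∂-basis []          = refl
∂-basis (false ∷ J) = trans (cong₂ _,_ (trans (⊕-idʳ _) (∂-basis J)) (∂-0 _))
  (δ-hom (_, 0c _) refl (λ a b → cong (a ⊕ b ,_) (sym (⊕-self _))) basis J)
∂-basis (true ∷ J)  = trans (cong₂ _,_ (trans (cong (_⊕ basis J) (∂-0 _)) (trans (⊕-idˡ _) (sym (⊕-idʳ _)))) (trans (∂-basis J) (sym (⊕-idˡ _))))
  (cong ((basis J , 0c _) ⊕_) (δ-hom (0c _ ,_) refl (λ a b → cong (_, a ⊕ b) (sym (⊕-self _))) basis J))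

unit : ∀ n → Chain n
unit n = basis (Vec.replicate n false)

∂-unit : ∀ n → ∂ (unit n) ≡ 0c n
∂-unit zero = refl
∂-unit (suc n) = cong₂ _,_ (trans (⊕-idʳ _) (∂-unit n)) (∂-0 n)

unit-on : (W : Vec Bool n) (p : Bool) → On W p 0 (unit n)
unit-on [] p = tt
unit-on (w ∷ W) p = unit-on W false , on₁-0 (w ∧ not p) W 0

-- Exterior multiplication by `j`: a set that contains `j` already is killed, which makes `∂-wedge`
-- the Leibniz rule.
wedge : Fin c → Chain c → Chain c
wedge zero    (a , b) = 0c _ , a
wedge (suc j) (a , b) = wedge j a , wedge j b

wedge-0 : (j : Fin c) → wedge j (0c c) ≡ 0c c
wedge-0 zero    = refl
wedge-0 (suc j) = cong₂ _,_ (wedge-0 j) (wedge-0 j)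

wedge-⊕ : (j : Fin c) (a b : Chain c) → wedge j (a ⊕ b) ≡ wedge j a ⊕ wedge j b
wedge-⊕ zero    (a , b) (a′ , b′) = cong (_, a ⊕ a′) (sym (⊕-self _))
wedge-⊕ (suc j) (a , b) (a′ , b′) = cong₂ _,_ (wedge-⊕ j a a′) (wedge-⊕ j b b′)

∂-wedge : (j : Fin c) (a : Chain c) → ∂ (wedge j a) ≡ a ⊕ wedge j (∂ a)
∂-wedge zero    (a , b) = cong₂ _,_
  (trans (cong (_⊕ a) (∂-0 _)) (trans (⊕-idˡ a) (sym (⊕-idʳ a))))
  (sym (trans (cong (b ⊕_) (⊕-comm (∂ a) b)) (⊕-cancel b (∂ a))))
∂-wedge (suc j) (a , b) = cong₂ _,_
  (trans (cong (_⊕ wedge j b) (∂-wedge j a))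
    (trans (⊕-assoc a _ _) (cong (a ⊕_) (sym (wedge-⊕ j (∂ a) b)))))
  (∂-wedge j b)

-- The chain map sending a set to the set of its colours, and to 0 if a colour repeats.
colours : Vec (Fin c) n → Chain n → Chain c
colours []        false   = 0c _
colours []        true    = unit _
colours (j ∷ col) (a , b) = colours col a ⊕ wedge j (colours col b)

colours-0 : (col : Vec (Fin c) n) → colours col (0c n) ≡ 0c c
colours-0 [] = refl
colours-0 (j ∷ col) rewrite colours-0 col | wedge-0 j = ⊕-self _

colours-⊕ : (col : Vec (Fin c) n) (a b : Chain n) → colours col (a ⊕ b) ≡ colours col a ⊕ colours col b
colours-⊕ [] false b = sym (⊕-idˡ _)
colours-⊕ [] true false = sym (⊕-idʳ _)
colours-⊕ [] true true = sym (⊕-self _)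
colours-⊕ (j ∷ col) (a , b) (a′ , b′)
  rewrite colours-⊕ col a a′ | colours-⊕ col b b′ | wedge-⊕ j (colours col b) (colours col b′) = ⊕-interchange _ _ _ _

colours-∂ : (col : Vec (Fin c) n) (z : Chain n) → colours col (∂ z) ≡ ∂ (colours col z)
colours-∂ [] false = sym (∂-0 _)
colours-∂ [] true = sym (∂-unit _)
colours-∂ (j ∷ col) (a , b) = begin
  colours col (∂ a ⊕ b) ⊕ wedge j (colours col (∂ b))
    ≡⟨ cong₂ _⊕_ (colours-⊕ col (∂ a) b) (cong (wedge j) (colours-∂ col b)) ⟩
  (colours col (∂ a) ⊕ colours col b) ⊕ wedge j (∂ (colours col b))
    ≡⟨ ⊕-assoc _ _ _ ⟩
  colours col (∂ a) ⊕ (colours col b ⊕ wedge j (∂ (colours col b)))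
    ≡⟨ cong₂ _⊕_ (colours-∂ col a) (sym (∂-wedge j (colours col b))) ⟩
  ∂ (colours col a) ⊕ ∂ (wedge j (colours col b))
    ≡⟨ sym (∂-⊕ _ _) ⟩
  ∂ (colours col a ⊕ wedge j (colours col b)) ∎
  where open ≡-Reasoning

-- In J s y: y is a combination of s-element subsets of J.
In : Vec Bool c → ℕ → Chain c → Set
In []          zero    y       = ⊤
In []          (suc s) y       = y ≡ false
In (false ∷ J) s       (a , b) = In J s a × b ≡ 0c _
In (true ∷ J)  zero    (a , b) = In J 0 a × b ≡ 0c _
In (true ∷ J)  (suc s) (a , b) = In J (suc s) a × In J s b

in-0 : (J : Vec Bool c) (s : ℕ) → In J s (0c c)
in-0 []          zero    = tt
in-0 []          (suc s) = refl
in-0 (false ∷ J) s       = in-0 J s , refl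
in-0 (true ∷ J)  zero    = in-0 J 0 , refl
in-0 (true ∷ J)  (suc s) = in-0 J (suc s) , in-0 J s

in-⊕ : (J : Vec Bool c) (s : ℕ) {a b : Chain c} → In J s a → In J s b → In J s (a ⊕ b)
in-⊕ []          zero    _ _ = tt
in-⊕ []          (suc s) refl refl = refl
in-⊕ (false ∷ J) s       (h , refl) (h′ , refl) = in-⊕ J s h h′ , ⊕-self _
in-⊕ (true ∷ J)  zero    (h , refl) (h′ , refl) = in-⊕ J 0 h h′ , ⊕-self _
in-⊕ (true ∷ J)  (suc s) (h , i) (h′ , i′) = in-⊕ J (suc s) h h′ , in-⊕ J s i i′

in-basis : (J : Vec Bool c) → In J (# J) (basis J)
in-basis []          = tt
in-basis (false ∷ J) = in-basis J , refl
in-basis (true ∷ J)  = in-0 J _ , in-basis J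

in-unit : (J : Vec Bool c) → In J 0 (unit c)
in-unit []          = tt
in-unit (false ∷ J) = in-unit J , refl
in-unit (true ∷ J)  = in-unit J , refl

in-large : (J : Vec Bool c) (s : ℕ) {y : Chain c} → # J < s → In J s y → y ≡ 0c c
in-large []          (suc s) lt h = h
in-large (false ∷ J) s       lt (h , refl) = cong (_, 0c _) (in-large J s lt h)
in-large (true ∷ J)  (suc s) (s≤s lt) (h , i) = cong₂ _,_ (in-large J (suc s) (≤-trans lt (n≤1+n s)) h) (in-large J s lt i)

in-wedge : (J : Vec Bool c) (s : ℕ) (j : Fin c) {y : Chain c} → lookup J j ≡ true → In J s y → In J (suc s) (wedge j y)
in-wedge (true ∷ J)  zero    zero    e (h , i) = in-0 J 1 , h
in-wedge (true ∷ J)  (suc s) zero    e (h , i) = in-0 J _ , h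
in-wedge (false ∷ J) s       (suc j) e (h , refl) = in-wedge J s j e h , wedge-0 j
in-wedge (true ∷ J)  zero    (suc j) e (h , refl) = in-wedge J 0 j e h , subst (In J 0) (sym (wedge-0 j)) (in-0 J 0)
in-wedge (true ∷ J)  (suc s) (suc j) e (h , i) = in-wedge J (suc s) j e h , in-wedge J s j e i

-- A chain of full size is a multiple of `J`, whose boundary contains the facet without its first
-- element. Nonemptiness matters: the empty set is a cycle.
no-top-cycle : (J : Vec Bool c) {k : ℕ} → # J ≡ suc k → (y : Chain c) → In J (# J) y → ∂ y ≡ 0c c → y ≡ 0c c
no-top-cycle (false ∷ J) e (a , b) (h , refl) z =
  cong (_, 0c _) (no-top-cycle J e a h (trans (sym (⊕-idʳ _)) (cong proj₁ z)))
no-top-cycle (true ∷ J) e (a , b) (h , i) z with in-large J (suc (# J)) ≤-refl h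
... | refl = cong (0c _ ,_) (trans (sym (⊕-idˡ b)) (trans (cong (_⊕ b) (sym (∂-0 _))) (cong proj₁ z)))

coloured : Vec (Fin c) n → Vec Bool c → Vec Bool n
coloured col J = Vec.map (lookup J) col

colours-in : (col : Vec (Fin c) n) (J : Vec Bool c) (p : Bool) (s : ℕ) {z : Chain n} →
             On (coloured col J) p s z → In J s (colours col z)
colours-in []        J p zero {true}  h = in-unit J
colours-in []        J p zero {false}  h = in-0 J 0
colours-in []        J p (suc s) refl = in-0 J (suc s)
colours-in (j ∷ col) J p s {a , b} (h , i) = in-⊕ J s (colours-in col J false s h) (rest p (lookup J j) refl s i)
  where
  none : ∀ s → b ≡ 0c _ → In J s (wedge j (colours col b))
  none s refl = subst (In J s) (sym (trans (cong (wedge j) (colours-0 col)) (wedge-0 j))) (in-0 J s)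
  rest : ∀ p w → lookup J j ≡ w → ∀ s → On₁ (w ∧ not p) (coloured col J) s b → In J s (wedge j (colours col b))
  rest true  true  e s       i = none s i
  rest p     false e s       i = none s i
  rest false true  e zero    i = none 0 i
  rest false true  e (suc s) i = in-wedge J s j e (colours-in col J true s i)

at : Chain c → Vec Bool c → Bool
at y       []          = y
at (a , b) (false ∷ K) = at a K
at (a , b) (true ∷ K)  = at b K

at-0 : (K : Vec Bool c) → at (0c c) K ≡ false
at-0 []          = refl
at-0 (false ∷ K) = at-0 K
at-0 (true ∷ K)  = at-0 K

at-⊕ : (a b : Chain c) (K : Vec Bool c) → at (a ⊕ b) K ≡ at a K xor at b K
at-⊕ a b []          = refl
at-⊕ (a , _) (b , _) (false ∷ K) = at-⊕ a b K
at-⊕ (_ , a) (_ , b) (true ∷ K)  = at-⊕ a b K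

at-basis : (K : Vec Bool c) → at (basis K) K ≡ true
at-basis []          = refl
at-basis (false ∷ K) = at-basis K
at-basis (true ∷ K)  = at-basis K

at-unit : (K : Vec Bool c) → at (unit c) K ≡ true → ∀ j → lookup K j ≡ false
at-unit (false ∷ K) e zero    = refl
at-unit (false ∷ K) e (suc j) = at-unit K e j
at-unit (true ∷ K)  e j with () ← trans (sym e) (at-0 K)

at-wedge : (j : Fin c) (y : Chain c) (K : Vec Bool c) → at (wedge j y) K ≡ true →
           Σ (Vec Bool c) λ K′ → at y K′ ≡ true × (∀ i → lookup K i ≡ true → j ≡ i ⊎ lookup K′ i ≡ true)
at-wedge zero    (a , b) (true ∷ K)  e = false ∷ K , e , λ { zero _ → inj₁ refl ; (suc i) h → inj₂ h }
at-wedge zero    (a , b) (false ∷ K) e with () ← trans (sym e) (at-0 K)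
at-wedge (suc j) (a , b) (false ∷ K) e with at-wedge j a K e
... | K′ , h , f = false ∷ K′ , h , λ { zero () ; (suc i) q → Sum.map₁ (cong suc) (f i q) }
at-wedge (suc j) (a , b) (true ∷ K) e with at-wedge j b K e
... | K′ , h , f = true ∷ K′ , h , λ { zero q → inj₂ refl ; (suc i) q → Sum.map₁ (cong suc) (f i q) }

-- The flag records whether the preceding vertex is taken.
Sparse : Bool → Vec Bool n → Set
Sparse p []      = ⊤
Sparse p (x ∷ S) = x ∧ p ≡ false × Sparse x S

xor-true : ∀ a b → a xor b ≡ true → a ≡ true ⊎ b ≡ true
xor-true true  b e = inj₁ refl
xor-true false b e = inj₂ e

Transversal : Vec (Fin c) n → Vec Bool n → Bool → Vec Bool c → Set
Transversal {n = n} col W p K = Σ (Vec Bool n) λ S → Sparse p S × (∀ i → lookup S i ⊑ lookup W i) ×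
  (∀ j → lookup K j ≡ true → Σ (Fin n) λ i → lookup S i ≡ true × lookup col i ≡ j)

-- The induction follows a summand of `colours` that is nonzero at `K` and takes the current vertex
-- exactly when this summand is the wedge; `On` then forbids the next vertex.
extract : (col : Vec (Fin c) n) (W : Vec Bool n) (p : Bool) (s : ℕ) (z : Chain n) → On W p s z →
          (K : Vec Bool c) → at (colours col z) K ≡ true → Transversal col W p K
extract [] [] p s true h K e = [] , tt , (λ ()) , λ j q → contra j (trans (sym q) (at-unit K e j))
  where contra : ∀ {A : Set} → Fin _ → true ≡ false → A
        contra j ()
extract [] [] p s false h K e with () ← trans (sym e) (at-0 K)
extract (j ∷ col) (w ∷ W) p s (a , b) (h , i) K e
  with xor-true _ _ (trans (sym (at-⊕ (colours col a) _ K)) e)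
... | inj₁ e₁ with extract col W false s a h K e₁
...   | S , sp , le , f = false ∷ S , (refl , sp) , (λ { zero () ; (suc i) → le i }) ,
          λ j′ q → let (i , r , t) = f j′ q in suc i , r , t
extract (j ∷ col) (w ∷ W) p s (a , b) (h , i) K e | inj₂ e₂ with at-wedge j (colours col b) K e₂
... | K′ , e′ , g = head w p s i
  where
  nonzero : b ≡ 0c _ → ⊥
  nonzero refl with () ← trans (sym e′) (trans (cong (λ t → at t K′) (colours-0 col)) (at-0 K′))
  head : ∀ w p s → On₁ (w ∧ not p) W s b → Transversal (j ∷ col) (w ∷ W) p K
  head false p     s       i = ⊥-elim (nonzero i)
  head true  true  s       i = ⊥-elim (nonzero i)
  head true  false zero    i = ⊥-elim (nonzero i)
  head true  false (suc s) i with extract col W true s b i K′ e′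
  ... | S , sp , le , f = true ∷ S , (refl , sp) , (λ { zero _ → refl ; (suc i) → le i }) , pick
    where
    pick : ∀ j′ → lookup K j′ ≡ true → Σ (Fin _) λ i → lookup (true ∷ S) i ≡ true × lookup (j ∷ col) i ≡ j′
    pick j′ q with g j′ q
    ... | inj₁ refl = zero , refl , refl
    ... | inj₂ q′   = let (i , r , t) = f j′ q′ in suc i , r , t

module _ (col : Vec (Fin c) n) (J₀ : Vec Bool c)
         (large : ∀ J → (∀ j → lookup J j ⊑ lookup J₀ j) → ∀ k → # J ≡ suc k → 3 * k < # coloured col J) where

  -- The topological proof of a Hall theorem: a chain map from the simplex on `J₀` to independent
  -- sets, the first argument being the size of `J`. The chains on the facets of `J` add up to a
  -- cycle, and `large` allows it to be filled with vertices of colours in `J`.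
  lift : ℕ → Vec Bool c → Chain n
  lift zero    J = unit n
  lift (suc k) J = fill (coloured col J) (δ (lift k) J)

  lookup-map-mono : ∀ {n} (col : Vec (Fin c) n) {J J′ : Vec Bool c} → (∀ i → lookup J i ⊑ lookup J′ i) →
                    ∀ i → lookup (coloured col J) i ⊑ lookup (coloured col J′) i
  lookup-map-mono (j ∷ col) le zero    = le j
  lookup-map-mono (j ∷ col) {J} {J′} le (suc i) = lookup-map-mono col {J} {J′} le i

  Sub : Vec Bool c → Set
  Sub J = ∀ j → lookup J j ⊑ lookup J₀ j

  sub : {J J′ : Vec Bool c} → J′ ⋖ J → Sub J → Sub J′
  sub r le j e = le j (⋖-⊑ r j e)

  lift-on : ∀ k J → Sub J → # J ≡ k → On (coloured col J) false k (lift k J)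
  lift-∂  : ∀ k J → Sub J → # J ≡ suc k → ∂ (lift (suc k) J) ≡ δ (lift k) J
  lift-fill : ∀ k J → Sub J → # J ≡ suc k →
              ∂ (lift (suc k) J) ≡ δ (lift k) J × On (coloured col J) false (suc k) (lift (suc k) J)
  lift-on zero    J le e = unit-on (coloured col J) false
  lift-on (suc k) J le e = proj₂ (lift-fill k J le e)
  lift-∂ k J le e = proj₁ (lift-fill k J le e)
  lift-fill k J le e = fill-∂ (coloured col J) k (δ (lift k) J) (large J le k e)
    (δ-all (On (coloured col J) false k) (on-0 (coloured col J) false k) (on-⊕ (coloured col J) false k) (lift k) J
      (λ {J′} r → on-mono (coloured col J′) (coloured col J) (lookup-map-mono col {J′} {J} (⋖-⊑ r)) false k
         (lift-on k J′ (sub r le) (suc-injective (trans (sym (⋖-# r)) e)))))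
    (trans (δ-hom ∂ (∂-0 n) ∂-⊕ (lift k) J) (cycle k e))
    where
    cycle : ∀ k → # J ≡ suc k → δ (λ K → ∂ (lift k K)) J ≡ 0c n
    cycle zero    e = δ-all (_≡ 0c n) refl (λ { refl refl → ⊕-self _ }) _ J (λ _ → ∂-unit n)
    cycle (suc k) e = trans
      (δ-cong _ _ J (λ {J′} r → lift-∂ k J′ (sub r le) (suc-injective (trans (sym (⋖-# r)) e))))
      (δδ≡0 (lift k) J)

  basis-empty : ∀ {c} (J : Vec Bool c) → # J ≡ 0 → basis J ≡ unit c
  basis-empty []          e = refl
  basis-empty (false ∷ J) e = cong (_, 0c _) (basis-empty J e)

  colours-unit : ∀ {n} (col : Vec (Fin c) n) → colours col (unit n) ≡ unit c
  colours-unit [] = refl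
  colours-unit (j ∷ col) rewrite colours-unit col | colours-0 col | wedge-0 j = ⊕-idʳ _

  -- Sperner's lemma: by induction both sides have the same boundary, so they differ by a cycle of
  -- full size in `J`, which vanishes.
  colours-lift : ∀ k J → Sub J → # J ≡ k → colours col (lift k J) ≡ basis J
  colours-lift zero    J le e = trans (colours-unit col) (sym (basis-empty J e))
  colours-lift (suc k) J le e = ⊕-zero⇒≡ _ _ (no-top-cycle J e _
    (in-⊕ J (# J) (subst (λ s → In J s (colours col (lift (suc k) J))) (sym e) (colours-in col J false (suc k) (lift-on (suc k) J le e))) (in-basis J))
    (begin
      ∂ (colours col (lift (suc k) J) ⊕ basis J)    ≡⟨ ∂-⊕ _ _ ⟩
      ∂ (colours col (lift (suc k) J)) ⊕ ∂ (basis J) ≡⟨ cong₂ _⊕_ (sym (colours-∂ col (lift (suc k) J))) (∂-basis J) ⟩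
      colours col (∂ (lift (suc k) J)) ⊕ δ basis J   ≡⟨ cong (λ t → colours col t ⊕ δ basis J) (lift-∂ k J le e) ⟩
      colours col (δ (lift k) J) ⊕ δ basis J         ≡⟨ cong (_⊕ δ basis J) (δ-hom (colours col) (colours-0 col) (colours-⊕ col) (lift k) J) ⟩
      δ (λ K → colours col (lift k K)) J ⊕ δ basis J ≡⟨ cong (_⊕ δ basis J) (δ-cong _ _ J (λ {J′} r → colours-lift k J′ (sub r le) (suc-injective (trans (sym (⋖-# r)) e)))) ⟩
      δ basis J ⊕ δ basis J                          ≡⟨ ⊕-self _ ⟩
      0c c                                           ∎))
    where open ≡-Reasoning


  transversal : Transversal col (coloured col J₀) false J₀
  transversal = extract col (coloured col J₀) false (# J₀) (lift (# J₀) J₀) (lift-on (# J₀) J₀ (λ _ e → e) refl) J₀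
    (trans (cong (λ y → at y J₀) (colours-lift (# J₀) J₀ (λ _ e → e) refl)) (at-basis J₀))

-- From chains to vertices of a list

#true : {V : Set} → (V → Bool) → List V → ℕ
#true f []      = 0
#true f (v ∷ L) = (if f v then 1 else 0) + #true f L

module _ {V : Set} where

  #true-≤ : {f g : V → Bool} (L : List V) → (∀ v → v ∈ L → f v ≡ true → g v ≡ true) → #true f L ≤ #true g L
  #true-≤ []      h = z≤n
  #true-≤ {f} {g} (v ∷ L) h with f v in ef | g v in eg
  ... | false | false = #true-≤ L (λ w i → h w (there i))
  ... | false | true  = ≤-trans (#true-≤ L (λ w i → h w (there i))) (n≤1+n _)
  ... | true  | true  = s≤s (#true-≤ L (λ w i → h w (there i)))
  ... | true  | false with () ← trans (sym eg) (h v (here refl) ef)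

  #true-∨ : (f g : V → Bool) → (∀ v → f v ≡ true → g v ≡ true → ⊥) → ∀ L →
            #true (λ v → f v ∨ g v) L ≡ #true f L + #true g L
  #true-∨ f g h [] = refl
  #true-∨ f g h (v ∷ L) with #true-∨ f g h L | f v in ef | g v in eg
  ... | ih | true  | true  = ⊥-elim (h v ef eg)
  ... | ih | true  | false = cong suc ih
  ... | ih | false | true  = trans (cong suc ih) (sym (+-suc _ _))
  ... | ih | false | false = ih

  #true-∨-≤ : (f g : V → Bool) → ∀ L → #true (λ v → f v ∨ g v) L ≤ #true f L + #true g L
  #true-∨-≤ f g [] = z≤n
  #true-∨-≤ f g (v ∷ L) with #true-∨-≤ f g L | f v | g v
  ... | ih | true  | true  = s≤s (≤-trans ih (+-monoʳ-≤ (#true f L) (n≤1+n _)))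
  ... | ih | true  | false = s≤s ih
  ... | ih | false | true  = ≤-trans (s≤s ih) (≤-reflexive (sym (+-suc _ _)))
  ... | ih | false | false = ih

  #true-subsingleton : (f : V → Bool) (L : List V) → Unique L → (∀ u v → u ∈ L → v ∈ L → f u ≡ true → f v ≡ true → u ≡ v) → #true f L ≤ 1
  #true-subsingleton f [] u h = z≤n
  #true-subsingleton f (v ∷ L) u h with f v in e
  ... | false = #true-subsingleton f L (tail-unique u) (λ a b i j → h a b (there i) (there j))
  ... | true  = s≤s (≤-trans (#true-≤ {g = λ _ → false} L
      (λ w i fw → ⊥-elim (head∉ u (subst (_∈ L) (sym (h v w (here refl) (there i) e fw)) i)))) (≤-reflexive (none L)))
    where none : ∀ L → #true (λ _ → false) L ≡ 0
          none [] = refl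
          none (_ ∷ L) = none L

  anyColour : ∀ {m} → Vec Bool m → (Fin m → V → Bool) → V → Bool
  anyColour []      c v = false
  anyColour (b ∷ J) c v = (b ∧ c zero v) ∨ anyColour J (c ∘ suc) v

  anyColour-elim : ∀ {m} (J : Vec Bool m) (c : Fin m → V → Bool) v → anyColour J c v ≡ true → Σ (Fin m) λ j → lookup J j ≡ true × c j v ≡ true
  anyColour-elim (true ∷ J) c v e with c zero v in eq
  ... | true = zero , refl , eq
  ... | false with anyColour-elim J (c ∘ suc) v e
  ...   | j , p , q = suc j , p , q
  anyColour-elim (false ∷ J) c v e with anyColour-elim J (c ∘ suc) v e
  ... | j , p , q = suc j , p , q

  count-colours : ∀ {m} (J : Vec Bool m) (c : Fin m → V → Bool) (t : ℕ) (L : List V) →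
                  (∀ v i j → c i v ≡ true → c j v ≡ true → i ≡ j) → (∀ j → lookup J j ≡ true → t ≤ #true (c j) L) →
                  (# J) * t ≤ #true (anyColour J c) L
  count-colours []          c t L d h = z≤n
  count-colours (false ∷ J) c t L d h = count-colours J (c ∘ suc) t L (λ v i j p q → Fin.suc-injective (d v _ _ p q)) (h ∘ suc)
  count-colours (true ∷ J)  c t L d h = ≤-trans
    (+-mono-≤ (h zero refl) (count-colours J (c ∘ suc) t L (λ v i j p q → Fin.suc-injective (d v _ _ p q)) (h ∘ suc)))
    (≤-reflexive (sym (#true-∨ (c zero) (anyColour J (c ∘ suc)) disjoint L)))
    where
    disjoint : ∀ v → c zero v ≡ true → anyColour J (c ∘ suc) v ≡ true → ⊥
    disjoint v p q with anyColour-elim J (c ∘ suc) v q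
    ... | j , _ , r with () ← d v zero (suc j) p r

  select : (L : List V) → Vec Bool (length L) → List V
  select []      []          = []
  select (v ∷ L) (true ∷ S)  = v ∷ select L S
  select (v ∷ L) (false ∷ S) = select L S

  select-⊆ : ∀ L S {v} → v ∈ select L S → v ∈ L
  select-⊆ []      []          ()
  select-⊆ (v ∷ L) (true ∷ S)  (here e)  = here e
  select-⊆ (v ∷ L) (true ∷ S)  (there i) = there (select-⊆ L S i)
  select-⊆ (v ∷ L) (false ∷ S) i         = there (select-⊆ L S i)

  select-tail : ∀ {a} L s S {v} → a ≢ v → v ∈ select (a ∷ L) (s ∷ S) → v ∈ select L S
  select-tail L true  S ne (here refl) = ⊥-elim (ne refl)
  select-tail L true  S ne (there i)   = i
  select-tail L false S ne i           = i

  select-sparse : ∀ L S {p} → Unique L → Sparse p S → ∀ {u v} → (u , v) ∈ steps L → u ∈ select L S → v ∈ select L S → ⊥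
  select-sparse (a ∷ b ∷ L) (false ∷ t ∷ S) un sp (here refl) i j = head∉ un (select-⊆ (b ∷ L) (t ∷ S) i)
  select-sparse (a ∷ b ∷ L) (true ∷ true ∷ S) un (_ , () , _) (here refl) i j
  select-sparse (a ∷ b ∷ L) (true ∷ false ∷ S) un sp (here refl) i (here e) = head∉ un (here (sym e))
  select-sparse (a ∷ b ∷ L) (true ∷ false ∷ S) un sp (here refl) i (there j) = head∉ (tail-unique un) (select-⊆ L S j)
  select-sparse (a ∷ L@(b ∷ M)) (s ∷ S) un (_ , sp) (there k) i j =
    select-sparse L S (tail-unique un) sp k
      (select-tail L s S (λ { refl → head∉ un (step-∈ˡ L k) }) i) (select-tail L s S (λ { refl → head∉ un (step-∈ʳ L k) }) j)

  module _ {c : ℕ} (colour : V → Fin c) (J₀ : Vec Bool c) where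

    cols : (L : List V) → Vec (Fin c) (length L)
    cols []      = []
    cols (v ∷ L) = colour v ∷ cols L

    #coloured : ∀ J L → # coloured (cols L) J ≡ #true (lookup J ∘ colour) L
    #coloured J [] = refl
    #coloured J (v ∷ L) with #coloured J L | lookup J (colour v)
    ... | ih | true  = cong suc ih
    ... | ih | false = ih

    select-colour : ∀ L S → (∀ i → lookup S i ⊑ lookup (coloured (cols L) J₀) i) → ∀ {v} → v ∈ select L S → lookup J₀ (colour v) ≡ true
    select-colour []      []          h ()
    select-colour (v ∷ L) (true ∷ S)  h (here refl) = h zero refl
    select-colour (v ∷ L) (true ∷ S)  h (there i)   = select-colour L S (h ∘ suc) i
    select-colour (v ∷ L) (false ∷ S) h i           = select-colour L S (h ∘ suc) i

    select-cover : ∀ L S i → lookup S i ≡ true → Σ V λ v → v ∈ select L S × colour v ≡ lookup (cols L) i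
    select-cover (v ∷ L) (true ∷ S)  zero    e = v , here refl , refl
    select-cover (v ∷ L) (true ∷ S)  (suc i) e with select-cover L S i e
    ... | w , j , q = w , there j , q
    select-cover (v ∷ L) (false ∷ S) (suc i) e = select-cover L S i e

    -- The bound is `3 * k` for `k` + 1 colours because the chain for these colours arises by
    -- filling a cycle of `k`-sets.
    independent-transversal : (L : List V) → Unique L →
      (∀ J → (∀ j → lookup J j ⊑ lookup J₀ j) → ∀ k → # J ≡ suc k → 3 * k < #true (lookup J ∘ colour) L) →
      Σ (List V) λ sel → (∀ {v} → v ∈ sel → v ∈ L × lookup J₀ (colour v) ≡ true) ×
        (∀ {u v} → (u , v) ∈ steps L → u ∈ sel → v ∈ sel → ⊥) ×
        (∀ j → lookup J₀ j ≡ true → Σ V λ v → v ∈ sel × colour v ≡ j)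
    independent-transversal L un large with transversal (cols L) J₀ (λ J le k e → subst (3 * k <_) (sym (#coloured J L)) (large J le k e))
    ... | S , sp , le , f = select L S , (λ i → select-⊆ L S i , select-colour L S le i) , select-sparse L S un sp ,
            λ j e → let (i , r , t) = f j e ; (v , k , q) = select-cover L S i r in v , k , trans q t

-- Realising paths in G

module _ {n : ℕ} {G : Graph n} where

  private V = Fin n

  walk-append : ∀ {a b y} I {R} → Walk G a b (a ∷ I ++ b ∷ []) → Walk G b y R → Walk G a y (a ∷ I ++ R)
  walk-append [] (step e (single _)) w = step e w
  walk-append (i ∷ I) (step e w′) w with walk-head w′
  ... | refl = step e (walk-append I w′ w)

  module _ (P : List V) (lab : V → V) where

    -- The label `k` names the component that is used, so detours with different labels are
    -- disjoint.
    record Detour (a b k : V) (d : ℕ) : Set where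
      constructor detour
      field
        inside  : List V
        walk    : Walk G a b (a ∷ inside ++ b ∷ [])
        distinct : Unique inside
        off     : ∀ {i} → i ∈ inside → i ∉ P × lab i ≡ k
        long    : d ≤ length inside

    Detour-sym : ∀ {a b k d} → Detour a b k d → Detour b a k d
    Detour-sym {a} {b} (detour I w u off l) = detour (reverse I) (rotate I w (single a))
      (unique-↭ (↭-sym (↭.↭-reverse I)) u) (λ i → off (↭.∈-resp-↭ (↭.↭-reverse I) i))
      (≤-trans l (≤-reflexive (sym (List.length-reverse I))))

  walk-adj : ∀ {a y L u v} → Walk G a y L → (u , v) ∈ steps L → adj G u v ≡ true
  walk-adj (step e (single _))     (here refl) = e
  walk-adj (step e (step _ _))     (here refl) = e
  walk-adj (step _ w@(step _ _))   (there i)   = walk-adj w i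

-- lab names the components off P, and κ v the component to which the spoke v is attached.
module Routing {n : ℕ} {G : Graph n} {x y : Fin n} {P : List (Fin n)} (H : Hubs G x y P) (lab κ : Fin n → Fin n) where
  open Hubs H
  private V = Fin n

  -- The paths that need not become longer when their green edges are replaced by detours: the detour
  -- from a to c skips b.
  data Neutral : List V → Set where
    stop    : ∀ {a} → Neutral (a ∷ [])
    along   : ∀ {a b L} → Adj P a b → Neutral (b ∷ L) → Neutral (a ∷ b ∷ L)
    through : ∀ {a b c L} → Green a b → B b ≡ true → Green c b → Neutral (c ∷ L) → Neutral (a ∷ b ∷ c ∷ L)

  record Routes : Set where
    field
      to-hub      : ∀ {v} → Spoke v → Detour {G = G} P lab v (hub v) (κ v) 1
      to-hub-long : ∀ {v} → Spoke v → B (hub v) ≡ false → Detour {G = G} P lab v (hub v) (κ v) 2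
      across      : ∀ {u v} → Spoke u → Spoke v → hub u ≡ hub v → u ≢ v → B (hub u) ≡ true → hub u ≢ x → hub u ≢ y →
                    Detour {G = G} P lab u v (κ u) 1
      same-class  : ∀ {u v} → Spoke u → Spoke v → κ u ≡ κ v → hub u ≡ hub v ⊎ u ≡ v ⊎ u ≡ hub v

  module _ (routes : Routes) where
    open Routes routes

    -- The realisation of `Q` may enter a component only if a spoke of it and the hub of this spoke
    -- both lie on `Q`. This keeps detours disjoint without a record of their vertices.
    Owned : List V → V → Set
    Owned Q k = Σ V λ v → Spoke v × κ v ≡ k × v ∈ Q × hub v ∈ Q

    record Realised (a : V) (Q : List V) : Set where
      field
        real    : List V
        walk    : Walk G a y real
        distinct : Unique real
        origin  : ∀ {v} → v ∈ real → v ∈ Q ⊎ (v ∉ P × Owned Q (lab v))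
        long    : length Q + #new B P Q ≤ length real
        longer  : Neutral Q ⊎ suc (length Q + #new B P Q) ≤ length real
    open Realised

    owned-mono : ∀ {Q Q′ k} → (∀ {v} → v ∈ Q → v ∈ Q′) → Owned Q k → Owned Q′ k
    owned-mono h (v , s , e , i , j) = v , s , e , h i , h j

    private
      new-along : ∀ {a b L} → Adj P a b → #new B P (a ∷ b ∷ L) ≡ #new B P (b ∷ L)
      new-along {a} {b} h rewrite ⌊⌋-true (adj? P a b) h | Bool.∧-zeroʳ (plain B a b) = refl

      new-≤ : ∀ {a b L} → #new B P (a ∷ b ∷ L) ≤ suc (#new B P (b ∷ L))
      new-≤ {a} {b} with plain B a b ∧ not ⌊ adj? P a b ⌋
      ... | true  = ≤-refl
      ... | false = n≤1+n _

      new-hubˡ : ∀ {a b L} → B a ≡ true → #new B P (a ∷ b ∷ L) ≡ #new B P (b ∷ L)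
      new-hubˡ e rewrite e = refl

      new-hubʳ : ∀ {a b L} → B b ≡ true → #new B P (a ∷ b ∷ L) ≡ #new B P (b ∷ L)
      new-hubʳ {a} e rewrite e | Bool.∧-zeroʳ (not (B a)) = refl

    prepend : ∀ {a b L} → a ∈ P → a ∉ b ∷ L → adj G a b ≡ true → Adj P a b → Realised b (b ∷ L) → Realised a (a ∷ b ∷ L)
    prepend {a} {b} {L} a∈ a∉ e h r = record
      { real = a ∷ real r ; walk = step e (walk r) ; distinct = ∷-unique fresh (distinct r)
      ; origin = λ { (here refl) → inj₁ (here refl) ; (there i) → Sum.map there (Product.map₂ (owned-mono there)) (origin r i) }
      ; long = s≤s (subst (λ m → suc (length L) + m ≤ length (real r)) (sym (new-along {L = L} h)) (long r))
      ; longer = Sum.map (along h) (λ l → s≤s (subst (λ m → suc (suc (length L) + m) ≤ length (real r)) (sym (new-along {L = L} h)) l)) (longer r) }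
      where
      fresh : a ∉ real r
      fresh i with origin r i
      ... | inj₁ j        = a∉ j
      ... | inj₂ (j , _)  = j a∈

    -- `L′` may be smaller than `L`: the rest can begin with the hub just reached, and only the
    -- vertices after it must not own the component.
    splice : ∀ {a b k d L L′ r} Q → Detour {G = G} P lab a b k d → a ∈ P → a ∈ Q → a ∉ L →
             (∀ {v} → v ∈ L → v ∈ Q) → (∀ {v} → v ∈ L → v ∈ P) → (∀ {v} → v ∈ L′ → v ∈ L) → Owned Q k → ¬ Owned L′ k →
             Walk G b y r → Unique r → (∀ {v} → v ∈ r → v ∈ L ⊎ (v ∉ P × Owned L′ (lab v))) →
             Σ (List V) λ r′ → Walk G a y r′ × Unique r′ × (∀ {v} → v ∈ r′ → v ∈ Q ⊎ (v ∉ P × Owned Q (lab v))) ×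
             suc (d + length r) ≤ length r′
    splice {a} {b} {k} {d} {L} {L′} {r} Q (detour I w u off l) a∈ aQ a∉ sub subP sub′ own nown wr ur or =
      a ∷ I ++ r , walk-append I w wr , ∷-unique fresh (Unique.++⁺ u ur disjoint) , origin′ ,
      s≤s (≤-trans (+-monoˡ-≤ (length r) l) (≤-reflexive (sym (List.length-++ I))))
      where
      disjoint : ∀ {v} → v ∈ I × v ∈ r → ⊥
      disjoint (i , j) with or j
      ... | inj₂ (_ , o) = nown (subst (Owned L′) (proj₂ (off i)) o)
      ... | inj₁ j′      = proj₁ (off i) (subP j′)
      fresh : a ∉ I ++ r
      fresh i with ∈-++⁻ I i
      ... | inj₁ j = proj₁ (off j) a∈
      ... | inj₂ j with or j
      ...   | inj₁ j′ = a∉ j′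
      ...   | inj₂ (j′ , _) = j′ a∈
      origin′ : ∀ {v} → v ∈ a ∷ I ++ r → v ∈ Q ⊎ (v ∉ P × Owned Q (lab v))
      origin′ (here refl) = inj₁ aQ
      origin′ (there i) with ∈-++⁻ I i
      ... | inj₁ j = inj₂ (proj₁ (off j) , subst (Owned Q) (sym (proj₂ (off j))) own)
      ... | inj₂ j = Sum.map sub (Product.map₂ (owned-mono (sub ∘ sub′))) (or j)

    Across : V → V → V → Set
    Across v a b = (v ≡ a × hub v ≡ b) ⊎ (v ≡ b × hub v ≡ a)

    across-∈ : ∀ {v a b L} → Across v a b → v ∈ a ∷ b ∷ L × hub v ∈ a ∷ b ∷ L
    across-∈ (inj₁ (refl , refl)) = here refl , there (here refl)
    across-∈ (inj₂ (refl , refl)) = there (here refl) , here refl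

    -- Two green edges of one component share their hub or coincide, so when both ends of one are
    -- used up, no other has both its ends on the rest of the path.
    not-owned : ∀ {v a b L} → Spoke v → Across v a b → Unique (a ∷ b ∷ L) → ¬ Owned L (κ v)
    not-owned {v} {a} {b} {L} s c u (v′ , s′ , e , i , j) = cases c (same-class s′ s e)
      where
      a∉ : a ∉ L
      a∉ h = head∉ u (there h)
      b∉ : b ∉ L
      b∉ h = head∉ (tail-unique u) h
      cases : Across v a b → hub v′ ≡ hub v ⊎ v′ ≡ v ⊎ v′ ≡ hub v → ⊥
      cases (inj₁ (refl , refl)) (inj₁ q)        = b∉ (subst (_∈ L) q j)
      cases (inj₁ (refl , refl)) (inj₂ (inj₁ q)) = a∉ (subst (_∈ L) q i)
      cases (inj₁ (refl , refl)) (inj₂ (inj₂ q)) = b∉ (subst (_∈ L) q i)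
      cases (inj₂ (refl , refl)) (inj₁ q)        = a∉ (subst (_∈ L) q j)
      cases (inj₂ (refl , refl)) (inj₂ (inj₁ q)) = b∉ (subst (_∈ L) q i)
      cases (inj₂ (refl , refl)) (inj₂ (inj₂ q)) = a∉ (subst (_∈ L) q i)

    -- `d` inner vertices pay for the replaced step and still gain one vertex: a step at a hub in
    -- `B` counts nothing and needs one, a pair edge counts at most one and needs two.
    Extra : V → V → ℕ → Set
    Extra a b d = ∀ L → suc (#new B P (a ∷ b ∷ L)) ≤ d + #new B P (b ∷ L)

    single-detour : ∀ {a b v d} → Spoke v → Across v a b → Extra a b d → Detour {G = G} P lab a b (κ v) d →
                    ∀ {L} → Unique (a ∷ b ∷ L) → (∀ {v} → v ∈ a ∷ b ∷ L → v ∈ P) →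
                    (r : List V) → Walk G b y (b ∷ r) → Unique (b ∷ r) → (∀ {v} → v ∈ r → v ∈ L ⊎ (v ∉ P × Owned L (lab v))) →
                    length L + #new B P (b ∷ L) ≤ length r → Realised a (a ∷ b ∷ L)
    single-detour {a} {b} {v} {d} s c ex D {L} u sub r w ur or l
      with splice {L = b ∷ L} {L′ = L} (a ∷ b ∷ L) D (sub (here refl)) (here refl) (head∉ u) there (sub ∘ there) there
             (v , s , refl , across-∈ c) (not-owned s c u) w ur
             (λ { (here refl) → inj₁ (here refl) ; (there i) → Sum.map₁ there (or i) })
    ... | r′ , w′ , u′ , or′ , l′ = record
      { real = r′ ; walk = w′ ; distinct = u′ ; origin = or′ ; long = ≤-trans (n≤1+n _) total ; longer = inj₂ total }
      where
      open ≤-Reasoning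
      total : suc (length (a ∷ b ∷ L) + #new B P (a ∷ b ∷ L)) ≤ length r′
      total = begin
        suc (suc (suc (length L) + #new B P (a ∷ b ∷ L))) ≡⟨ cong (λ m → suc (suc m)) (sym (+-suc (length L) _)) ⟩
        suc (suc (length L + suc (#new B P (a ∷ b ∷ L)))) ≤⟨ s≤s (s≤s (+-monoʳ-≤ (length L) (ex L))) ⟩
        suc (suc (length L + (d + #new B P (b ∷ L))))     ≡⟨ cong (λ m → suc (suc m)) (shuffle (length L) d _) ⟩
        suc (suc (d + (length L + #new B P (b ∷ L))))     ≤⟨ s≤s (s≤s (+-monoʳ-≤ d l)) ⟩
        suc (suc (d + length r))                          ≡⟨ cong suc (sym (+-suc d (length r))) ⟩
        suc (d + suc (length r))                          ≤⟨ l′ ⟩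
        length r′                                         ∎
        where
        shuffle : ∀ a b c → a + (b + c) ≡ b + (a + c)
        shuffle a b c = trans (sym (+-assoc a b c)) (trans (cong (_+ c) (+-comm a b)) (+-assoc b a c))

    -- A second green edge at `b` would lead back to `a`, unless `b` lies in `B` and `c` is another
    -- of its spokes, which the hypothesis on `Green c b` excludes.
    next-along : ∀ {v a b c} → Spoke v → Across v a b → a ≢ c → (B b ≡ true → ¬ Green c b) → Edge b c → Adj P b c
    next-along s c a≢c h (inj₁ e) = e
    next-along {a = a} s (inj₁ (refl , refl)) a≢c h (inj₂ e) with hub-kind s | e
    ... | inj₁ b       | inj₁ ((_ , nb) , _) with () ← trans (sym b) nb
    ... | inj₁ b       | inj₂ g = ⊥-elim (h b g)
    ... | inj₂ (_ , q) | inj₁ (_ , q′) = ⊥-elim (a≢c (trans (sym q) q′))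
    ... | inj₂ ((_ , nb) , q) | inj₂ (s′ , q″) with hub-kind s′
    ...   | inj₁ b with () ← trans (sym b) (trans (cong B q″) nb)
    ...   | inj₂ (_ , q′) = ⊥-elim (a≢c (trans (sym q) (trans (cong hub (sym q″)) q′)))
    next-along s (inj₂ (refl , refl)) a≢c h (inj₂ (inj₁ (_ , q))) = ⊥-elim (a≢c q)
    next-along (_ , nb) (inj₂ (refl , refl)) a≢c h (inj₂ (inj₂ (s′ , refl))) with hub-kind s′
    ... | inj₁ b with () ← trans (sym b) nb
    ... | inj₂ (_ , q′) = ⊥-elim (a≢c q′)

    to-hub-extra : ∀ {v a b} → Spoke v → Across v a b → Σ ℕ λ d → Extra a b d × Detour {G = G} P lab a b (κ v) d
    to-hub-extra {v} s c with B (hub v) in eq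
    ... | false = 2 , (λ L → s≤s (new-≤ {L = L})) , orient-detour c (to-hub-long s eq)
      where
      orient-detour : ∀ {a b d} → Across v a b → Detour {G = G} P lab v (hub v) (κ v) d → Detour {G = G} P lab a b (κ v) d
      orient-detour (inj₁ (refl , refl)) D = D
      orient-detour (inj₂ (refl , refl)) D = Detour-sym P lab D
    to-hub-extra {v} s (inj₁ (refl , refl)) | true = 1 , (λ L → s≤s (≤-reflexive (new-hubʳ {v} {hub v} {L} eq))) , to-hub s
    to-hub-extra {v} s (inj₂ (refl , refl)) | true = 1 , (λ L → s≤s (≤-reflexive (new-hubˡ {hub v} {v} {L} eq))) , Detour-sym P lab (to-hub s)

    P-adj : ∀ {a b} → Adj P a b → adj G a b ≡ true
    P-adj (inj₁ i) = walk-adj (proj₁ path) i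
    P-adj (inj₂ i) = trans (adj-sym G _ _) (walk-adj (proj₁ path) i)

    walk-shape : ∀ {c Q} {Γ : Graph n} → Walk Γ c y Q → Σ (List V) λ t → Q ≡ c ∷ t
    walk-shape (single _) = [] , refl
    walk-shape (step {vs = vs} _ _) = vs , refl

    single-step : ∀ {a b c v t} → Spoke v → Across v a b → Unique (a ∷ b ∷ c ∷ t) → (∀ {v} → v ∈ a ∷ b ∷ c ∷ t → v ∈ P) →
                  (B b ≡ true → ¬ Green c b) → Edge b c → Realised c (c ∷ t) → Realised a (a ∷ b ∷ c ∷ t)
    single-step {a} {b} {c} {v} {t} s cr u sub h e r with to-hub-extra s cr
    ... | d , ex , D = single-detour s cr ex D u sub (real r) (step (P-adj bc) (walk r)) (∷-unique fresh (distinct r)) (origin r)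
                         (subst (λ m → suc (length t) + m ≤ length (real r)) (sym (new-along {L = t} bc)) (long r))
      where
      bc : Adj P b c
      bc = next-along s cr (λ { refl → head∉ u (there (here refl)) }) h e
      fresh : b ∉ real r
      fresh i with origin r i
      ... | inj₁ j       = head∉ (tail-unique u) j
      ... | inj₂ (j , _) = j (sub (there (here refl)))

    -- At least one inner vertex of the detour replaces the skipped `b`, so nothing is lost. Two
    -- spokes with hub `x` or `y` may belong to different components, but a path between these two
    -- passes through neither.
    double-step : ∀ {a b c t} → Green a b → B b ≡ true → Green c b → b ≢ x → b ≢ y → Unique (a ∷ b ∷ c ∷ t) →
                  (∀ {v} → v ∈ a ∷ b ∷ c ∷ t → v ∈ P) → Realised c (c ∷ t) → Realised a (a ∷ b ∷ c ∷ t)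
    double-step {a} {b} {c} {t} (s , q) bb (s′ , q′) b≢x b≢y u sub r
      with splice {L = c ∷ t} {L′ = c ∷ t} (a ∷ b ∷ c ∷ t)
             (across s s′ (trans q (sym q′)) (λ { refl → head∉ u (there (here refl)) })
               (trans (cong B q) bb) (b≢x ∘ trans (sym q)) (b≢y ∘ trans (sym q)))
             (sub (here refl)) (here refl) (head∉ u ∘ there) (there ∘ there) (sub ∘ there ∘ there) (λ i → i)
             (a , s , refl , across-∈ (inj₁ (refl , q))) (not-owned s (inj₁ (refl , q)) u) (walk r) (distinct r) (origin r)
    ... | r′ , w′ , u′ , or′ , l′ = record
      { real = r′ ; walk = w′ ; distinct = u′ ; origin = or′
      ; long = ≤-trans (≤-reflexive (cong (λ m → suc (suc (suc (length t + m)))) new-eq)) (≤-trans (s≤s (s≤s (long r))) l′)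
      ; longer = Sum.map (through (s , q) bb (s′ , q′))
          (λ l → ≤-trans (≤-reflexive (cong (λ m → suc (suc (suc (suc (length t + m))))) new-eq)) (≤-trans (s≤s (s≤s l)) l′)) (longer r) }
      where
      new-eq : #new B P (a ∷ b ∷ c ∷ t) ≡ #new B P (c ∷ t)
      new-eq = trans (new-hubʳ {a} {b} {c ∷ t} bb) (new-hubˡ {b} {c} {t} bb)

    -- A green edge needs a look at the following step: either both become one detour, or the second
    -- runs along `P` and is copied. Hence the realisations of both remainders are supplied.
    two-steps : ∀ {a b c vs} → Edge a b → Edge b c → Walk graph c y vs → Unique (a ∷ b ∷ vs) → (∀ {v} → v ∈ a ∷ b ∷ vs → v ∈ P) →
                b ≢ x → Realised b (b ∷ vs) → Realised c vs → Realised a (a ∷ b ∷ vs)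
    two-steps {b = b} {c} e e′ w u sub b≢x r₁ r₂ with walk-shape w
    ... | t , refl with e
    ... | inj₁ h = prepend (sub (here refl)) (head∉ u) (P-adj h) h r₁
    ... | inj₂ (inj₂ (s , q)) = single-step s (inj₂ (refl , q)) u sub (λ bb → contradiction (trans (sym bb) (proj₂ s)) λ ()) e′ r₂
    ... | inj₂ (inj₁ g@(s , q)) with B b Bool.≟ true | green? c b
    ...   | yes bb | yes g′ = double-step g bb g′ b≢x (λ { refl → head∉ (tail-unique u) (walk-last w) }) u sub r₂
    ...   | yes bb | no ng  = single-step s (inj₁ (refl , q)) u sub (λ _ → ng) e′ r₂
    ...   | no nb  | _      = single-step s (inj₁ (refl , q)) u sub (λ bb → ⊥-elim (nb bb)) e′ r₂

    last-step : ∀ {a} → Edge a y → Unique (a ∷ y ∷ []) → (∀ {v} → v ∈ a ∷ y ∷ [] → v ∈ P) →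
                Realised y (y ∷ []) → Realised a (a ∷ y ∷ [])
    last-step (inj₁ h) u sub r = prepend (sub (here refl)) (head∉ u) (P-adj h) h r
    last-step (inj₂ (inj₁ (s , q))) u sub r with to-hub-extra s (inj₁ (refl , q))
    ... | d , ex , D = single-detour s (inj₁ (refl , q)) ex D u sub [] (single _) ([] ∷ []) (λ ()) z≤n
    last-step (inj₂ (inj₂ (s , q))) u sub r with to-hub-extra s (inj₂ (refl , q))
    ... | d , ex , D = single-detour s (inj₂ (refl , q)) ex D u sub [] (single _) ([] ∷ []) (λ ()) z≤n

    here-only : Realised y (y ∷ [])
    here-only = record { real = y ∷ [] ; walk = single y ; distinct = [] ∷ [] ; origin = inj₁ ; long = ≤-refl ; longer = inj₁ stop }

    route : ∀ {a Q} → Walk graph a y Q → Unique Q → (∀ {v} → v ∈ Q → v ∈ P) → (∀ {v} → v ∈ drop 1 Q → v ≢ x) → Realised a Q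
    route (single _)            u sub x∉ = here-only
    route (step e (single _))   u sub x∉ = last-step (edge e) u sub here-only
    route (step e (step {vs = vs} e′ w)) u sub x∉ = two-steps (edge e) (edge e′) w u sub (x∉ (here refl))
      (route (step e′ w) (tail-unique u) (sub ∘ there) (x∉ ∘ there))
      (route w (tail-unique (tail-unique u)) (sub ∘ there ∘ there) (x∉ ∘ there ∘ drop₁ vs))
      where
      drop₁ : ∀ vs {v} → v ∈ drop 1 vs → v ∈ vs
      drop₁ (_ ∷ _) i = there i

    neutral-or-longer : ∀ {Q} → IsPath graph x y Q → x ∈ P →
                        Neutral Q ⊎ (Σ (List V) λ R → IsPath G x y R × length Q + #new B P Q < length R)
    neutral-or-longer (w , u) x∈ with route w u (walk-⊆ x∈ w) (λ i → λ { refl → tail∉ w u i })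
      where
      tail∉ : ∀ {Q} → Walk graph x y Q → Unique Q → x ∉ drop 1 Q
      tail∉ (step _ _) u i = head∉ u i
    ... | r = Sum.map₂ (λ l → real r , (walk r , distinct r) , l) (longer r)

-- Descent along P

module _ {A : Set} where

  step-after : ∀ as {a b} {S : List A} → Unique (as ++ a ∷ S) → (a , b) ∈ steps (as ++ a ∷ S) → Σ (List A) λ S′ → S ≡ b ∷ S′
  step-after [] {S = _ ∷ S} u (here refl) = S , refl
  step-after [] {S = _ ∷ S} u (there i) = ⊥-elim (head∉ u (step-∈ˡ (_ ∷ S) i))
  step-after (c ∷ []) u (here refl) = ⊥-elim (head∉ u (here refl))
  step-after (c ∷ []) (_ ∷ u) (there i) = step-after [] u i
  step-after (c ∷ d ∷ as) u (here refl) = ⊥-elim (head∉ u (∈-++⁺ʳ (d ∷ as) (here refl)))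
  step-after (c ∷ d ∷ as) (_ ∷ u) (there i) = step-after (d ∷ as) u i

  step-before : ∀ as {a b} {S : List A} → Unique (as ++ a ∷ S) → (b , a) ∈ steps (as ++ a ∷ S) → b ∈ as
  step-before [] u i = ⊥-elim (head∉ u (step-tail _ i))
  step-before (c ∷ []) u (here refl) = here refl
  step-before (c ∷ []) (_ ∷ u) (there i) = ⊥-elim (head∉ u (step-tail _ i))
  step-before (c ∷ d ∷ as) u (here refl) = here refl
  step-before (c ∷ d ∷ as) (_ ∷ u) (there i) = there (step-before (d ∷ as) u i)

  step-++⁻ : ∀ as {a u v} {S : List A} → (u , v) ∈ steps (as ++ a ∷ S) → (u , v) ∈ steps (as ++ a ∷ []) ⊎ (u , v) ∈ steps (a ∷ S)
  step-++⁻ [] i = inj₂ i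
  step-++⁻ (c ∷ []) (here e) = inj₁ (here e)
  step-++⁻ (c ∷ []) (there i) = inj₂ i
  step-++⁻ (c ∷ d ∷ as) (here e) = inj₁ (here e)
  step-++⁻ (c ∷ d ∷ as) (there i) with step-++⁻ (d ∷ as) i
  ... | inj₁ j = inj₁ (there j)
  ... | inj₂ j = inj₂ j

  step-++ˡ : ∀ as {a u v} {S : List A} → (u , v) ∈ steps (as ++ a ∷ []) → (u , v) ∈ steps (as ++ a ∷ S)
  step-++ˡ (c ∷ []) (here e) = here e
  step-++ˡ (c ∷ d ∷ as) (here e) = here e
  step-++ˡ (c ∷ d ∷ as) (there i) = there (step-++ˡ (d ∷ as) i)

  Adj-++ʳ : ∀ as {u v} (S : List A) → Adj S u v → Adj (as ++ S) u v
  Adj-++ʳ as S (inj₁ i) = inj₁ (step-++ʳ as S i)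
  Adj-++ʳ as S (inj₂ i) = inj₂ (step-++ʳ as S i)

  unique-⊇ : {xs ys : List A} → ((a : A) (zs : List A) → Dec (a ∈ zs)) → Unique xs → (∀ {a} → a ∈ xs → a ∈ ys) → length ys ≤ length xs → ∀ {a} → a ∈ ys → a ∈ xs
  unique-⊇ {xs} {ys} dec u sub l {a} i with dec a xs
  ... | yes j = j
  ... | no nj = ⊥-elim (1+n≰n (≤-trans (unique-⊆-length {xs = a ∷ xs} ys (∷-unique nj u) (λ { (here refl) → i ; (there j) → sub j })) l))

two-of-two : ∀ {A : Set} {p q r s w : A} → p ≢ q → p ≡ r ⊎ p ≡ s → q ≡ r ⊎ q ≡ s → w ≡ r ⊎ w ≡ s → w ≡ p ⊎ w ≡ q
two-of-two ne (inj₁ refl) (inj₁ refl) _           = ⊥-elim (ne refl)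
two-of-two ne (inj₂ refl) (inj₂ refl) _           = ⊥-elim (ne refl)
two-of-two ne (inj₁ refl) (inj₂ refl) w           = w
two-of-two ne (inj₂ refl) (inj₁ refl) (inj₁ refl) = inj₂ refl
two-of-two ne (inj₂ refl) (inj₁ refl) (inj₂ refl) = inj₁ refl

walk-end : ∀ {n} {Γ : Graph n} {a y L} → Walk Γ a y L → a ≢ y → Σ (Fin n) λ p → (p , y) ∈ steps L
walk-end (single _) ne = ⊥-elim (ne refl)
walk-end {y = y} (step {z = z} e w) ne with z Fin.≟ y
walk-end (step e (single _)) ne | yes refl = _ , here refl
walk-end (step e (step _ _)) ne | yes refl = _ , here refl
walk-end (step e w@(single _)) ne | no nz = ⊥-elim (nz refl)
walk-end (step e w@(step _ _)) ne | no nz with walk-end w nz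
... | p , i = p , there i

end-last : ∀ {n} {Γ : Graph n} {a y v L} → Walk Γ a y L → Unique L → (y , v) ∉ steps L
end-last (step _ w@(single _)) u (here refl) = head∉ u (walk-last w)
end-last (step _ w@(step _ _)) u (here refl) = head∉ u (walk-last w)
end-last (step _ w@(step _ _)) u (there i)   = end-last w (tail-unique u) i

walk-prefix : ∀ {n} {Γ : Graph n} {x y z} as {a L} → Walk Γ x y (as ++ a ∷ L) → ∀ {M} → Walk Γ a z (a ∷ M) → Walk Γ x z (as ++ a ∷ M)
walk-prefix [] w w′ with walk-head w
... | refl = w′
walk-prefix (c ∷ []) (step e w) w′ with walk-head w
... | refl = step e w′
walk-prefix (c ∷ d ∷ as) (step e w) w′ = step e (walk-prefix (d ∷ as) w w′)

module Descent {n : ℕ} {G : Graph n} {x y : Fin n} {P : List (Fin n)} (H : Hubs G x y P) (lab κ : Fin n → Fin n)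
  (routes : Routing.Routes H lab κ) (longest : ∀ R → IsPath G x y R → length R ≤ length P) where
  open Hubs H
  open Routing H lab κ
  private V = Fin n

  -- The hubs that the detours of a neutral path skip, with the two spokes around each.
  greens : ∀ {L} → Neutral L → List V
  greens stop = []
  greens (along _ N) = greens N
  greens (through {a} {b} {c} _ _ _ N) = a ∷ b ∷ c ∷ greens N

  greens-⊆ : ∀ {L} (N : Neutral L) {v} → v ∈ greens N → v ∈ L
  greens-⊆ (along _ N) i = there (greens-⊆ N i)
  greens-⊆ (through _ _ _ N) (here e) = here e
  greens-⊆ (through _ _ _ N) (there (here e)) = there (here e)
  greens-⊆ (through _ _ _ N) (there (there (here e))) = there (there (here e))
  greens-⊆ (through _ _ _ N) (there (there (there i))) = there (there (greens-⊆ N i))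

  greens-step : ∀ {L} (N : Neutral L) {u v} → (u , v) ∈ steps L → Adj P u v ⊎ (u ∈ greens N × v ∈ greens N)
  greens-step (along h N) (here refl) = inj₁ h
  greens-step (along h N) (there i) = greens-step N i
  greens-step (through _ _ _ N) (here refl) = inj₂ (here refl , there (here refl))
  greens-step (through _ _ _ N) (there (here refl)) = inj₂ (there (here refl) , there (there (here refl)))
  greens-step (through _ _ _ N) (there (there i)) = Sum.map₂ (λ (p , q) → there (there (there p)) , there (there (there q))) (greens-step N i)

  greens-spoke : ∀ {L} (N : Neutral L) {v} → v ∈ greens N → B v ≡ false → Spoke v × hub v ∈ greens N × B (hub v) ≡ true
  greens-spoke (along _ N) i e = greens-spoke N i e
  greens-spoke (through (s , refl) b _ N) (here refl) e = s , there (here refl) , b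
  greens-spoke (through _ b _ N) (there (here refl)) e = contradiction (trans (sym e) b) λ ()
  greens-spoke (through _ b (s , q) N) (there (there (here refl))) e = s , there (here q) , trans (cong B q) b
  greens-spoke (through _ _ _ N) (there (there (there i))) e with greens-spoke N i e
  ... | s , j , b = s , there (there (there j)) , b

  greens-head : ∀ {a L} (N : Neutral (a ∷ L)) → Unique (a ∷ L) → a ∈ greens N → B a ≡ false
  greens-head (along _ N) u i = ⊥-elim (head∉ u (greens-⊆ N i))
  greens-head (through (s , _) _ _ _) u i = proj₂ s

  private
    clash : ∀ {b} {X : Set} → b ≡ true → b ≡ false → X
    clash refl ()

  -- Spokes lie outside `B`, so `v` is the middle of a `through`, where both steps are green.
  greens-centre : ∀ {L} (N : Neutral L) → Unique L → ∀ {u v} → v ∈ greens N → B v ≡ true → Adj L u v → Green u v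
  greens-centre (along h N) un i b (inj₁ (here refl)) = clash b (greens-head N (tail-unique un) i)
  greens-centre (along h N) un i b (inj₂ (here refl)) = ⊥-elim (head∉ un (greens-⊆ N i))
  greens-centre (along h N) un i b (inj₁ (there j))   = greens-centre N (tail-unique un) i b (inj₁ j)
  greens-centre (along h N) un i b (inj₂ (there j))   = greens-centre N (tail-unique un) i b (inj₂ j)
  greens-centre (through (s , _) _ _ N) un (here refl) b h = clash b (proj₂ s)
  greens-centre (through _ _ (s , _) N) un (there (there (here refl))) b h = clash b (proj₂ s)
  greens-centre (through g _ g′ N) un (there (here refl)) b (inj₁ (here refl))         = g
  greens-centre (through g _ g′ N) un (there (here refl)) b (inj₂ (here refl))         = ⊥-elim (head∉ un (here refl))
  greens-centre (through g _ g′ N) un (there (here refl)) b (inj₁ (there (here refl))) = ⊥-elim (head∉ (tail-unique un) (here refl))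
  greens-centre (through g _ g′ N) un (there (here refl)) b (inj₂ (there (here refl))) = g′
  greens-centre (through g _ g′ N) un (there (here refl)) b (inj₁ (there (there j)))   = ⊥-elim (head∉ (tail-unique un) (step-∈ʳ _ j))
  greens-centre (through g _ g′ N) un (there (here refl)) b (inj₂ (there (there j)))   = ⊥-elim (head∉ (tail-unique un) (step-∈ˡ _ j))
  greens-centre (through _ _ (s , _) N) un (there (there (there i))) b (inj₁ (here refl))         = ⊥-elim (head∉ (tail-unique un) (greens-⊆ N i))
  greens-centre (through _ _ (s , _) N) un (there (there (there i))) b (inj₂ (here refl))         = ⊥-elim (head∉ un (there (greens-⊆ N i)))
  greens-centre (through _ _ (s , _) N) un (there (there (there i))) b (inj₁ (there (here refl))) = clash b (proj₂ s)
  greens-centre (through _ _ (s , _) N) un (there (there (there i))) b (inj₂ (there (here refl))) = ⊥-elim (head∉ (tail-unique un) (greens-⊆ N i))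
  greens-centre (through _ _ _ N) un (there (there (there i))) b (inj₁ (there (there j))) = greens-centre N (tail-unique (tail-unique un)) i b (inj₁ j)
  greens-centre (through _ _ _ N) un (there (there (there i))) b (inj₂ (there (there j))) = greens-centre N (tail-unique (tail-unique un)) i b (inj₂ j)

  neutral-new : ∀ {Q} → Neutral Q → #new B P Q ≡ 0
  neutral-new stop = refl
  neutral-new (along {L = L} h N) = trans (new-along′ h) (neutral-new N)
    where
    new-along′ : ∀ {a b} → Adj P a b → #new B P (a ∷ b ∷ L) ≡ #new B P (b ∷ L)
    new-along′ {a} {b} h rewrite ⌊⌋-true (adj? P a b) h | Bool.∧-zeroʳ (plain B a b) = refl
  neutral-new (through {a} {b} _ e _ N) rewrite e | Bool.∧-zeroʳ (not (B a)) = neutral-new N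

  -- A `through` begins with a green edge, which is never an edge of `P`; so the prefix consists of
  -- `along` steps only.
  neutral-suffix : ∀ as {a L} → (∀ {u v} → (u , v) ∈ steps (as ++ a ∷ []) → Adj P u v) → Neutral (as ++ a ∷ L) → Neutral (a ∷ L)
  neutral-suffix [] h N = N
  neutral-suffix (c ∷ []) h (along _ N) = N
  neutral-suffix (c ∷ []) h (through (s , refl) _ _ _) = ⊥-elim (hub-far s (h (here refl)))
  neutral-suffix (c ∷ d ∷ as) h N = neutral-suffix (d ∷ as) (h ∘ there) (tail N)
    where
    tail : ∀ {M} → Neutral (c ∷ d ∷ M) → Neutral (d ∷ M)
    tail (along _ N) = N
    tail (through (s , refl) _ _ _) = ⊥-elim (hub-far s (h (here refl)))

  x∈P : x ∈ P
  x∈P = walk-first (proj₁ path)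

  longest-neutral : ∀ {Q} → IsPath graph x y Q → length P ≤ length Q + #new B P Q → Neutral Q × length P ≤ length Q
  longest-neutral {Q} p l with neutral-or-longer routes p x∈P
  ... | inj₂ (R , pR , lt) = ⊥-elim (<-irrefl refl (≤-trans (≤-trans (s≤s l) lt) (longest R pR)))
  ... | inj₁ N = N , subst (length P ≤_) (trans (cong (length Q +_) (neutral-new N)) (+-identityʳ _)) l

  -- Q follows P up to a and then passes through the hub b, while P goes on to h.
  module Diverge (as : List V) {a h b c : V} {S T : List V} (eP : P ≡ as ++ a ∷ h ∷ S)
    (pQ : IsPath graph x y (as ++ a ∷ b ∷ c ∷ T)) (lQ : length P ≤ length (as ++ a ∷ b ∷ c ∷ T))
    (whole : Neutral (as ++ a ∷ b ∷ c ∷ T))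
    (g : Green a b) (B-b : B b ≡ true) (g′ : Green c b) (N′ : Neutral (c ∷ T)) where

    Q L P₂ : List V
    L  = a ∷ b ∷ c ∷ T
    Q  = as ++ L
    P₂ = h ∷ S
    N : Neutral L
    N = through g B-b g′ N′
    wQ = proj₁ pQ
    uQ = proj₂ pQ
    uP : Unique (as ++ a ∷ h ∷ S)
    uP = subst Unique eP (proj₂ path)
    uL : Unique L
    uL = drop-unique as uQ
    uP₂ : Unique P₂
    uP₂ = tail-unique (drop-unique as uP)

    Q⊆P : ∀ {v} → v ∈ Q → v ∈ P
    Q⊆P = walk-⊆ x∈P wQ
    P⊆Q : ∀ {v} → v ∈ P → v ∈ Q
    P⊆Q = unique-⊇ _∈?_ uQ Q⊆P lQ
    P₂⊆P : ∀ {v} → v ∈ P₂ → v ∈ P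
    P₂⊆P i = subst (_ ∈_) (sym eP) (∈-++⁺ʳ as (there i))
    adj-P₂ : ∀ {u v} → Adj P₂ u v → Adj P u v
    adj-P₂ {u} {v} h = subst (λ M → Adj M u v) (trans (List.++-assoc as (a ∷ []) P₂) (sym eP)) (Adj-++ʳ (as ++ a ∷ []) P₂ h)
    ah : (a , h) ∈ steps P
    ah = subst (λ M → (a , h) ∈ steps M) (sym eP) (step-here as S)
    assocP : P ≡ (as ++ a ∷ []) ++ P₂
    assocP = trans eP (sym (List.++-assoc as (a ∷ []) P₂))
    assocQ : Q ≡ (as ++ a ∷ []) ++ b ∷ c ∷ T
    assocQ = sym (List.++-assoc as (a ∷ []) _)
    before-P₂ : ∀ {v} → v ∈ as ++ a ∷ [] → v ∉ P₂
    before-P₂ = unique-disjoint (as ++ a ∷ []) (subst Unique assocP (proj₂ path))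
    before-T : ∀ {v} → v ∈ as ++ a ∷ [] → v ∉ b ∷ c ∷ T
    before-T = unique-disjoint (as ++ a ∷ []) (subst Unique assocQ uQ)
    P₂⊆T : ∀ {v} → v ∈ P₂ → v ∈ b ∷ c ∷ T
    P₂⊆T i with ∈-++⁻ (as ++ a ∷ []) (subst (_ ∈_) assocQ (P⊆Q (P₂⊆P i)))
    ... | inj₁ j = ⊥-elim (before-P₂ j i)
    ... | inj₂ j = j
    T⊆P₂ : ∀ {v} → v ∈ b ∷ c ∷ T → v ∈ P₂
    T⊆P₂ i with ∈-++⁻ (as ++ a ∷ []) (subst (_ ∈_) assocP (Q⊆P (∈-++⁺ʳ as (there i))))
    ... | inj₁ j = ⊥-elim (before-T j i)
    ... | inj₂ j = j
    x-before : x ∈ as ++ a ∷ []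
    x-before = first as (subst (Walk G x y) eP (proj₁ path))
      where first : ∀ as {M} → Walk G x y (as ++ a ∷ M) → x ∈ as ++ a ∷ []
            first [] w = here (walk-head w)
            first (_ ∷ as) w = here (walk-head w)
    P₂≢x : ∀ {v} → v ∈ P₂ → v ≢ x
    P₂≢x i refl = before-P₂ x-before i

    ¬ah : ¬ Adj Q a h
    ¬ah (inj₁ i) with step-after as uQ i
    ... | _ , refl = hub-far (proj₁ g) (subst (Adj P a) (sym (proj₂ g)) (inj₁ ah))
    ¬ah (inj₂ i) = before-P₂ (∈-++⁺ˡ (step-before as uQ i)) (here refl)

    -- `Q` has no new plain steps and at most the length of `P`, so the count has no room for a
    -- dropped plain step.
    no-lost : ∀ {e} → e ∈ steps P → plain B (proj₁ e) (proj₂ e) ≡ true → ¬ Adj Q (proj₁ e) (proj₂ e) → ⊥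
    no-lost {e} i pl na = 1+n≰n (≤-trans (subst₂ _≤_ (+-comm (length P) 1) (trans (cong (length Q +_) (neutral-new whole)) (+-identityʳ _))
        (count pQ (λ v i _ → P⊆Q i) (e ∷ []) ([] ∷ []) λ { (here refl) → i , pl , na }))
      (unique-⊆-length P uQ Q⊆P))

    -- `Q` drops the step from `a` to `h`, and `a` is a spoke; with `h` outside `B` a plain step
    -- would be lost.
    B-h : B h ≡ true
    B-h with B h in eq
    ... | true  = refl
    ... | false = ⊥-elim (no-lost ah (cong₂ (λ s t → not s ∧ not t) (proj₂ (proj₁ g)) eq) ¬ah)

    -- Otherwise `P` has only one vertex after `a`, while `b` and `c` both have to lie there.
    h≢y : h ≢ y
    h≢y refl with P₂-only
      where
      P₂-only : S ≡ []
      P₂-only = end S (walk-from (as ++ a ∷ []) (subst (Walk G x y) assocP (proj₁ path))) uP₂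
        where end : ∀ S → Walk G y y (y ∷ S) → Unique (y ∷ S) → S ≡ []
              end [] w u = refl
              end (_ ∷ _) (step _ w) u = ⊥-elim (head∉ u (walk-last w))
    ... | refl with T⊆P₂ (here refl) | T⊆P₂ (there (here refl))
    ... | here refl | here refl = head∉ (tail-unique uL) (here refl)

    gs : List V
    gs = greens N

    -- Both steps of `Q` at `v` run along `P`, and `v` has only two neighbours along `P`, so both
    -- are used.
    untouched : ∀ {v} → v ∈ b ∷ c ∷ T → v ≢ y → v ∉ gs → ∀ {w} → Adj P v w → Adj Q v w
    untouched {v} i v≢y ng {w} vw with
      two-of-two (Inner.pre≢post IQ) (Inner.only IP (along-P (inj₂ (Inner.pre-step IQ))))
        (Inner.only IP (along-P (inj₁ (Inner.post-step IQ)))) (Inner.only IP vw)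
      where
      v≢x : v ≢ x
      v≢x = P₂≢x (T⊆P₂ i)
      IQ = inner pQ (∈-++⁺ʳ as (there i)) v≢x v≢y
      IP = inner path (Q⊆P (∈-++⁺ʳ as (there i))) v≢x v≢y
      near : ∀ {s t} → (s , t) ∈ steps Q → s ≡ v ⊎ t ≡ v → (s , t) ∈ steps L
      near j e with step-++⁻ as j
      ... | inj₂ k = k
      near j (inj₁ refl) | inj₁ k = ⊥-elim (before-T (step-∈ˡ _ k) i)
      near j (inj₂ refl) | inj₁ k = ⊥-elim (before-T (step-∈ʳ _ k) i)
      along-P : ∀ {w} → Adj Q v w → Adj P v w
      along-P (inj₁ j) with greens-step N (near j (inj₁ refl))
      ... | inj₁ k       = k
      ... | inj₂ (k , _) = ⊥-elim (ng k)
      along-P (inj₂ j) with greens-step N (near j (inj₂ refl))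
      ... | inj₁ k       = Adj-sym {L = P} k
      ... | inj₂ (_ , k) = ⊥-elim (ng k)
    ... | inj₁ refl = inj₂ (Inner.pre-step (inner pQ (∈-++⁺ʳ as (there i)) (P₂≢x (T⊆P₂ i)) v≢y))
    ... | inj₂ refl = inj₁ (Inner.post-step (inner pQ (∈-++⁺ʳ as (there i)) (P₂≢x (T⊆P₂ i)) v≢y))

    -- The steps of `Q` at such a hub are green, and green edges are not edges of `P`.
    centre-lost : ∀ {u v} → v ∈ b ∷ c ∷ T → v ∈ gs → B v ≡ true → Adj Q u v → Adj P u v → ⊥
    centre-lost {u} {v} i k bv uv uv′ with greens-centre N uL k bv (near uv)
      where
      near : Adj Q u v → Adj L u v
      near (inj₁ j) with step-++⁻ as j
      ... | inj₂ k = inj₁ k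
      ... | inj₁ k = ⊥-elim (before-T (step-∈ʳ _ k) i)
      near (inj₂ j) with step-++⁻ as j
      ... | inj₂ k = inj₂ k
      ... | inj₁ k = ⊥-elim (before-T (step-∈ˡ _ k) i)
    ... | s , refl = hub-far s uv′

    -- Otherwise `Q` would keep the step between `a` and `h`.
    h∈gs : h ∈ gs
    h∈gs = decidable-stable (h ∈? gs) λ ng → ¬ah (Adj-sym {L = Q} (untouched (P₂⊆T (here refl)) h≢y ng (inj₂ ah)))

    -- Besides the ends of `P₂` only the hubs that `Q` passes by green edges may be skipped; the
    -- other members of `B` on `P₂` become spokes.
    Hub₂ : V → Set
    Hub₂ v = v ≡ h ⊎ v ≡ y ⊎ (v ∈ gs × B v ≡ true)

    hub₂? : ∀ v → Dec (Hub₂ v)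
    hub₂? v = (v Fin.≟ h) ⊎-dec (v Fin.≟ y) ⊎-dec ((v ∈? gs) ×-dec (B v Bool.≟ true))

    B₂ : V → Bool
    B₂ v = ⌊ hub₂? v ⌋

    B₂-elim : ∀ {v} → B₂ v ≡ true → Hub₂ v
    B₂-elim {v} = true-⌊⌋ (hub₂? v)
    B₂-intro : ∀ {v} → Hub₂ v → B₂ v ≡ true
    B₂-intro {v} = ⌊⌋-true (hub₂? v)
    B₂⇒B : ∀ {v} → Hub₂ v → B v ≡ true
    B₂⇒B (inj₁ refl)           = B-h
    B₂⇒B (inj₂ (inj₁ refl))    = B-y
    B₂⇒B (inj₂ (inj₂ (_ , e))) = e

    -- The hub h of the vertices without a green edge on Q is fictitious: there is no detour to it. It
    -- makes their degree odd, and real-start shows that a path of minimal loss does not use it.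
    hub₂ : V → V
    hub₂ v = if ⌊ v ∈? gs ⌋ then hub v else h

    hub₂-cases : ∀ v → (v ∈ gs × hub₂ v ≡ hub v) ⊎ (v ∉ gs × hub₂ v ≡ h)
    hub₂-cases v with v ∈? gs
    ... | yes i = inj₁ (i , refl)
    ... | no ni = inj₂ (ni , refl)

    Spoke₂ : V → Set
    Spoke₂ v = Inside h y P₂ v × B₂ v ≡ false

    not-hub₂ : ∀ {v} → Spoke₂ v → ¬ Hub₂ v
    not-hub₂ (_ , e) k = clash (B₂-intro k) e

    plain-green : ∀ {v} → Spoke₂ v → v ∈ gs → B v ≡ false
    plain-green s i = Bool.¬-not λ e → not-hub₂ s (inj₂ (inj₂ (i , e)))

    green-spoke : ∀ {v} → Spoke₂ v → v ∈ gs → Spoke v × hub v ∈ gs × B (hub v) ≡ true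
    green-spoke s i = greens-spoke N i (plain-green s i)

    centre-in : ∀ {v} → v ∈ gs → B v ≡ true → v ∈ b ∷ c ∷ T
    centre-in i e with greens-⊆ N i
    ... | here refl = clash e (proj₂ (proj₁ g))
    ... | there j   = j

    hub₂-hub : ∀ {v} → Spoke₂ v → Hub₂ (hub₂ v)
    hub₂-hub {v} s with hub₂-cases v
    ... | inj₁ (i , q) = subst Hub₂ (sym q) (inj₂ (inj₂ (proj₂ (green-spoke s i))))
    ... | inj₂ (_ , q) = inj₁ q

    -- An untouched vertex after `h` would make `Q` use an edge of `P` at `h`, where its steps are
    -- green. So no spoke with the fictitious hub is consecutive to `h`, as `far₂` requires.
    next-green : ∀ {s} → (h , s) ∈ steps P₂ → s ≢ y → s ∈ gs
    next-green {s} i s≢y = decidable-stable (s ∈? gs) λ ng → centre-lost (P₂⊆T (here refl)) h∈gs B-h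
      (untouched (P₂⊆T (step-∈ʳ P₂ i)) s≢y ng (adj-P₂ (inj₂ i))) (adj-P₂ (inj₂ i))

    far₂ : ∀ {v} → Spoke₂ v → ¬ Adj P₂ v (hub₂ v)
    far₂ {v} s@((i , v≢h , v≢y) , _) e with hub₂-cases v
    ... | inj₁ (j , q) = hub-far (proj₁ (green-spoke s j)) (subst (Adj P v) q (adj-P₂ e))
    ... | inj₂ (nj , q) with subst (Adj P₂ v) q e
    ...   | inj₁ k = head∉ uP₂ (step-tail S k)
    ...   | inj₂ k = nj (next-green k v≢y)

    H₂ : Hubs G h y P₂
    H₂ = record
      { path = walk-from (as ++ a ∷ []) (subst (Walk G x y) assocP (proj₁ path)) , uP₂
      ; x≢y = h≢y ; B = B₂ ; B-x = B₂-intro (inj₁ refl) ; B-y = B₂-intro (inj₂ (inj₁ refl))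
      ; B-sparse = λ i bu bv → sparse (adj-P₂ (inj₁ i)) (B₂⇒B (B₂-elim bu)) (B₂⇒B (B₂-elim bv))
      ; hub = hub₂ ; hub-∈ = in₂ ; hub-≢ = ne₂ ; hub-far = far₂ ; hub-kind = λ s → inj₁ (B₂-intro (hub₂-hub s)) }
      where
      sparse : ∀ {u v} → Adj P u v → B u ≡ true → B v ≡ true → ⊥
      sparse e = no-BB-edge (inj₁ e)
      in₂ : ∀ {v} → Spoke₂ v → hub₂ v ∈ P₂
      in₂ {v} s with hub₂-cases v
      ... | inj₁ (i , q) = let (_ , j , e) = green-spoke s i in subst (_∈ P₂) (sym q) (T⊆P₂ (centre-in j e))
      ... | inj₂ (_ , q) = here q
      ne₂ : ∀ {v} → Spoke₂ v → hub₂ v ≢ v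
      ne₂ {v} s e with hub₂-cases v
      ... | inj₁ (i , q) = hub-≢ (proj₁ (green-spoke s i)) (trans (sym q) e)
      ... | inj₂ (_ , q) = proj₁ (proj₂ (proj₁ s)) (trans (sym e) q)

    module H₂ = Hubs H₂

    start : Σ V λ o → Spoke₂ o
    start with inner-first (proj₁ H₂.path) h≢y
      where
      inner-first : ∀ {S} → Walk G h y (h ∷ S) → h ≢ y → Σ V λ o → (h , o) ∈ steps (h ∷ S)
      inner-first (single _) ne = ⊥-elim (ne refl)
      inner-first (step _ (single o)) ne = o , here refl
      inner-first (step {z = o} _ (step _ _)) ne = o , here refl
    ... | o , i = o , (step-∈ʳ P₂ i , (λ { refl → step-antisym P₂ uP₂ i i }) , o≢y) , B₂-false
      where
      ¬Bo : B o ≡ true → ⊥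
      ¬Bo e = no-BB-edge (inj₁ (adj-P₂ (inj₁ i))) B-h e
      o≢y : o ≢ y
      o≢y refl = ¬Bo B-y
      B₂-false : B₂ o ≡ false
      B₂-false = ⌊⌋-false (hub₂? o) λ k → ¬Bo (B₂⇒B k)

    -- All hubs of `H₂` lie in `B₂`. Without pairs a missed hub cannot be traded for a new plain
    -- step, so the second path again visits everything.
    no-new : ∀ {u v} → H₂.Edge u v → plain B₂ u v ∧ not ⌊ adj? P₂ u v ⌋ ≡ false
    no-new {u} {v} (inj₁ k) rewrite ⌊⌋-true (adj? P₂ u v) k = Bool.∧-zeroʳ (plain B₂ u v)
    no-new {u} (inj₂ (inj₁ (s , refl))) rewrite B₂-intro (hub₂-hub s) | Bool.∧-zeroʳ (not (B₂ u)) = refl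
    no-new (inj₂ (inj₂ (s , refl))) rewrite B₂-intro (hub₂-hub s) = refl

    new₂ : ∀ {M a′} → Walk H₂.graph a′ y M → #new B₂ P₂ M ≡ 0
    new₂ (single _) = refl
    new₂ (step e (single v)) rewrite no-new (H₂.edge e) = refl
    new₂ (step e w@(step _ _)) = cong₂ (λ t m → (if t then 1 else 0) + m) (no-new (H₂.edge e)) (new₂ w)

    module Second {M : List V} (pM : IsPath H₂.graph h y (h ∷ M)) (ne : h ∷ M ≢ P₂)
                  (cov : ∀ v → v ∈ P₂ → B₂ v ≡ false → v ∈ h ∷ M) where

      wM = proj₁ pM

      count₂ : (lost : List (V × V)) → Unique lost →
               (∀ {u v} → (u , v) ∈ lost → (u , v) ∈ steps P₂ × plain B₂ u v ≡ true × ¬ Adj (h ∷ M) u v) →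
               length P₂ + length lost ≤ length (h ∷ M)
      count₂ lost ul k = ≤-trans (H₂.count pM cov lost ul k)
        (≤-reflexive (trans (cong (length (h ∷ M) +_) (new₂ wM)) (+-identityʳ _)))

      full : length P₂ ≤ length (h ∷ M)
      full = subst (_≤ length (h ∷ M)) (+-identityʳ _) (count₂ [] [] λ ())

      M⊆P₂ : ∀ {v} → v ∈ h ∷ M → v ∈ P₂
      M⊆P₂ = H₂.walk-⊆ (here refl) wM

      no-lost₂ : ∀ {u v} → Adj P₂ u v → B₂ u ≡ false → B₂ v ≡ false → ¬ Adj (h ∷ M) u v → ⊥
      no-lost₂ (inj₁ i) bu bv na = 1+n≰n (≤-trans
        (subst (_≤ length (h ∷ M)) (+-comm (length P₂) 1) (count₂ (_ ∷ []) ([] ∷ [])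
          λ { (here refl) → i , cong₂ (λ s t → not s ∧ not t) bu bv , na }))
        (unique-⊆-length P₂ (proj₂ pM) M⊆P₂))
      no-lost₂ (inj₂ i) bu bv na = no-lost₂ (inj₁ i) bv bu (na ∘ Adj-sym {L = h ∷ M})

      -- No green edge of `H₂` has `y` as hub: it is neither `h` nor a hub that `Q` passes through,
      -- being the last vertex of `Q`.
      last-edge : Σ V λ p → (p , y) ∈ steps P₂ × (p , y) ∈ steps (h ∷ M)
      last-edge with walk-end wM h≢y
      ... | p , i = p , along₂ (H₂.walk-edge wM i) , i
        where
        not-centre : y ∉ gs
        not-centre i with greens-mid N i B-y
          where
          greens-mid : ∀ {R} (N : Neutral R) {v} → v ∈ greens N → B v ≡ true → Σ V λ w → (v , w) ∈ steps R
          greens-mid (along _ N) i e = Product.map₂ there (greens-mid N i e)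
          greens-mid (through (s , _) _ _ _) (here refl) e = clash e (proj₂ s)
          greens-mid (through _ _ _ N) (there (here refl)) e = _ , there (here refl)
          greens-mid (through _ _ (s , _) _) (there (there (here refl))) e = clash e (proj₂ s)
          greens-mid (through _ _ _ N) (there (there (there i))) e = Product.map₂ (there ∘ there) (greens-mid N i e)
        ... | w , j = end-last wQ uQ (step-++ʳ as L j)
        along₂ : H₂.Edge p y → (p , y) ∈ steps P₂
        along₂ (inj₁ (inj₁ k)) = k
        along₂ (inj₁ (inj₂ k)) = ⊥-elim (end-last (proj₁ H₂.path) uP₂ k)
        along₂ (inj₂ (inj₂ (s , _))) = ⊥-elim (proj₂ (proj₂ (proj₁ s)) refl)
        along₂ (inj₂ (inj₁ (s , q))) with hub₂-cases p
        ... | inj₂ (_ , q′) = ⊥-elim (h≢y (trans (sym q′) q))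
        ... | inj₁ (j , q′) = ⊥-elim (not-centre (subst (_∈ gs) (trans (sym q′) q) (proj₁ (proj₂ (green-spoke s j)))))

      -- The second path reaches `v` from `h` and goes on to a vertex other than `e`. By the
      -- properties of `Q`, `e` is neither `h` nor a hub passed by green edges, and by `last-edge`
      -- it is not `y`. So a plain step is dropped, which the count forbids.
      unpaid : ∀ {v e} (i : (h , v) ∈ steps (h ∷ M)) (s : Spoke₂ v) → v ∉ gs → Adj P₂ v e →
               e ≢ Inner.post (inner pM (step-∈ʳ (h ∷ M) i) (proj₁ (proj₂ (proj₁ s))) (proj₂ (proj₂ (proj₁ s)))) → ⊥
      unpaid {v} {e} i s@((v∈ , v≢h , v≢y) , bv) ng ve e≢c with hub₂? e
      ... | yes (inj₁ refl) = far₂ s (subst (Adj P₂ v) (sym out) ve)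
        where out : hub₂ v ≡ h
              out with hub₂-cases v
              ... | inj₁ (j , _) = ⊥-elim (ng j)
              ... | inj₂ (_ , q) = q
      ... | yes (inj₂ (inj₂ (j , b))) = centre-lost (centre-in j b) j b (untouched (P₂⊆T v∈) v≢y ng (adj-P₂ ve)) (adj-P₂ ve)
      ... | yes (inj₂ (inj₁ refl)) = missing ve
        where
        missing : Adj P₂ v y → ⊥
        missing (inj₂ k) = end-last (proj₁ H₂.path) uP₂ k
        missing (inj₁ k) with last-edge
        ... | p , k′ , m with predecessor-unique P₂ uP₂ k k′
        ...   | refl = e≢c (successor-unique (h ∷ M) (proj₂ pM) m (Inner.post-step (inner pM _ v≢h v≢y)))
      ... | no nh = no-lost₂ ve bv (⌊⌋-false (hub₂? e) nh) λ k → cases (Inner.only IM k)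
        where
        IM = inner pM (step-∈ʳ (h ∷ M) i) v≢h v≢y
        cases : e ≡ Inner.pre IM ⊎ e ≡ Inner.post IM → ⊥
        cases (inj₂ q) = e≢c q
        cases (inj₁ q) = nh (inj₁ (trans q (predecessor-unique (h ∷ M) (proj₂ pM) (Inner.pre-step IM) i)))

      -- v would give up an edge of P₂ that Q keeps, and the other end of this edge is then no hub of
      -- H₂, so that the count does not allow its loss.
      real-start : ∀ {v} → (h , v) ∈ steps (h ∷ M) → Spoke₂ v → v ∉ gs → ⊥
      real-start {v} i s@((v∈ , v≢h , v≢y) , _) ng with Inner.post IM Fin.≟ Inner.pre IP
        where
        IM = inner pM (step-∈ʳ (h ∷ M) i) v≢h v≢y
        IP = inner H₂.path v∈ v≢h v≢y
      ... | no ne  = unpaid i s ng (inj₂ (Inner.pre-step (inner H₂.path v∈ v≢h v≢y))) (ne ∘ sym)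
      ... | yes eq = unpaid i s ng (inj₁ (Inner.post-step (inner H₂.path v∈ v≢h v≢y)))
                       (λ e → Inner.pre≢post (inner H₂.path v∈ v≢h v≢y) (sym (trans e eq)))

      -- A fictitious edge ends in `h`, which occurs only at the start of the path, and there
      -- `real-start` excludes it.
      genuine : ∀ {u v} → (u , v) ∈ steps (h ∷ M) → Edge u v
      genuine i with H₂.walk-edge wM i
      ... | inj₁ k = inj₁ (adj-P₂ k)
      ... | inj₂ (inj₁ (s , q)) with hub₂-cases _
      ...   | inj₁ (j , q′) = inj₂ (inj₁ (proj₁ (green-spoke s j) , trans (sym q′) q))
      ...   | inj₂ (_ , q′) with refl ← trans (sym q) q′ = ⊥-elim (head∉ (proj₂ pM) (step-tail M i))
      genuine i | inj₂ (inj₂ (s , q)) with hub₂-cases _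
      ...   | inj₁ (j , q′) = inj₂ (inj₂ (proj₁ (green-spoke s j) , trans (sym q′) q))
      ...   | inj₂ (nj , q′) with refl ← trans (sym q) q′ = ⊥-elim (real-start i s nj)

      next : List V
      next = (as ++ a ∷ []) ++ h ∷ M

      next-walk : Walk graph x y next
      next-walk = walk-prefix (as ++ a ∷ []) (subst (Walk graph x y) assocP (proj₁ path-walk)) (convert wM genuine)
        where
        convert : ∀ {a′ R} → Walk H₂.graph a′ y R → (∀ {u v} → (u , v) ∈ steps R → Edge u v) → Walk graph a′ y R
        convert (single _) k = single _
        convert (step _ w@(single _)) k = step (edge⁻¹ (k (here refl))) (convert w λ ())
        convert (step _ w@(step _ _)) k = step (edge⁻¹ (k (here refl))) (convert w (k ∘ there))

      next-path : IsPath graph x y next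
      next-path = next-walk , Unique.++⁺ (unique-prefix (as ++ a ∷ []) (subst Unique assocP (proj₂ path))) (proj₂ pM)
                                (λ (i , j) → before-P₂ i (M⊆P₂ j))
        where
        unique-prefix : ∀ zs {R : List V} → Unique (zs ++ R) → Unique zs
        unique-prefix [] u = []
        unique-prefix (z ∷ zs) u = ∷-unique (λ i → head∉ u (∈-++⁺ˡ i)) (unique-prefix zs (tail-unique u))

      next-length : length P ≤ length next
      next-length = begin
        length P                              ≡⟨ cong length assocP ⟩
        length ((as ++ a ∷ []) ++ P₂)         ≡⟨ List.length-++ (as ++ a ∷ []) ⟩
        length (as ++ a ∷ []) + length P₂     ≤⟨ +-monoʳ-≤ (length (as ++ a ∷ [])) full ⟩
        length (as ++ a ∷ []) + length (h ∷ M) ≡⟨ sym (List.length-++ (as ++ a ∷ [])) ⟩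
        length next                           ∎
        where open ≤-Reasoning

  -- Recursion on the part `S` of `P` beyond the common prefix. A step along `P` goes forward, as
  -- the prefix is used up; a green step is answered by another path that contains the next vertex
  -- of `P` in its prefix. At the end of `P` nothing is left in which the paths could differ.
  descend : ∀ S as {a T} → P ≡ as ++ a ∷ S → IsPath graph x y (as ++ a ∷ T) → length P ≤ length (as ++ a ∷ T) →
            Neutral (as ++ a ∷ T) → Neutral (a ∷ T) → a ∷ T ≢ a ∷ S → ⊥
  descend S as {a} eP pQ lQ W stop ne = ne (cong (a ∷_) (sym (nothing S (subst (Walk G x y) eP (proj₁ path)) (subst Unique eP (proj₂ path)) a≡y)))
    where
    a≡y : a ≡ y
    a≡y with walk-from as (proj₁ pQ)
    ... | single _ = refl
    nothing : ∀ S → Walk G x y (as ++ a ∷ S) → Unique (as ++ a ∷ S) → a ≡ y → S ≡ []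
    nothing [] w u e = refl
    nothing (s ∷ S) w u refl = ⊥-elim (end-last w u (step-here as S))
  descend S as {a} eP pQ lQ W (along {b = b} {L} h N) ne with onward h
    where
    onward : Adj P a b → Σ (List V) λ S′ → S ≡ b ∷ S′
    onward (inj₁ i) = step-after as (subst Unique eP (proj₂ path)) (subst (λ M → (a , b) ∈ steps M) eP i)
    onward (inj₂ i) = ⊥-elim (unique-disjoint as (proj₂ pQ)
      (step-before as (subst Unique eP (proj₂ path)) (subst (λ M → (b , a) ∈ steps M) eP i)) (there (here refl)))
  ... | S′ , refl = descend S′ (as ++ a ∷ []) (trans eP (sym (assoc S′)))
        (subst (IsPath graph x y) (sym (assoc L)) pQ) (subst (λ M → length P ≤ length M) (sym (assoc L)) lQ)
        (subst Neutral (sym (assoc L)) W) N (λ e → ne (cong (a ∷_) e))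
    where
    assoc : ∀ R → (as ++ a ∷ []) ++ b ∷ R ≡ as ++ a ∷ b ∷ R
    assoc R = List.++-assoc as (a ∷ []) (b ∷ R)
  descend [] as {a} eP pQ lQ W (through (((_ , _ , a≢y) , _) , _) bb g′ N) ne = a≢y (last-is (walk-from as (subst (Walk G x y) eP (proj₁ path))))
    where
    last-is : Walk G a y (a ∷ []) → a ≡ y
    last-is (single _) = refl
  descend (h ∷ S) as {a} eP pQ lQ W (through g bb g′ N) ne = continue (H₂.second (proj₁ start) (proj₂ start))
    where
    open Diverge as eP pQ lQ W g bb g′ N
    continue : (Σ (List V) λ M → M ≢ P₂ × IsPath H₂.graph h y M × (∀ v → v ∈ P₂ → B₂ v ≡ false → v ∈ M)) → ⊥
    continue (M , ne₂ , pM , cov) with walk-cons (proj₁ pM)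
      where
      walk-cons : ∀ {R} → Walk H₂.graph h y R → Σ (List V) λ t → R ≡ h ∷ t
      walk-cons (single _) = [] , refl
      walk-cons (step _ _) = _ , refl
    ... | t , refl = descend S (as ++ a ∷ []) assocP next-path next-length next-neutral
          (neutral-suffix (as ++ a ∷ []) (λ i → inj₁ (subst (λ R → _ ∈ steps R) (sym assocP) (step-++ˡ (as ++ a ∷ []) i))) next-neutral) ne₂
      where
      open Second pM ne₂ cov
      next-neutral : Neutral next
      next-neutral = proj₁ (longest-neutral next-path (≤-trans next-length (m≤m+n _ _)))

  no-spoke : ∀ o → ¬ Spoke o
  no-spoke o s with second o s
  ... | Q , ne , pQ , cov = begin-descent (walk-cons (proj₁ path)) (walk-cons (proj₁ pQ))
    where
    walk-cons : ∀ {Γ : Graph n} {R} → Walk Γ x y R → Σ (List V) λ t → R ≡ x ∷ t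
    walk-cons (single _) = [] , refl
    walk-cons (step _ _) = _ , refl
    neutral : Neutral Q × length P ≤ length Q
    neutral = longest-neutral pQ (subst (_≤ length Q + #new B P Q) (+-identityʳ _) (count pQ cov [] [] λ ()))
    begin-descent : (Σ (List V) λ t → P ≡ x ∷ t) → (Σ (List V) λ t → Q ≡ x ∷ t) → ⊥
    begin-descent (S , eP) (T , eQ) = descend S [] eP (subst (IsPath graph x y) eQ pQ)
      (subst (λ R → length P ≤ length R) eQ (proj₂ neutral)) (subst Neutral eQ (proj₁ neutral)) (subst Neutral eQ (proj₁ neutral))
      (λ e → ne (trans eQ (trans e (sym eP))))

-- Cubic graphs and components off P

module _ {n : ℕ} (G : Graph n) where
  private V = Fin n

  neighbours : V → List V
  neighbours v = filter (λ w → adj G v w Bool.≟ true) (allFin n)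

  degree-length : ∀ v → degree G v ≡ length (neighbours v)
  degree-length v = go (adj G v) (λ i → i) (λ i → refl)
    where
    go : ∀ {m} (f : Fin m → Bool) (g : Fin m → V) → (∀ i → adj G v (g i) ≡ f i) →
         ∣ Vec.tabulate f ∣ ≡ length (filter (λ w → adj G v w Bool.≟ true) (List.tabulate g))
    go {zero} f g h = refl
    go {suc m} f g h with f zero | h zero
    ... | true  | e rewrite e = cong suc (go (f ∘ suc) (g ∘ suc) (h ∘ suc))
    ... | false | e rewrite e = go (f ∘ suc) (g ∘ suc) (h ∘ suc)

  module _ (cubic : Cubic G) where

    fourth-neighbour : ∀ {v a b c d} → adj G v a ≡ true → adj G v b ≡ true → adj G v c ≡ true → adj G v d ≡ true →
                       a ≢ b → a ≢ c → b ≢ c → d ≢ a → d ≢ b → d ≢ c → ⊥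
    fourth-neighbour {v} {a} {b} {c} {d} va vb vc vd ab ac bc da db dc =
      1+n≰n (subst (4 ≤_) (trans (sym (degree-length v)) (cubic v))
        (unique-⊆-length {xs = d ∷ a ∷ b ∷ c ∷ []} (neighbours v)
          ((da ∷ db ∷ dc ∷ []) ∷ (ab ∷ ac ∷ []) ∷ (bc ∷ []) ∷ [] ∷ [])
          λ { (here refl) → nb vd ; (there (here refl)) → nb va ; (there (there (here refl))) → nb vb
            ; (there (there (there (here refl)))) → nb vc }))
      where
      nb : ∀ {w} → adj G v w ≡ true → w ∈ neighbours v
      nb = ∈-filter⁺ (λ w → adj G v w Bool.≟ true) (∈-allFin _)

    other-neighbour : ∀ v a b → Σ V λ c → adj G v c ≡ true × c ≢ a × c ≢ b
    other-neighbour v a b with Fin.any? (λ c → (adj G v c Bool.≟ true) ×-dec ¬? (c Fin.≟ a) ×-dec ¬? (c Fin.≟ b))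
    ... | yes found = found
    ... | no none = ⊥-elim (1+n≰n (subst (_≤ 2) (trans (sym (degree-length v)) (cubic v))
        (unique-⊆-length {xs = neighbours v} (a ∷ b ∷ []) (Unique.filter⁺ (λ w → adj G v w Bool.≟ true) (Unique.allFin⁺ n)) within)))
      where
      within : ∀ {c} → c ∈ neighbours v → c ∈ a ∷ b ∷ []
      within {c} i with c Fin.≟ a | c Fin.≟ b
      ... | yes e | _     = here e
      ... | no _  | yes e = there (here e)
      ... | no p  | no q  = ⊥-elim (none (c , proj₂ (∈-filter⁻ (λ w → adj G v w Bool.≟ true) {xs = allFin n} i) , p , q))

  simplify : ∀ {u v L} → Walk G u v L → Σ (List V) λ L′ → IsPath G u v L′ × (∀ {w} → w ∈ L′ → w ∈ L)
  simplify (single u) = u ∷ [] , (single u , [] ∷ []) , λ i → i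
  simplify (step {x = u} e w) with simplify w
  ... | L , (w′ , un) , sub with u ∈? L
  ...   | no u∉ = u ∷ L , (step e w′ , ∷-unique u∉ un) , λ { (here q) → here q ; (there i) → there (sub i) }
  ...   | yes i with ∈-∃++ i
  ...     | as , bs , refl = u ∷ bs , (walk-from as w′ , drop-unique as un) , λ i → there (sub (∈-++⁺ʳ as i))

  walk-trans : ∀ {a b c L M} → Walk G a b L → Walk G b c M → Σ (List V) λ N → Walk G a c N × (∀ {v} → v ∈ N → v ∈ L ⊎ v ∈ M)
  walk-trans (single _) w = _ , w , inj₂
  walk-trans (step e w) w′ with walk-trans w w′
  ... | N , w″ , o = _ ∷ N , step e w″ , λ { (here q) → inj₁ (here q) ; (there i) → Sum.map₁ there (o i) }

  walk-sym : ∀ {a b L} → Walk G a b L → Σ (List V) λ M → Walk G b a M × (∀ {v} → v ∈ M → v ∈ L)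
  walk-sym (single a) = _ , single a , λ i → i
  walk-sym (step {x = a} {z} e w) with walk-sym w
  ... | M , w′ , s with walk-trans w′ (step (trans (adj-sym G z a) e) (single a))
  ...   | N , w″ , o = N , w″ , λ i → back (o i)
    where
    back : ∀ {v} → v ∈ M ⊎ v ∈ z ∷ a ∷ [] → v ∈ a ∷ _
    back (inj₁ i) = there (s i)
    back (inj₂ (here refl)) = there (walk-first w)
    back (inj₂ (there (here refl))) = here refl

  -- Components of the graph off P

  module Components (P : List V) where

    Joined : V → V → Set
    Joined a b = a ≡ b ⊎ Σ (List V) λ L → Walk G a b L × (∀ {v} → v ∈ L → v ∉ P)

    joined-sym : ∀ {a b} → Joined a b → Joined b a
    joined-sym (inj₁ e) = inj₁ (sym e)
    joined-sym (inj₂ (L , w , o)) with walk-sym w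
    ... | M , w′ , s = inj₂ (M , w′ , o ∘ s)

    joined-trans : ∀ {a b c} → Joined a b → Joined b c → Joined a c
    joined-trans (inj₁ refl) j = j
    joined-trans j (inj₁ refl) = j
    joined-trans (inj₂ (L , w , o)) (inj₂ (M , w′ , o′)) with walk-trans w w′
    ... | N , w″ , s = inj₂ (N , w″ , λ i → Sum.[ o , o′ ] (s i))

    Off : V × V → Set
    Off (u , v) = adj G u v ≡ true × u ∉ P × v ∉ P

    off? : ∀ e → Dec (Off e)
    off? (u , v) = (adj G u v Bool.≟ true) ×-dec ¬? (u ∈? P) ×-dec ¬? (v ∈? P)

    -- Each edge off `P` in turn identifies the labels of its ends, so the final label is a
    -- representative of the component.
    merge : List (V × V) → V → V
    merge []            w = w
    merge ((u , v) ∷ E) w = if ⌊ merge E w Fin.≟ merge E u ⌋ then merge E v else merge E w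

    merge-edge : ∀ E {u v} → (u , v) ∈ E → merge E u ≡ merge E v
    merge-edge ((u , v) ∷ E) (here refl) with merge E u Fin.≟ merge E u | merge E v Fin.≟ merge E u
    ... | yes _ | yes _ = refl
    ... | yes _ | no _  = refl
    ... | no ne | _     = ⊥-elim (ne refl)
    merge-edge ((u , v) ∷ E) {u′} {v′} (there i) rewrite merge-edge E i = refl

    merge-joined : ∀ E → (∀ {e} → e ∈ E → Off e) → ∀ {w w′} → merge E w ≡ merge E w′ → Joined w w′
    merge-joined [] h e = inj₁ e
    merge-joined ((u , v) ∷ E) h {w} {w′} e with merge E w Fin.≟ merge E u | merge E w′ Fin.≟ merge E u
    ... | yes p | yes q = rec (trans p (sym q))
      where rec = merge-joined E (h ∘ there)
    ... | no _  | no _  = merge-joined E (h ∘ there) e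
    ... | yes p | no _  = joined-trans (merge-joined E (h ∘ there) p) (joined-trans (uv (h (here refl))) (merge-joined E (h ∘ there) e))
      where
      uv : Off (u , v) → Joined u v
      uv (a , u∉ , v∉) = inj₂ (u ∷ v ∷ [] , step a (single v) , λ { (here refl) → u∉ ; (there (here refl)) → v∉ })
    ... | no _  | yes q = joined-sym (joined-trans (merge-joined E (h ∘ there) q) (joined-trans (uv (h (here refl))) (merge-joined E (h ∘ there) (sym e))))
      where
      uv : Off (u , v) → Joined u v
      uv (a , u∉ , v∉) = inj₂ (u ∷ v ∷ [] , step a (single v) , λ { (here refl) → u∉ ; (there (here refl)) → v∉ })

    offEdges : List (V × V)
    offEdges = filter off? (cartesianProduct (allFin n) (allFin n))

    abstract
      lab : V → V
      lab = merge offEdges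

      lab-edge : ∀ {u v} → adj G u v ≡ true → u ∉ P → v ∉ P → lab u ≡ lab v
      lab-edge a u∉ v∉ = merge-edge offEdges (∈-filter⁺ off? (∈-cartesianProduct⁺ (∈-allFin _) (∈-allFin _)) (a , u∉ , v∉))

      lab-joined : ∀ {u v} → lab u ≡ lab v → Joined u v
      lab-joined = merge-joined offEdges (λ i → proj₂ (∈-filter⁻ off? {xs = cartesianProduct (allFin n) (allFin n)} i))

    lab-walk : ∀ {a b L} → Walk G a b L → (∀ {v} → v ∈ L → v ∉ P) → ∀ {v} → v ∈ L → lab v ≡ lab a
    lab-walk (single _) o (here refl) = refl
    lab-walk (step e w) o (here refl) = refl
    lab-walk (step e w) o (there i) = trans (lab-walk w (o ∘ there) i)
      (sym (lab-edge e (o (here refl)) (o (there (walk-first w)))))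

    Attached : V → V → Set
    Attached v k = adj G v k ≡ true × k ∉ P

    -- A path from `k` to `k′` inside the component serves as the inner part; it has two vertices as
    -- soon as `k` and `k′` differ.
    bridge : ∀ {v w k k′} → Attached v k → Attached w k′ → lab k ≡ lab k′ → ∀ d → (d ≡ 1 ⊎ (d ≡ 2 × k ≢ k′)) →
             Detour {G = G} P lab v w (lab k) d
    bridge {v} {w} {k} {k′} (vk , k∉) (wk′ , k′∉) e d hd = build (lab-joined e)
      where
      make : ∀ {L} → IsPath G k k′ L → (∀ {u} → u ∈ L → u ∉ P) → Detour {G = G} P lab v w (lab k) d
      make {L} (wL , uL) o = detour L (outer wL) uL (λ i → o i , lab-walk wL o i) (big wL hd)
        where
        outer : ∀ {L} → Walk G k k′ L → Walk G v w (v ∷ L ++ w ∷ [])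
        outer wL = step vk (append wL)
          where
          append : ∀ {k L} → Walk G k k′ L → Walk G k w (L ++ w ∷ [])
          append (single _) = step (trans (adj-sym G k′ w) wk′) (single w)
          append (step e w) = step e (append w)
        big : ∀ {L} → Walk G k k′ L → (d ≡ 1 ⊎ (d ≡ 2 × k ≢ k′)) → d ≤ length L
        big (single _) (inj₁ refl) = ≤-refl
        big (step _ _) (inj₁ refl) = s≤s z≤n
        big (single _) (inj₂ (_ , ne)) = ⊥-elim (ne refl)
        big (step _ (single _)) (inj₂ (refl , _)) = ≤-refl
        big (step _ (step _ _)) (inj₂ (refl , _)) = s≤s (s≤s z≤n)
      build : Joined k k′ → Detour {G = G} P lab v w (lab k) d
      build (inj₁ refl) = make (single k , [] ∷ []) λ { (here refl) → k∉ }
      build (inj₂ (L , wL , o)) with simplify wL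
      ... | L′ , p , sub = make p (o ∘ sub)

    -- Up to its first vertex on `P` the walk stays in one component.
    exit : ∀ {k z L} → Walk G k z L → k ∉ P → z ∈ P →
           Σ V λ j → Σ V λ s → Attached s j × s ∈ P × s ∈ L × j ∈ L × lab j ≡ lab k
    exit (single _) k∉ z∈ = ⊥-elim (k∉ z∈)
    exit {k} (step {z = t} e w) k∉ z∈ with t ∈? P
    ... | yes t∈ = k , t , (trans (adj-sym G t k) e , k∉) , t∈ , there (walk-first w) , here refl , refl
    ... | no t∉ with exit w t∉ z∈
    ...   | j , s , at , s∈ , i , i′ , q = j , s , at , s∈ , there i , there i′ , trans q (sym (lab-edge e k∉ t∉))

    lengthen : ∀ {x y a b k} → IsPath G x y P → (a , b) ∈ steps P → Detour {G = G} P lab a b k 1 →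
               Σ (List V) λ R → IsPath G x y R × length P < length R
    lengthen {x} {y} {a} {b} (w , u) i (detour I wI uI off l) with step-split P i
    ... | as , bs , e = as ++ a ∷ I ++ b ∷ bs , (walk-prefix as (subst (Walk G x y) e w) (walk-append I wI (walk-from (as ++ a ∷ []) (subst (Walk G x y) assoc w))) , distinct) , longer
      where
      assoc : P ≡ (as ++ a ∷ []) ++ b ∷ bs
      assoc = trans e (sym (List.++-assoc as (a ∷ []) (b ∷ bs)))
      perm = ↭.shifts (as ++ a ∷ []) I {b ∷ bs}
      assoc′ : as ++ a ∷ I ++ b ∷ bs ≡ (as ++ a ∷ []) ++ I ++ b ∷ bs
      assoc′ = sym (List.++-assoc as (a ∷ []) (I ++ b ∷ bs))
      distinct : Unique (as ++ a ∷ I ++ b ∷ bs)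
      distinct = subst Unique (sym assoc′) (unique-↭ (↭-sym′ perm) (Unique.++⁺ uI (subst Unique assoc u)
        (λ (j , j′) → proj₁ (off j) (subst (_ ∈_) (sym assoc) j′))))
        where open import Data.List.Relation.Binary.Permutation.Propositional using () renaming (↭-sym to ↭-sym′)
      longer : length P < length (as ++ a ∷ I ++ b ∷ bs)
      longer = begin
        suc (length P)                                     ≤⟨ +-monoˡ-≤ (length P) l ⟩
        length I + length P                                ≡⟨ cong (λ t → length I + length t) assoc ⟩
        length I + length ((as ++ a ∷ []) ++ b ∷ bs)       ≡⟨ sym (List.length-++ I) ⟩
        length (I ++ (as ++ a ∷ []) ++ b ∷ bs)             ≡⟨ sym (↭.↭-length perm) ⟩
        length ((as ++ a ∷ []) ++ I ++ b ∷ bs)             ≡⟨ cong length (sym assoc′) ⟩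
        length (as ++ a ∷ I ++ b ∷ bs)                     ∎
        where open ≤-Reasoning

-- Choosing the hubs

length-filter : ∀ {n} {Q : Fin n → Set} (Q? : ∀ v → Dec (Q v)) L → length (filter Q? L) ≡ #true (λ v → ⌊ Q? v ⌋) L
length-filter Q? [] = refl
length-filter Q? (v ∷ L) with Q? v
... | yes _ = cong suc (length-filter Q? L)
... | no _  = length-filter Q? L

step-init : ∀ {A : Set} (L : List A) {u v z} → v ≢ z → (u , v) ∈ steps (L ++ z ∷ []) → (u , v) ∈ steps L
step-init (a ∷ [])     ne (here refl) = ⊥-elim (ne refl)
step-init (a ∷ b ∷ L)  ne (here e)    = here e
step-init (a ∷ b ∷ L)  ne (there i)   = there (step-init (b ∷ L) ne i)

step-rest : ∀ {A : Set} {L : List A} {a u v} → u ≢ a → (u , v) ∈ steps (a ∷ L) → (u , v) ∈ steps L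
step-rest {L = _ ∷ _} ne (here refl) = ⊥-elim (ne refl)
step-rest {L = _ ∷ _} ne (there i)   = i

headOr : ∀ {A : Set} → A → List A → A
headOr a []      = a
headOr a (b ∷ _) = b

headOr-∈ : ∀ {A : Set} {a w : A} {L} → w ∈ L → headOr a L ∈ L
headOr-∈ {L = _ ∷ _} _ = here refl

module Unbound {n : ℕ} (G : Graph n) (two-connected : TwoConnected G) (cubic : Cubic G) {x y : Fin n} (x≢y : x ≢ y)
  {P : List (Fin n)} (path : IsPath G x y P) (longest : ∀ R → IsPath G x y R → length R ≤ length P)
  (unbound : ∀ v → v ∈ P → v ≢ x → v ≢ y → Σ (Fin n) λ k → adj G v k ≡ true × k ∉ P) where

  private V = Fin n
  open Components G P

  Int : V → Set
  Int = Inside x y P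

  x∈P = walk-first (proj₁ path)
  y∈P = walk-last (proj₁ path)

  out? : ∀ v → Dec (Σ V λ k → Attached v k)
  out? v = Fin.any? λ k → (adj G v k Bool.≟ true) ×-dec ¬? (k ∈? P)

  abstract
    out : V → V
    out v with out? v
    ... | yes (k , _) = k
    ... | no _        = v

    out-attached : ∀ {v} → Int v → Attached v (out v)
    out-attached {v} (i , p , q) with out? v
    ... | yes (_ , a) = a
    ... | no none     = ⊥-elim (none (unbound v i p q))

  -- The two neighbours along `P` and `out v` exhaust the degree three.
  out-unique : ∀ {v k} → Int v → Attached v k → k ≡ out v
  out-unique {v} {k} iv@(i , p , q) (a , k∉) = decidable-stable (k Fin.≟ out v) λ ne →
    fourth-neighbour G cubic (trans (adj-sym G v pre) (walk-adj (proj₁ path) pre-step)) (walk-adj (proj₁ path) post-step)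
      (proj₁ (out-attached iv)) a pre≢post
      (λ e → proj₂ (out-attached iv) (subst (_∈ P) e (step-∈ˡ P pre-step)))
      (λ e → proj₂ (out-attached iv) (subst (_∈ P) e (step-∈ʳ P post-step)))
      (λ e → k∉ (subst (_∈ P) (sym e) (step-∈ˡ P pre-step))) (λ e → k∉ (subst (_∈ P) (sym e) (step-∈ʳ P post-step))) ne
    where open Inner (inner path i p q)

  κ : V → V
  κ v = lab (out v)

  -- A detour between consecutive vertices could be inserted into the longest path `P`.
  apart : ∀ {a b j k} → Attached a j → Attached b k → lab j ≡ lab k → ¬ Adj P a b
  apart aj bk e (inj₁ i) with lengthen path i (bridge aj bk e 1 (inj₁ refl))
  ... | R , p , lt = <-irrefl refl (≤-trans lt (longest R p))
  apart aj bk e (inj₂ i) with lengthen path i (bridge bk aj (sym e) 1 (inj₁ refl))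
  ... | R , p , lt = <-irrefl refl (≤-trans lt (longest R p))

  -- As `v` is no cut vertex, some path from `out v` to `x` avoids it and leaves the component
  -- elsewhere.
  another-attachment : ∀ {v} → Int v → Σ V λ s → Σ V λ j → s ≢ v × s ∈ P × Attached s j × lab j ≡ κ v
  another-attachment {v} iv@(i , v≢x , _) with proj₂ (proj₂ two-connected) v (out v) x
      (λ e → proj₂ (out-attached iv) (subst (_∈ P) (sym e) i)) (v≢x ∘ sym)
  ... | L , (w , _) , v∉ with exit w (proj₂ (out-attached iv)) x∈P
  ...   | j , s , at , s∈ , k , _ , q = s , j , (λ { refl → v∉ k }) , s∈ , at , q

  -- A common neighbour `out v` would have a third neighbour `t`, which is off `P` because only `v`
  -- and `w` are attached to the component. As `v` and `w` have no other neighbour off `P`, it would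
  -- separate `t` from `x`.
  pair-long : ∀ {v w} → Int v → Int w → (∀ {s j} → s ∈ P → Attached s j → lab j ≡ κ v → s ≡ v ⊎ s ≡ w) → out v ≢ out w
  pair-long {v} {w} iv iw only e with other-neighbour G cubic (out v) v w
  ... | t , a , t≢v , t≢w with t ∈? P
  ...   | yes t∈ = Sum.[ t≢v , t≢w ] (only t∈ (trans (adj-sym G t (out v)) a , proj₂ (out-attached iv)) refl)
  ...   | no t∉ with proj₂ (proj₂ two-connected) (out v) t x
            (λ { refl → contradiction (trans (sym a) (adj-irrefl G _)) λ () }) (λ e → proj₂ (out-attached iv) (subst (_∈ P) e x∈P))
  ...     | L , (wL , _) , k∉ with exit wL t∉ x∈P
  ...       | j , s , at , s∈ , _ , i , q with only s∈ at (trans q (sym (lab-edge a (proj₂ (out-attached iv)) t∉)))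
  ...         | inj₁ refl = k∉ (subst (_∈ L) (out-unique iv at) i)
  ...         | inj₂ refl = k∉ (subst (_∈ L) (trans (out-unique iw at) (sym e)) i)

  interior : Σ (List V) λ L → P ≡ x ∷ L ++ y ∷ []
  interior with proj₁ path
  ... | single _ = ⊥-elim (x≢y refl)
  ... | step _ w with final w
    where
    final : ∀ {z L} → Walk G z y L → Σ (List V) λ M → L ≡ M ++ y ∷ []
    final (single _) = [] , refl
    final (step {x = u} _ w) with final w
    ... | M , refl = u ∷ M , refl
  ...   | M , refl = M , refl

  ints : List V
  ints = proj₁ interior
  P≡ : P ≡ x ∷ ints ++ y ∷ []
  P≡ = proj₂ interior

  uP : Unique (x ∷ ints ++ y ∷ [])
  uP = subst Unique P≡ (proj₂ path)

  ints-int : ∀ {v} → v ∈ ints → Int v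
  ints-int i = subst (_ ∈_) (sym P≡) (there (∈-++⁺ˡ i)) , (λ { refl → head∉ uP (∈-++⁺ˡ i) }) ,
               λ { refl → unique-disjoint ints (tail-unique uP) i (here refl) }

  int-ints : ∀ {v} → Int v → v ∈ ints
  int-ints (i , p , q) with subst (_ ∈_) P≡ i
  ... | here e = ⊥-elim (p e)
  ... | there j with ∈-++⁻ ints j
  ...   | inj₁ k        = k
  ...   | inj₂ (here e) = ⊥-elim (q e)

  ints-unique : Unique ints
  ints-unique = prefix ints (tail-unique uP)
    where
    prefix : ∀ zs {R : List V} → Unique (zs ++ R) → Unique zs
    prefix [] u = []
    prefix (z ∷ zs) u = ∷-unique (λ i → head∉ u (∈-++⁺ˡ i)) (prefix zs (tail-unique u))

  Meets : V → V → Set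
  Meets z k = Σ V λ j → Attached z j × lab j ≡ k

  meets? : ∀ z k → Dec (Meets z k)
  meets? z k = Fin.any? λ j → ((adj G z j Bool.≟ true) ×-dec ¬? (j ∈? P)) ×-dec (lab j Fin.≟ k)

  members : V → List V
  members k = filter (λ v → κ v Fin.≟ k) ints

  ∈-members : ∀ {v} → Int v → v ∈ members (κ v)
  ∈-members {v} i = ∈-filter⁺ (λ w → κ w Fin.≟ κ v) (int-ints i) refl

  members-∈ : ∀ {v} k → v ∈ members k → Int v × κ v ≡ k
  members-∈ k i with ∈-filter⁻ (λ v → κ v Fin.≟ k) {xs = ints} i
  ... | j , e = ints-int j , e

  members-unique : ∀ k → Unique (members k)
  members-unique k = Unique.filter⁺ (λ v → κ v Fin.≟ k) ints-unique

  attached-member : ∀ {s j k} → s ∈ P → Attached s j → lab j ≡ k → ¬ Meets x k → ¬ Meets y k → s ∈ members k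
  attached-member {s} {j} i at refl nx ny = subst (λ k → s ∈ members k) (cong lab (sym (out-unique is at))) (∈-members is)
    where
    is : Int s
    is = i , (λ { refl → nx (j , at , refl) }) , λ { refl → ny (j , at , refl) }

  Big : V → Set
  Big k = ¬ Meets x k × ¬ Meets y k × 3 ≤ length (members k)

  big? : ∀ k → Dec (Big k)
  big? k = ¬? (meets? x k) ×-dec ¬? (meets? y k) ×-dec (3 ≤? length (members k))

  Extremal : V → Set
  Extremal v = (x , v) ∈ steps P ⊎ (v , y) ∈ steps P

  extremal? : ∀ v → Dec (Extremal v)
  extremal? v = ((x , v) ∈ₛ? steps P) ⊎-dec ((v , y) ∈ₛ? steps P)

  -- Colour 0 is never selected; it keeps the hubs away from the two vertices next to x and y.
  colour : V → Fin (suc n)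
  colour v = if ⌊ extremal? v ⌋ then zero else suc (κ v)

  colour-suc : ∀ {v k} → colour v ≡ suc k → ¬ Extremal v × κ v ≡ k
  colour-suc {v} e with extremal? v
  colour-suc refl | no ne = ne , refl

  bigs : Vec Bool (suc n)
  bigs = false ∷ Vec.tabulate (λ k → ⌊ big? k ⌋)

  bigs-big : ∀ k → lookup bigs (suc k) ≡ true → Big k
  bigs-big k e = true-⌊⌋ (big? k) (trans (sym (Vec.lookup∘tabulate _ k)) e)

  big-bigs : ∀ k → Big k → lookup bigs (suc k) ≡ true
  big-bigs k b = trans (Vec.lookup∘tabulate _ k) (⌊⌋-true (big? k) b)

  -- `k` + 1 big classes have at least 3`k` + 3 members, and only the successor of `x` and the
  -- predecessor of `y` lose their colour, which leaves at least 3`k` + 1.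
  enough : ∀ J → (∀ j → lookup J j ⊑ lookup bigs j) → ∀ k → # J ≡ suc k → 3 * k < #true (lookup J ∘ colour) ints
  enough (true ∷ J)  le k e with () ← le zero refl
  enough (false ∷ J) le k e = +-cancelʳ-≤ 2 _ _ (begin
    suc (3 * k) + 2                                    ≡⟨ cong suc (+-comm (3 * k) 2) ⟩
    3 + 3 * k                                          ≡⟨ sym (*-suc 3 k) ⟩
    3 * suc k                                          ≡⟨ *-comm 3 (suc k) ⟩
    suc k * 3                                          ≡⟨ cong (_* 3) (sym e) ⟩
    (# J) * 3                                          ≤⟨ count-colours J has 3 ints (λ v i j p q → trans (sym (true-⌊⌋ (κ v Fin.≟ i) p)) (true-⌊⌋ (κ v Fin.≟ j) q)) three ⟩
    #true (anyColour J has) ints                         ≤⟨ #true-≤ ints (λ v _ → covered v) ⟩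
    #true (λ v → lookup (false ∷ J) (colour v) ∨ (first v ∨ last v)) ints
                                                       ≤⟨ #true-∨-≤ (lookup (false ∷ J) ∘ colour) _ ints ⟩
    T + #true (λ v → first v ∨ last v) ints            ≤⟨ +-monoʳ-≤ T (≤-trans (#true-∨-≤ first last ints) (+-mono-≤ one-first one-last)) ⟩
    T + 2                                              ∎)
    where
    open ≤-Reasoning
    T = #true (lookup (false ∷ J) ∘ colour) ints
    has : Fin n → V → Bool
    has j v = ⌊ κ v Fin.≟ j ⌋
    first last : V → Bool
    first v = ⌊ (x , v) ∈ₛ? steps P ⌋
    last v = ⌊ (v , y) ∈ₛ? steps P ⌋
    three : ∀ j → lookup J j ≡ true → 3 ≤ #true (has j) ints
    three j e = subst (3 ≤_) (length-filter (λ v → κ v Fin.≟ j) ints) (proj₂ (proj₂ (bigs-big j (le (suc j) e))))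
    one-first : #true first ints ≤ 1
    one-first = #true-subsingleton first ints ints-unique λ u v _ _ p q →
      successor-unique P (proj₂ path) (true-⌊⌋ ((x , u) ∈ₛ? steps P) p) (true-⌊⌋ ((x , v) ∈ₛ? steps P) q)
    one-last : #true last ints ≤ 1
    one-last = #true-subsingleton last ints ints-unique λ u v _ _ p q →
      predecessor-unique P (proj₂ path) (true-⌊⌋ ((u , y) ∈ₛ? steps P) p) (true-⌊⌋ ((v , y) ∈ₛ? steps P) q)
    covered : ∀ v → anyColour J has v ≡ true → lookup (false ∷ J) (colour v) ∨ (first v ∨ last v) ≡ true
    covered v e with anyColour-elim J has v e
    ... | j , p , q with refl ← true-⌊⌋ (κ v Fin.≟ j) q with (x , v) ∈ₛ? steps P | (v , y) ∈ₛ? steps P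
    ...   | yes _ | _     = refl
    ...   | no _  | yes _ = refl
    ...   | no _  | no _  = trans (Bool.∨-identityʳ _) p

  abstract
    selection : Σ (List V) λ sel → (∀ {v} → v ∈ sel → v ∈ ints × lookup bigs (colour v) ≡ true) ×
      (∀ {u v} → (u , v) ∈ steps ints → u ∈ sel → v ∈ sel → ⊥) ×
      (∀ j → lookup bigs j ≡ true → Σ V λ v → v ∈ sel × colour v ≡ j)
    selection = independent-transversal colour bigs ints ints-unique enough

  sel : List V
  sel = proj₁ selection

  sel-spec : ∀ {v} → v ∈ sel → Int v × ¬ Extremal v × Big (κ v)
  sel-spec {v} i with proj₁ (proj₂ selection) i
  ... | j , e = ints-int j , spec (colour v) refl e
    where
    spec : ∀ k → colour v ≡ k → lookup bigs k ≡ true → ¬ Extremal v × Big (κ v)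
    spec (suc k) q e with colour-suc {v} q
    ... | ne , refl = ne , bigs-big k e

  abstract
    pick : V → V
    -- By `pick-spec` the default `x` is not taken when the class is big.
    pick k = headOr x (filter (λ v → κ v Fin.≟ k) sel)

    pick-spec : ∀ {k} → Big k → pick k ∈ sel × κ (pick k) ≡ k
    pick-spec {k} b = let (w , i , e) = proj₂ (proj₂ (proj₂ selection)) (suc k) (big-bigs k b) in
      ∈-filter⁻ (λ v → κ v Fin.≟ k) {xs = sel}
        (headOr-∈ (∈-filter⁺ (λ v → κ v Fin.≟ k) i (proj₂ (colour-suc {w} e))))

  Hub : V → Set
  Hub v = v ≡ x ⊎ v ≡ y ⊎ v ∈ sel

  isHub? : ∀ v → Dec (Hub v)
  isHub? v = (v Fin.≟ x) ⊎-dec (v Fin.≟ y) ⊎-dec (v ∈? sel)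

  abstract
    isHub : V → Bool
    isHub v = ⌊ isHub? v ⌋

    hub-true : ∀ {v} → Hub v → isHub v ≡ true
    hub-true {v} = ⌊⌋-true (isHub? v)

    true-hub : ∀ {v} → isHub v ≡ true → Hub v
    true-hub {v} = true-⌊⌋ (isHub? v)

    hub-false : ∀ {v} → ¬ Hub v → isHub v ≡ false
    hub-false {v} = ⌊⌋-false (isHub? v)

    false-hub : ∀ {v} → isHub v ≡ false → ¬ Hub v
    false-hub e h = contradiction (trans (sym e) (hub-true h)) λ ()

  -- `x` takes precedence over `y`, so that all members of a class attached to both get the same
  -- hub.
  data Kind (k v h : V) : Set where
    at-x : Meets x k → h ≡ x → Kind k v h
    at-y : ¬ Meets x k → Meets y k → h ≡ y → Kind k v h
    pair : ∀ {a b} → ¬ Meets x k → ¬ Meets y k → members k ≡ a ∷ b ∷ [] → (v ≡ a × h ≡ b) ⊎ (v ≡ b × h ≡ a) → Kind k v h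
    big  : Big k → h ≡ pick k → Kind k v h

  assign : ∀ v → Σ V λ h → Int v → Kind (κ v) v h
  assign v = choose (meets? x cls) (meets? y cls)
    where
    cls = κ v
    two : ∀ {u w : V} {a} → u ≢ w → u ∈ a ∷ [] → w ∈ a ∷ [] → ⊥
    two ne (here refl) (here refl) = ne refl
    in-pair : ∀ {a b} → ¬ Meets x cls → ¬ Meets y cls → members cls ≡ a ∷ b ∷ [] → Dec (v ≡ a) → Σ V λ h → Int v → Kind cls v h
    in-pair {a} {b} nx ny e (yes q) = b , λ _ → pair nx ny e (inj₁ (q , refl))
    in-pair {a} {b} nx ny e (no ne) = a , λ iv → pair nx ny e (inj₂ (second-one (subst (v ∈_) e (∈-members iv)) , refl))
      where
      second-one : v ∈ a ∷ b ∷ [] → v ≡ b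
      second-one (here q)         = ⊥-elim (ne q)
      second-one (there (here q)) = q
    by-size : ∀ M → members cls ≡ M → ¬ Meets x cls → ¬ Meets y cls → Σ V λ h → Int v → Kind cls v h
    -- A class contains `v` and, away from `x` and `y`, a second attachment. So the sizes 0 and 1 do
    -- not occur and `x` is a dummy value.
    by-size []              e nx ny = x , λ iv → contradiction (subst (v ∈_) e (∈-members iv)) λ ()
    by-size (a ∷ [])        e nx ny = x , λ iv → let (s , j , ne , i , at , q) = another-attachment iv in
      ⊥-elim (two ne (subst (s ∈_) e (attached-member i at q nx ny)) (subst (v ∈_) e (∈-members iv)))
    by-size (a ∷ b ∷ [])    e nx ny = in-pair nx ny e (v Fin.≟ a)
    by-size (a ∷ b ∷ c ∷ M) e nx ny =
      pick cls , λ _ → big (nx , ny , subst (λ M → 3 ≤ length M) (sym e) (s≤s (s≤s (s≤s z≤n)))) refl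
    choose : Dec (Meets x cls) → Dec (Meets y cls) → Σ V λ h → Int v → Kind cls v h
    choose (yes mx) _        = x , λ _ → at-x mx refl
    choose (no nx)  (yes my) = y , λ _ → at-y nx my refl
    choose (no nx)  (no ny)  = by-size (members cls) refl nx ny

  abstract
    hub : V → V
    hub v = proj₁ (assign v)

    kind : ∀ {v} → Int v → Kind (κ v) v (hub v)
    kind {v} = proj₂ (assign v)

  not-big-pair : ∀ {k a b} → Big k → members k ≡ a ∷ b ∷ [] → ⊥
  not-big-pair (_ , _ , l) e with subst (λ M → 3 ≤ length M) e l
  ... | s≤s (s≤s ())

  pair-other : ∀ {k v h a b} → members k ≡ a ∷ b ∷ [] → (v ≡ a × h ≡ b) ⊎ (v ≡ b × h ≡ a) → h ≢ v × h ∈ members k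
  pair-other {k} e c = ne c , subst (_ ∈_) (sym e) (mem c)
    where
    a≢b : ∀ {a b} → members k ≡ a ∷ b ∷ [] → a ≢ b
    a≢b e refl = head∉ (subst Unique e (members-unique k)) (here refl)
    ne : ∀ {v h} → (v ≡ _ × h ≡ _) ⊎ (v ≡ _ × h ≡ _) → h ≢ v
    ne (inj₁ (refl , refl)) q = a≢b e (sym q)
    ne (inj₂ (refl , refl)) q = a≢b e q
    mem : ∀ {v h a b} → (v ≡ a × h ≡ b) ⊎ (v ≡ b × h ≡ a) → h ∈ a ∷ b ∷ []
    mem (inj₁ (refl , refl)) = there (here refl)
    mem (inj₂ (refl , refl)) = here refl

  hub-attached : ∀ {v} → Int v → Σ V λ j → hub v ∈ P × Attached (hub v) j × lab j ≡ κ v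
  hub-attached {v} iv with kind iv
  ... | at-x (j , at , q) e   = j , subst (_∈ P) (sym e) x∈P , subst (λ h → Attached h j) (sym e) at , q
  ... | at-y _ (j , at , q) e = j , subst (_∈ P) (sym e) y∈P , subst (λ h → Attached h j) (sym e) at , q
  ... | pair _ _ e c with members-∈ (κ v) (proj₂ (pair-other e c))
  ...   | ih , q = out (hub v) , proj₁ ih , out-attached ih , q
  hub-attached {v} iv | big b e with pick-spec b
  ...   | i , q with sel-spec (subst (_∈ sel) (sym e) i)
  ...     | ih , _ = out (hub v) , proj₁ ih , out-attached ih , trans (cong κ e) q

  not-both : ∀ {v h k} → members k ≡ v ∷ h ∷ [] ⊎ members k ≡ h ∷ v ∷ [] → κ h ≡ k → Int h → ¬ Meets x k → ¬ Meets y k → hub h ≡ v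
  not-both {v} {h} {k} e refl ih nx ny with kind ih
  ... | at-x mx _   = ⊥-elim (nx mx)
  ... | at-y _ my _ = ⊥-elim (ny my)
  ... | big b _     = ⊥-elim (Sum.[ not-big-pair b , not-big-pair b ] e)
  ... | pair {a} {b} _ _ e′ c = same (Sum.map (trans (sym e′)) (trans (sym e′)) e) c
    where
    ne : v ≢ h
    ne refl = Sum.[ (λ e → head∉ (subst Unique e (members-unique _)) (here refl)) , (λ e → head∉ (subst Unique e (members-unique _)) (here refl)) ] e
    same : ∀ {u a b} → a ∷ b ∷ [] ≡ v ∷ h ∷ [] ⊎ a ∷ b ∷ [] ≡ h ∷ v ∷ [] → (h ≡ a × u ≡ b) ⊎ (h ≡ b × u ≡ a) → u ≡ v
    same (inj₁ refl) (inj₁ (p , _)) = ⊥-elim (ne (sym p))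
    same (inj₁ refl) (inj₂ (_ , r)) = r
    same (inj₂ refl) (inj₁ (_ , r)) = r
    same (inj₂ refl) (inj₂ (p , _)) = ⊥-elim (ne (sym p))

  members-plain : ∀ {k v a b} → members k ≡ a ∷ b ∷ [] → v ∈ members k → isHub v ≡ false
  members-plain {k} {v} e i = hub-false λ
    { (inj₁ q) → proj₁ (proj₂ (proj₁ (members-∈ k i))) q
    ; (inj₂ (inj₁ q)) → proj₂ (proj₂ (proj₁ (members-∈ k i))) q
    ; (inj₂ (inj₂ s)) → not-big-pair (subst Big (proj₂ (members-∈ k i)) (proj₂ (proj₂ (sel-spec s)))) e }

  module _ (nonempty : Σ V λ o → o ∈ ints) where

    x-y-apart : (x , y) ∉ steps P
    x-y-apart i = go ints P≡ nonempty
      where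
      go : ∀ L → P ≡ x ∷ L ++ y ∷ [] → (Σ V λ o → o ∈ L) → ⊥
      go (a ∷ M) e _ with step-after [] (subst Unique e (proj₂ path)) (subst (λ L → (x , y) ∈ steps L) e i)
      ... | M′ , q with refl ← List.∷-injectiveˡ q = head∉ (tail-unique (subst Unique e (proj₂ path))) (∈-++⁺ʳ M (here refl))

    -- Selected hubs are not extremal and not consecutive among themselves, and an inner vertex
    -- separates `x` from `y`.
    hubs-sparse : ∀ {u v} → (u , v) ∈ steps P → Hub u → Hub v → ⊥
    hubs-sparse i (inj₁ refl) (inj₁ refl) = step-antisym P (proj₂ path) i i
    hubs-sparse i (inj₁ refl) (inj₂ (inj₁ refl)) = x-y-apart i
    hubs-sparse i (inj₁ refl) (inj₂ (inj₂ s)) = proj₁ (proj₂ (sel-spec s)) (inj₁ i)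
    hubs-sparse i (inj₂ (inj₁ refl)) h = end-last (proj₁ path) (proj₂ path) i
    hubs-sparse i (inj₂ (inj₂ s)) (inj₁ refl) = head∉ uP (step-tail _ (subst (λ L → (_ , x) ∈ steps L) P≡ i))
    hubs-sparse i (inj₂ (inj₂ s)) (inj₂ (inj₁ refl)) = proj₁ (proj₂ (sel-spec s)) (inj₂ i)
    hubs-sparse {u} {v} i (inj₂ (inj₂ s)) (inj₂ (inj₂ t)) =
      proj₁ (proj₂ (proj₂ selection))
        (step-init ints (proj₂ (proj₂ (proj₁ (sel-spec t)))) (step-rest (proj₁ (proj₂ (proj₁ (sel-spec s)))) (subst (λ L → (u , v) ∈ steps L) P≡ i))) s t

    H : Hubs G x y P
    H = record
      { path = path ; x≢y = x≢y ; B = isHub ; B-x = hub-true (inj₁ refl) ; B-y = hub-true (inj₂ (inj₁ refl))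
      ; B-sparse = λ i p q → hubs-sparse i (true-hub p) (true-hub q)
      ; hub = hub
      ; hub-∈ = λ (iv , _) → proj₁ (proj₂ (hub-attached iv))
      ; hub-≢ = λ (iv , bv) → ne iv bv
      ; hub-far = λ (iv , _) → let (j , _ , at , q) = hub-attached iv in apart (out-attached iv) at (sym q)
      ; hub-kind = λ (iv , _) → hk iv }
      where
      ne : ∀ {v} → Int v → isHub v ≡ false → hub v ≢ v
      ne iv bv q with kind iv
      ... | at-x _ e     = proj₁ (proj₂ iv) (trans (sym q) e)
      ... | at-y _ _ e   = proj₂ (proj₂ iv) (trans (sym q) e)
      ... | pair _ _ e c = proj₁ (pair-other e c) q
      ... | big b e      = false-hub bv (inj₂ (inj₂ (subst (_∈ sel) (trans (sym e) q) (proj₁ (pick-spec b)))))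
      hk : ∀ {v} → Int v → isHub (hub v) ≡ true ⊎ ((Int (hub v) × isHub (hub v) ≡ false) × hub (hub v) ≡ v)
      hk {v} iv with kind iv
      ... | at-x _ e   = inj₁ (hub-true (inj₁ e))
      ... | at-y _ _ e = inj₁ (hub-true (inj₂ (inj₁ e)))
      ... | big b e    = inj₁ (hub-true (inj₂ (inj₂ (subst (_∈ sel) (sym e) (proj₁ (pick-spec b))))))
      ... | pair nx ny e c = inj₂ ((ih , members-plain e (proj₂ (pair-other e c))) ,
                                   not-both (both-orders e c) q ih nx ny)
        where
        ih = proj₁ (members-∈ (κ v) (proj₂ (pair-other e c)))
        q  = proj₂ (members-∈ (κ v) (proj₂ (pair-other e c)))
        both-orders : ∀ {v h a b k} → members k ≡ a ∷ b ∷ [] → (v ≡ a × h ≡ b) ⊎ (v ≡ b × h ≡ a) → members k ≡ v ∷ h ∷ [] ⊎ members k ≡ h ∷ v ∷ []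
        both-orders e (inj₁ (refl , refl)) = inj₁ e
        both-orders e (inj₂ (refl , refl)) = inj₂ e

    open Hubs H using (Spoke)

    routes : Routing.Routes H lab κ
    routes = record { to-hub = λ (iv , _) → to-hub iv ; to-hub-long = λ (iv , _) e → to-hub-long iv e
                    ; across = λ (iu , _) (iv , bv) → across iu iv ; same-class = λ (iu , _) (iv , _) → same-class iu iv }
      where
      to-hub : ∀ {v} → Int v → Detour {G = G} P lab v (hub v) (κ v) 1
      to-hub iv with hub-attached iv
      ... | j , _ , at , q = bridge (out-attached iv) at (sym q) 1 (inj₁ refl)

      to-hub-long : ∀ {v} → Int v → isHub (hub v) ≡ false → Detour {G = G} P lab v (hub v) (κ v) 2
      to-hub-long {v} iv nh with kind iv
      ... | at-x _ e   = ⊥-elim (false-hub nh (inj₁ e))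
      ... | at-y _ _ e = ⊥-elim (false-hub nh (inj₂ (inj₁ e)))
      ... | big b e    = ⊥-elim (false-hub nh (inj₂ (inj₂ (subst (_∈ sel) (sym e) (proj₁ (pick-spec b))))))
      ... | pair nx ny e c = bridge (out-attached iv) (out-attached ih) (sym q) 2 (inj₂ (refl , pair-long iv ih only))
        where
        ih = proj₁ (members-∈ (κ v) (proj₂ (pair-other e c)))
        q  = proj₂ (members-∈ (κ v) (proj₂ (pair-other e c)))
        only : ∀ {s j} → s ∈ P → Attached s j → lab j ≡ κ v → s ≡ v ⊎ s ≡ hub v
        only i at r = choose c (subst (_ ∈_) e (attached-member i at r nx ny))
          where
          choose : ∀ {s v h a b} → (v ≡ a × h ≡ b) ⊎ (v ≡ b × h ≡ a) → s ∈ a ∷ b ∷ [] → s ≡ v ⊎ s ≡ h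
          choose (inj₁ (refl , refl)) (here r)         = inj₁ r
          choose (inj₁ (refl , refl)) (there (here r)) = inj₂ r
          choose (inj₂ (refl , refl)) (here r)         = inj₂ r
          choose (inj₂ (refl , refl)) (there (here r)) = inj₁ r

      -- Unlike `x` and `y`, any other hub belongs to the class that it serves; this is why two
      -- spokes with such a hub are joined by a detour in `across`.
      big-hub : ∀ {v} → Int v → isHub (hub v) ≡ true → hub v ≢ x → hub v ≢ y → κ (hub v) ≡ κ v
      big-hub {v} iv h hx hy with kind iv
      ... | at-x _ e       = ⊥-elim (hx e)
      ... | at-y _ _ e     = ⊥-elim (hy e)
      ... | big b e        = trans (cong κ e) (proj₂ (pick-spec b))
      ... | pair _ _ e c   = proj₂ (members-∈ (κ v) (proj₂ (pair-other e c)))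

      across : ∀ {u v} → Int u → Int v → hub u ≡ hub v → u ≢ v → isHub (hub u) ≡ true → hub u ≢ x → hub u ≢ y →
               Detour {G = G} P lab u v (κ u) 1
      across iu iv e _ h hx hy = bridge (out-attached iu) (out-attached iv)
        (trans (sym (big-hub iu h hx hy)) (trans (cong κ e) (big-hub iv (trans (cong isHub (sym e)) h) (hx ∘ trans e) (hy ∘ trans e)))) 1 (inj₁ refl)

      same-class : ∀ {u v} → Int u → Int v → κ u ≡ κ v → hub u ≡ hub v ⊎ u ≡ v ⊎ u ≡ hub v
      same-class {u} {v} iu iv e = compare (kind iu) (subst (λ k → Kind k v (hub v)) (sym e) (kind iv))
        where
        compare : ∀ {k g h} → Kind k u g → Kind k v h → g ≡ h ⊎ u ≡ v ⊎ u ≡ h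
        compare (at-x _ p) (at-x _ q)              = inj₁ (trans p (sym q))
        compare (at-x m _) (at-y nm _ _)           = ⊥-elim (nm m)
        compare (at-x m _) (pair nm _ _ _)         = ⊥-elim (nm m)
        compare (at-x m _) (big (nm , _) _)        = ⊥-elim (nm m)
        compare (at-y nm _ _) (at-x m _)           = ⊥-elim (nm m)
        compare (at-y _ _ p) (at-y _ _ q)          = inj₁ (trans p (sym q))
        compare (at-y _ m _) (pair _ nm _ _)       = ⊥-elim (nm m)
        compare (at-y _ m _) (big (_ , nm , _) _)  = ⊥-elim (nm m)
        compare (pair nm _ _ _) (at-x m _)         = ⊥-elim (nm m)
        compare (pair _ nm _ _) (at-y _ m _)       = ⊥-elim (nm m)
        compare (pair _ _ p _) (big b _)           = ⊥-elim (not-big-pair b p)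
        compare (big (nm , _) _) (at-x m _)        = ⊥-elim (nm m)
        compare (big (_ , nm , _) _) (at-y _ m _)  = ⊥-elim (nm m)
        compare (big b _) (pair _ _ p _)           = ⊥-elim (not-big-pair b p)
        compare (big _ p) (big _ q)                = inj₁ (trans p (sym q))
        compare {h = h} (pair {a} {b} _ _ p c) (pair _ _ q d) = match (trans (sym p) q) c d
          where
          match : ∀ {g a b a′ b′} → a ∷ b ∷ [] ≡ a′ ∷ b′ ∷ [] → (u ≡ a × g ≡ b) ⊎ (u ≡ b × g ≡ a) →
                  (v ≡ a′ × h ≡ b′) ⊎ (v ≡ b′ × h ≡ a′) → g ≡ h ⊎ u ≡ v ⊎ u ≡ h
          match refl (inj₁ (refl , refl)) (inj₁ (refl , refl)) = inj₁ refl
          match refl (inj₁ (refl , refl)) (inj₂ (refl , refl)) = inj₂ (inj₂ refl)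
          match refl (inj₂ (refl , refl)) (inj₁ (refl , refl)) = inj₂ (inj₂ refl)
          match refl (inj₂ (refl , refl)) (inj₂ (refl , refl)) = inj₁ refl

    -- The vertex after `x` is no chosen hub, since `x` is one.
    spoke-exists : Σ V Spoke
    spoke-exists = go ints P≡ ints-int nonempty
      where
      go : ∀ L → P ≡ x ∷ L ++ y ∷ [] → (∀ {v} → v ∈ L → Int v) → (Σ V λ o → o ∈ L) → Σ V Spoke
      go (o ∷ L) e h _ = o , h (here refl) , hub-false (hubs-sparse (subst (λ M → (x , o) ∈ steps M) (sym e) (here refl)) (inj₁ refl))
      go [] e h (_ , ())

    contradictory : ⊥
    contradictory = Descent.no-spoke H lab κ routes longest (proj₁ spoke-exists) (proj₂ spoke-exists)

  -- `x` has a neighbour other than `y`, from which a path avoiding `x` leads to `y`; so `P` has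
  -- more than two vertices.
  ints-nonempty : Σ V λ o → o ∈ ints
  ints-nonempty = go ints P≡
    where
    go : ∀ L → P ≡ x ∷ L ++ y ∷ [] → Σ V λ o → o ∈ L
    go (o ∷ _) e = o , here refl
    go [] e with other-neighbour G cubic x x y
    ... | z , a , z≢x , z≢y with proj₂ (proj₂ two-connected) x z y z≢x (x≢y ∘ sym)
    ...   | L , (w , u) , x∉ = ⊥-elim (<-irrefl refl (≤-trans (s≤s (≤-reflexive (cong length e)))
              (≤-trans (s≤s (long w)) (longest (x ∷ L) (step a w , ∷-unique x∉ u)))))
      where
      long : ∀ {L} → Walk G z y L → 2 ≤ length L
      long (single _) = ⊥-elim (z≢y refl)
      long (step _ (single _)) = s≤s (s≤s z≤n)
      long (step _ (step _ _)) = s≤s (s≤s z≤n)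

  impossible : ⊥
  impossible = contradictory ints-nonempty

theorem1p5 : {n : ℕ} (G : Graph n) → TwoConnected G → Cubic G →
    (x y : Fin n) → x ≢ y → (P : List (Fin n)) → LongestPath G x y P →
    Σ (Fin n) λ v → Internal G x y P v × Bound G P v
theorem1p5 G two-connected cubic x y x≢y P (path , longest)
  with Fin.any? (λ v → internal? v ×-dec bound? v)
  where
  internal? : ∀ v → Dec (Internal G x y P v)
  internal? v = (v ∈? P) ×-dec ¬? (v Fin.≟ x) ×-dec ¬? (v Fin.≟ y)
  bound? : ∀ v → Dec (Bound G P v)
  bound? v = (v ∈? P) ×-dec Fin.all? (λ w → (adj G v w Bool.≟ true) →-dec (w ∈? P))
... | yes found = found
... | no none = ⊥-elim (Unbound.impossible G two-connected cubic x≢y path longest′ unbound)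
  where
  longest′ : ∀ R → IsPath G x y R → length R ≤ length P
  longest′ R p = pred-cancel R (proj₁ path) (longest R p)
    where
    -- `P` is nonempty, so the truncated subtraction in `pathLength` hides nothing.
    pred-cancel : ∀ R {Q} → Walk G x y Q → length R ∸ 1 ≤ length Q ∸ 1 → length R ≤ length Q
    pred-cancel [] _ l = z≤n
    pred-cancel (_ ∷ _) (single _) l = s≤s l
    pred-cancel (_ ∷ _) (step _ _) l = s≤s l
  unbound : ∀ v → v ∈ P → v ≢ x → v ≢ y → Σ _ λ k → adj G v k ≡ true × k ∉ P
  unbound v i p q with Fin.any? (λ k → (adj G v k Bool.≟ true) ×-dec ¬? (k ∈? P))
  ... | yes found = found
  ... | no no-exit = ⊥-elim (none (v , (i , p , q) , i , λ w a → decidable-stable (w ∈? P) λ w∉ → no-exit (w , a , w∉)))
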